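{- (a) If $w$ is a word of length $\ell$, then $w$ is not $d$-slantable for any integer $d\geq 8\log_2\ell+47$. (b) If $\ell>1$ is an integer all of whose prime factors are at least $2^d$, then the word $\mathsf{A}\mathsf{B}^{\ell-1}$ (one letter $\mathsf A$ followed by $\ell-1$ copies of a distinct letter $\mathsf B$) is $d$-slantable.
   Context: A word is a finite string $w=w_0w_1\cdots w_{\ell-1}$ of letters; words are assumed to contain at least two distinct letters. A $d$-dimensional grid $\Gamma$ of shape $G=\prod_{i=1}^d\mathbb Z/n_i\mathbb Z$ is a map $\Gamma\colon G\to\Sigma$ to an alphabet; its size is $|G|$. An appearance of $w$ in $\Gamma$ is a pair $(p,\mathbf v)\in G\times(\{ -1,0,1\}^d\setminus\{\mathbf 0\})$ with $\Gamma(p+i\mathbf v)=w_i$ for all $0\le i<\ell$. The concentration $c_d(w,\Gamma)$ is the number of appearances divided by $|G|$, and $C_d(w)$ is the supremum of $c_d(w,\Gamma)$ over all $d$-dimensional grids. A word $w$ is called $d$-slantable if $C_d(w)=\frac{3^d-1}{2}C_1(w)$. -}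

module Defs where

open import Data.Nat using (ℕ; zero; suc; _+_; _*_; _∸_; _^_; _≤_; _%_)
import Data.Nat
open import Data.Nat.Properties using (_≟_)
open import Data.Bool using (Bool; true; false; if_then_else_; _∧_)
open import Data.List as List using (List; []; _∷_; length; upTo; concatMap; map; replicate)
open import Data.Nat.ListAction using (sum)
open import Data.Vec as Vec using (Vec; []; _∷_)
open import Data.Vec.Relation.Unary.All using (All)
open import Data.Integer as ℤ using (+_)
open import Data.Rational.Unnormalised as ℚ using (ℚᵘ; mkℚᵘ; 0ℚᵘ)
open import Data.Product using (Σ; ∃; ∃-syntax; _×_; _,_)
open import Data.List.Membership.Propositional using (_∈_)
open import Relation.Nullary using (¬_; does)
open import Relation.Binary.PropositionalEquality using (_≢_)

IsWord : List ℕ → Set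
IsWord w = ∃[ a ] ∃[ b ] (a ≢ b × a ∈ w × b ∈ w)

-- reduction modulo n (only used with n ≥ 1)
_mod_ : ℕ → ℕ → ℕ
x mod zero = x
x mod suc n = x % suc n

-- A d-dimensional grid of shape ∏ ℤ/n_i: the shape (all n_i ≥ 1) and a
-- labelling.  Positions are coordinate vectors with 0 ≤ p_i < n_i; the
-- labelling is given as a function on Vec ℕ d and only its values on
-- reduced positions matter.
record Grid (d : ℕ) : Set where
  field
    shape    : Vec ℕ d
    shapePos : All (1 ≤_) shape
    label    : Vec ℕ d → ℕ
open Grid public

positions : ∀ {d} → Vec ℕ d → List (Vec ℕ d)
positions []       = [] ∷ []
positions (n ∷ ns) = concatMap (λ i → map (i ∷_) (positions ns)) (upTo n)

size : ∀ {d} → Vec ℕ d → ℕ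
size = Vec.foldr _ _*_ 1

data Dir : Set where
  neg zer pos : Dir

allDirVecs : (d : ℕ) → List (Vec Dir d)
allDirVecs zero    = [] ∷ []
allDirVecs (suc d) = concatMap (λ v → map (_∷ v) (neg ∷ zer ∷ pos ∷ [])) (allDirVecs d)

isNonzero : ∀ {d} → Vec Dir d → Bool
isNonzero []        = false
isNonzero (zer ∷ v) = isNonzero v
isNonzero (neg ∷ v) = true
isNonzero (pos ∷ v) = true

step : ℕ → ℕ → Dir → ℕ → ℕ
step n p neg i = (p + i * (n ∸ 1)) mod n
step n p zer i = p mod n
step n p pos i = (p + i) mod n

shift : ∀ {d} → Vec ℕ d → Vec ℕ d → Vec Dir d → ℕ → Vec ℕ d
shift []       []       []       i = []
shift (n ∷ ns) (p ∷ ps) (v ∷ vs) i = step n p v i ∷ shift ns ps vs i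

appearsFrom : ∀ {d} → Grid d → Vec ℕ d → Vec Dir d → ℕ → List ℕ → Bool
appearsFrom Γ p v i []       = true
appearsFrom Γ p v i (a ∷ w) =
  does (label Γ (shift (shape Γ) p v i) ≟ a) ∧ appearsFrom Γ p v (suc i) w

appears : ∀ {d} → Grid d → Vec ℕ d → Vec Dir d → List ℕ → Bool
appears Γ p v w = isNonzero v ∧ appearsFrom Γ p v 0 w

appearances : ∀ {d} → List ℕ → Grid d → ℕ
appearances {d} w Γ =
  sum (concatMap (λ p → map (λ v → if appears Γ p v w then 1 else 0) (allDirVecs d))
                 (positions (shape Γ)))

-- concentration c_d(w, Γ) = #appearances / |G|   (|G| ≥ 1, so the
-- denominator field  |G| - 1  of mkℚᵘ encodes the denominator |G|)
conc : ∀ {d} → List ℕ → Grid d → ℚᵘ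
conc w Γ = mkℚᵘ (+ appearances w Γ) (size (shape Γ) ∸ 1)

-- (3^d - 1)/2, an integer since 3^d is odd
K : ℕ → ℕ
K d = (3 ^ d ∸ 1) Data.Nat./ 2

-- C_d(w) = K_d · C_1(w), with C_d(w) = sup_Γ c_d(w,Γ); equality of the two
-- suprema (both of bounded nonempty sets of rationals) written out:
-- every value on one side is ≤ (up to any ε > 0) some value on the other.
Slantable : ℕ → List ℕ → Set
Slantable d w =
  ((Γ : Grid d) (ε : ℚᵘ) → ε ℚ.> 0ℚᵘ →
     ∃[ Δ ] (conc w Γ ℚ.≤ (mkℚᵘ (+ K d) 0 ℚ.* conc {1} w Δ) ℚ.+ ε))
  × ((Δ : Grid 1) (ε : ℚᵘ) → ε ℚ.> 0ℚᵘ →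
     ∃[ Γ ] (mkℚᵘ (+ K d) 0 ℚ.* conc w Δ ℚ.≤ conc {d} w Γ ℚ.+ ε))

{-# OPTIONS --safe #-}

-- A line of the grid read in direction ±v is covered by occurrences of w and
-- of its reversal.  If b, q, r are the lengths of the longest proper border,
-- palindromic suffix and palindromic prefix of w, then consecutive occurrences
-- are on average at least D / 2 letters apart, D = 2ℓ − max (2b, q + r), and a
-- periodic word attains this, which gives C₁(w).
--
-- (a) If C_d(w) = K_d C₁(w), then up to a negligible set of defects every line
-- in every direction v ∈ {−1,0,1}^d ∖ {0} is optimal, and on optimal lines the
-- number of occurrences of a letter A has bounded discrepancy.  Let φ be the
-- centred indicator of A and W_v(x) = ∑_{s<N} φ(x + sv).  Summing W_v(x)² over
-- x and over v = y − y′ with y, y′ ∈ {0,1}^d gives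
--   ∑_{s,t<N} ∑_x (∑_y φ(x + (s−t)y))² ≥ N 4^d ∑_x φ(x)²,
-- whereas bounded discrepancy makes each term with v ≠ 0 polynomial in ℓ per
-- point.  For N = 2^(d−1) these are incompatible.
--
-- (b) Label x ∈ (ℤ/ℓ)^d by A exactly when ∑ 2^i x_i ≡ 0.  For v ≠ 0 the number
-- ∑ 2^i v_i is nonzero and smaller than 2^d in absolute value, hence a unit
-- modulo ℓ, so every line reads A B^(ℓ−1) periodically.

module Submission where

open import Defs
open import Data.Nat as ℕ using (ℕ; zero; suc; _+_; _*_; _∸_; _^_; _⊔_; _≤_; _<_; z≤n; s≤s; _≟_; _≤?_; _<?_; _%_; _/_; NonZero)
import Data.Nat.Properties as ℕₚ
import Data.Nat.DivMod as ℕ-DivMod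
open import Data.Nat.Coprimality using (Coprime; coprime-divisor)
open import Data.Nat.Divisibility using (_∣_; divides; _∣?_; ∣⇒≤; ∣-trans; m∣m*n)
open import Data.Nat.ListAction using (sum)
open import Data.Nat.Primality using (Prime)
open import Data.Nat.Primality.Factorisation using (factorise)
import Data.Nat.Tactic.RingSolver as ℕ-Ring
open import Data.Integer.Base as ℤ using (ℤ; +_; -[1+_]; 0ℤ; 1ℤ; -1ℤ) renaming (∣_∣ to abs; _+_ to _+ᶻ_; _*_ to _*ᶻ_; _-_ to _-ᶻ_; -_ to -ᶻ_; _≤_ to _≤ᶻ_)
open import Data.Integer.DivMod using (_%ℕ_; _/ℕ_; n%ℕd<d; a≡a%ℕn+[a/ℕn]*n)
import Data.Integer.Properties as ℤₚ
import Data.Integer.Tactic.RingSolver as ℤ-Ring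
import Algebra.Properties.AbelianGroup ℤₚ.+-0-abelianGroup as ℤ-Group
open import Data.Rational.Unnormalised as ℚ using (ℚᵘ; mkℚᵘ; 0ℚᵘ)
import Data.Rational.Unnormalised.Properties as ℚₚ
open import Data.Bool using (Bool; true; false; if_then_else_; _∧_)
open import Data.Empty using (⊥; ⊥-elim)
open import Data.List using (List; []; _∷_; _++_; length; replicate; map; concatMap; upTo; downFrom)
import Data.List.Properties as Listₚ
open import Data.List.Membership.Propositional using (_∈_)
open import Data.List.Membership.Propositional.Properties using (∈-upTo⁻; ∈-downFrom⁺; ∈-map⁺; ∈-concatMap⁺)
open import Data.List.Relation.Unary.All using () renaming (_∷_ to _∷ᴬ_)
open import Data.List.Relation.Unary.Any as Any using (here; there)
open import Data.Maybe using (Maybe; just; nothing; _<∣>_; maybe′) renaming (map to mapᴹ)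
open import Data.Product using (∃-syntax; _×_; _,_; proj₁; proj₂; map₂)
open import Data.Sum using (_⊎_; inj₁; inj₂)
open import Data.Vec as Vec using (Vec; []; _∷_)
open import Data.Vec.Relation.Unary.All using (All; []; _∷_)
open import Function using (_∘_)
open import Function.Bundles using (mk⇔)
open import Relation.Nullary using (¬_; Dec; yes; no; does; _→-dec_)
open import Relation.Nullary.Decidable using (does-⇔; map′; dec-true; dec-false)
open import Relation.Binary.PropositionalEquality

-- Finite sums of integers

-- Slantability only provides grids approaching a supremum, so optimality has to be used
-- quantitatively. Each step along a line changes an `energy` of the occurrence in sight, and the
-- slack in `D * f + energy σ′ ≤ 2 + energy σ` is a natural number, the defect. Summed over the
-- torus the energies cancel, so the deficit of a grid in its upper bound is measured exactly by its
-- total defect, which slantability makes at most |G| / X for any prescribed X.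
--
-- Bounded discrepancy is local in the same way: a bounded `height` of the state increases by φ of
-- the current letter wherever the defect vanishes, and the error elsewhere is charged to the
-- defect. The obstacle is the tie 2b = q + r, where two kinds of optimal pattern can be mixed on
-- one line; φ can be centred only because both have the same density of A.
--
-- The size of N comes from the pairs y = y′. Their direction is 0, no discrepancy bound applies,
-- and they may contribute 2^d N² V, where V = ∑ φ². The lower bound N 4^d V is twice that when 2^d
-- = 2N, so half of it is left for the nonzero directions.

private variable
  Ix Jx : Set

-- Integer inequalities are proved by exhibiting the difference as a
-- visibly nonnegative expression.
≤-by : ∀ {a b} c → 0ℤ ≤ᶻ c → b ≡ a +ᶻ c → a ≤ᶻ b
≤-by {a} c 0≤c refl = subst (_≤ᶻ a +ᶻ c) (ℤₚ.+-identityʳ a) (ℤₚ.+-monoʳ-≤ a 0≤c)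

0≤-+ : ∀ {a b} → 0ℤ ≤ᶻ a → 0ℤ ≤ᶻ b → 0ℤ ≤ᶻ a +ᶻ b
0≤-+ = ℤₚ.+-mono-≤

0≤-* : ∀ {a b} → 0ℤ ≤ᶻ a → 0ℤ ≤ᶻ b → 0ℤ ≤ᶻ a *ᶻ b
0≤-* {+ m} {+ n} _ _ = subst (0ℤ ≤ᶻ_) (ℤₚ.pos-* m n) (ℤ.+≤+ z≤n)

0≤+ : ∀ {n} → 0ℤ ≤ᶻ + n
0≤+ = ℤ.+≤+ z≤n

0≤sq : ∀ a → 0ℤ ≤ᶻ a *ᶻ a
0≤sq (+ n)      = 0≤-* {+ n} {+ n} 0≤+ 0≤+
0≤sq (-[1+ n ]) = 0≤+

∸-nonneg : ∀ {a b} → a ≤ᶻ b → 0ℤ ≤ᶻ b -ᶻ a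
∸-nonneg = ℤₚ.i≤j⇒0≤j-i

∑ : List Ix → (Ix → ℤ) → ℤ
∑ []       f = 0ℤ
∑ (x ∷ xs) f = f x +ᶻ ∑ xs f

∑-cong : ∀ (xs : List Ix) {f g : Ix → ℤ} → (∀ x → f x ≡ g x) → ∑ xs f ≡ ∑ xs g
∑-cong []       f≡g = refl
∑-cong (x ∷ xs) f≡g = cong₂ _+ᶻ_ (f≡g x) (∑-cong xs f≡g)

∑-mono : ∀ (xs : List Ix) {f g : Ix → ℤ} → (∀ x → f x ≤ᶻ g x) → ∑ xs f ≤ᶻ ∑ xs g
∑-mono []       f≤g = ℤₚ.≤-refl
∑-mono (x ∷ xs) f≤g = ℤₚ.+-mono-≤ (f≤g x) (∑-mono xs f≤g)

∑-nonneg : ∀ (xs : List Ix) {f : Ix → ℤ} → (∀ x → 0ℤ ≤ᶻ f x) → 0ℤ ≤ᶻ ∑ xs f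
∑-nonneg []       0≤f = ℤₚ.≤-refl
∑-nonneg (x ∷ xs) 0≤f = 0≤-+ (0≤f x) (∑-nonneg xs 0≤f)

interchange : ∀ a b c d → (a +ᶻ b) +ᶻ (c +ᶻ d) ≡ (a +ᶻ c) +ᶻ (b +ᶻ d)
interchange = ℤ-Ring.solve-∀

∑-+ : ∀ (xs : List Ix) (f g : Ix → ℤ) → ∑ xs (λ x → f x +ᶻ g x) ≡ ∑ xs f +ᶻ ∑ xs g
∑-+ []       f g = refl
∑-+ (x ∷ xs) f g = trans (cong (λ s → (f x +ᶻ g x) +ᶻ s) (∑-+ xs f g))
                         (interchange (f x) (g x) (∑ xs f) (∑ xs g))

∑-*ˡ : ∀ (xs : List Ix) c (f : Ix → ℤ) → ∑ xs (λ x → c *ᶻ f x) ≡ c *ᶻ ∑ xs f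
∑-*ˡ []       c f = sym (ℤₚ.*-zeroʳ c)
∑-*ˡ (x ∷ xs) c f = trans (cong (λ s → c *ᶻ f x +ᶻ s) (∑-*ˡ xs c f))
                          (sym (ℤₚ.*-distribˡ-+ c (f x) (∑ xs f)))

∑-*ʳ : ∀ (xs : List Ix) c (f : Ix → ℤ) → ∑ xs (λ x → f x *ᶻ c) ≡ ∑ xs f *ᶻ c
∑-*ʳ xs c f = trans (∑-cong xs (λ x → ℤₚ.*-comm (f x) c))
             (trans (∑-*ˡ xs c f) (ℤₚ.*-comm c (∑ xs f)))

suc-*-pos : ∀ n c → c +ᶻ + n *ᶻ c ≡ + suc n *ᶻ c
suc-*-pos n c = sym (ℤₚ.suc-* (+ n) c)

∑-const : ∀ (xs : List Ix) c → ∑ xs (λ _ → c) ≡ + length xs *ᶻ c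
∑-const []       c = sym (ℤₚ.*-zeroˡ c)
∑-const (x ∷ xs) c = trans (cong (c +ᶻ_) (∑-const xs c)) (suc-*-pos (length xs) c)

∑-swap : ∀ (xs : List Ix) (ys : List Jx) (f : Ix → Jx → ℤ) →
         ∑ xs (λ x → ∑ ys (f x)) ≡ ∑ ys (λ y → ∑ xs (λ x → f x y))
∑-swap []       ys f = sym (trans (∑-const ys 0ℤ) (ℤₚ.*-zeroʳ (+ length ys)))
∑-swap (x ∷ xs) ys f = trans (cong (∑ ys (f x) +ᶻ_) (∑-swap xs ys f))
                             (sym (∑-+ ys (f x) (λ y → ∑ xs (λ x′ → f x′ y))))

∑-product : ∀ (xs : List Ix) (ys : List Jx) (f : Ix → ℤ) (g : Jx → ℤ) →
            ∑ xs (λ x → ∑ ys (λ y → f x *ᶻ g y)) ≡ ∑ xs f *ᶻ ∑ ys g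
∑-product xs ys f g = trans (∑-cong xs (λ x → ∑-*ˡ ys (f x) g)) (∑-*ʳ xs (∑ ys g) f)

∑-++ : ∀ (xs ys : List Ix) (f : Ix → ℤ) → ∑ (xs ++ ys) f ≡ ∑ xs f +ᶻ ∑ ys f
∑-++ []       ys f = sym (ℤₚ.+-identityˡ _)
∑-++ (x ∷ xs) ys f = trans (cong (f x +ᶻ_) (∑-++ xs ys f)) (sym (ℤₚ.+-assoc (f x) _ _))

∑-map : ∀ (g : Ix → Jx) xs (f : Jx → ℤ) → ∑ (map g xs) f ≡ ∑ xs (f ∘ g)
∑-map g []       f = refl
∑-map g (x ∷ xs) f = cong (f (g x) +ᶻ_) (∑-map g xs f)

∑-concatMap : ∀ (g : Ix → List Jx) xs (f : Jx → ℤ) →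
              ∑ (concatMap g xs) f ≡ ∑ xs (λ x → ∑ (g x) f)
∑-concatMap g []       f = refl
∑-concatMap g (x ∷ xs) f = trans (∑-++ (g x) (concatMap g xs) f)
                                 (cong (∑ (g x) f +ᶻ_) (∑-concatMap g xs f))

∑-sum : ∀ xs → + sum xs ≡ ∑ xs (λ x → + x)
∑-sum []       = refl
∑-sum (x ∷ xs) = trans (ℤₚ.pos-+ x (sum xs)) (cong (+ x +ᶻ_) (∑-sum xs))

∑-term : ∀ {xs : List Ix} {x} (f : Ix → ℤ) → (∀ y → 0ℤ ≤ᶻ f y) → x ∈ xs → f x ≤ᶻ ∑ xs f
∑-term {xs = _ ∷ xs} {x} f 0≤f (here refl) = ≤-by (∑ xs f) (∑-nonneg xs 0≤f) refl
∑-term {xs = y ∷ xs} {x} f 0≤f (there x∈xs) =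
  ℤₚ.≤-trans (∑-term f 0≤f x∈xs) (≤-by (f y) (0≤f y) (ℤₚ.+-comm (f y) (∑ xs f)))

∑-cong-∈ : ∀ (xs : List Ix) {f g : Ix → ℤ} → (∀ {x} → x ∈ xs → f x ≡ g x) → ∑ xs f ≡ ∑ xs g
∑-cong-∈ []       f≡g = refl
∑-cong-∈ (x ∷ xs) f≡g = cong₂ _+ᶻ_ (f≡g (here refl)) (∑-cong-∈ xs (f≡g ∘ there))

∑-upTo : ∀ n (f : ℕ → ℤ) → ∑ (upTo n) f ≡ ∑ (downFrom n) f
∑-upTo zero    f = refl
∑-upTo (suc n) f = begin
  ∑ (upTo (suc n)) f                ≡⟨ cong (λ xs → ∑ xs f) (sym (Listₚ.upTo-∷ʳ n)) ⟩
  ∑ (upTo n ++ n ∷ []) f            ≡⟨ ∑-++ (upTo n) (n ∷ []) f ⟩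
  ∑ (upTo n) f +ᶻ (f n +ᶻ 0ℤ)     ≡⟨ cong₂ _+ᶻ_ (∑-upTo n f) (ℤₚ.+-identityʳ (f n)) ⟩
  ∑ (downFrom n) f +ᶻ f n          ≡⟨ ℤₚ.+-comm (∑ (downFrom n) f) (f n) ⟩
  f n +ᶻ ∑ (downFrom n) f          ∎
  where open ≡-Reasoning

telescope : ∀ n (h : ℕ → ℤ) → ∑ (downFrom n) (λ t → h (suc t) -ᶻ h t) ≡ h n -ᶻ h 0
telescope zero    h = sym (ℤₚ.+-inverseʳ (h 0))
telescope (suc n) h = trans (cong (h (suc n) -ᶻ h n +ᶻ_) (telescope n h)) (lem (h (suc n)) (h n) (h 0))
  where
  lem : ∀ a b c → (a -ᶻ b) +ᶻ (b -ᶻ c) ≡ a -ᶻ c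
  lem = ℤ-Ring.solve-∀

square-of-sum : ∀ (xs : List Ix) (f : Ix → ℤ) →
                ∑ xs f *ᶻ ∑ xs f ≡ ∑ xs (λ x → ∑ xs (λ y → f x *ᶻ f y))
square-of-sum xs f = sym (∑-product xs xs f f)

-- By induction on the list, without division: the new term a adds ∑ (a - f y)², expanded in `dev≡`,
-- to the slack of the induction hypothesis.
cauchy-schwarz : ∀ (xs : List Ix) (f : Ix → ℤ) →
                 ∑ xs f *ᶻ ∑ xs f ≤ᶻ + length xs *ᶻ ∑ xs (λ x → f x *ᶻ f x)
cauchy-schwarz []       f = ℤₚ.≤-refl
cauchy-schwarz (x ∷ xs) f =
  ≤-by _ (0≤-+ (∸-nonneg (cauchy-schwarz xs f)) dev≥0) (lem (f x) (∑ xs f) (+ length xs) _)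
  where
  a = f x
  expand : ∀ a b → (a -ᶻ b) *ᶻ (a -ᶻ b) ≡ a *ᶻ a +ᶻ ((-ᶻ (+ 2) *ᶻ a) *ᶻ b +ᶻ b *ᶻ b)
  expand = ℤ-Ring.solve-∀
  dev≡ : ∑ xs (λ y → (a -ᶻ f y) *ᶻ (a -ᶻ f y)) ≡
         + length xs *ᶻ (a *ᶻ a) +ᶻ ((-ᶻ (+ 2) *ᶻ a) *ᶻ ∑ xs f +ᶻ ∑ xs (λ y → f y *ᶻ f y))
  dev≡ = begin
    ∑ xs (λ y → (a -ᶻ f y) *ᶻ (a -ᶻ f y))
      ≡⟨ ∑-cong xs (λ y → expand a (f y)) ⟩
    ∑ xs (λ y → a *ᶻ a +ᶻ ((-ᶻ (+ 2) *ᶻ a) *ᶻ f y +ᶻ f y *ᶻ f y))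
      ≡⟨ ∑-+ xs (λ _ → a *ᶻ a) (λ y → (-ᶻ (+ 2) *ᶻ a) *ᶻ f y +ᶻ f y *ᶻ f y) ⟩
    ∑ xs (λ _ → a *ᶻ a) +ᶻ ∑ xs (λ y → (-ᶻ (+ 2) *ᶻ a) *ᶻ f y +ᶻ f y *ᶻ f y)
      ≡⟨ cong₂ _+ᶻ_ (∑-const xs (a *ᶻ a)) (trans (∑-+ xs (λ y → (-ᶻ (+ 2) *ᶻ a) *ᶻ f y) (λ y → f y *ᶻ f y))
                      (cong (_+ᶻ ∑ xs (λ y → f y *ᶻ f y)) (∑-*ˡ xs (-ᶻ (+ 2) *ᶻ a) f))) ⟩
    _ ∎
    where open ≡-Reasoning
  dev≥0 : 0ℤ ≤ᶻ + length xs *ᶻ (a *ᶻ a) +ᶻ ((-ᶻ (+ 2) *ᶻ a) *ᶻ ∑ xs f +ᶻ ∑ xs (λ y → f y *ᶻ f y))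
  dev≥0 = subst (0ℤ ≤ᶻ_) dev≡ (∑-nonneg xs (λ y → 0≤sq (a -ᶻ f y)))
  lem : ∀ a b n s → (1ℤ +ᶻ n) *ᶻ (a *ᶻ a +ᶻ s) ≡
        (a +ᶻ b) *ᶻ (a +ᶻ b) +ᶻ ((n *ᶻ s -ᶻ b *ᶻ b) +ᶻ (n *ᶻ (a *ᶻ a) +ᶻ ((-ᶻ (+ 2) *ᶻ a) *ᶻ b +ᶻ s)))
  lem = ℤ-Ring.solve-∀

-- Translations of the torus

-- Reduction modulo n (with the junk value 0 for n = 0).
_modᶻ_ : ℤ → ℕ → ℕ
x modᶻ zero  = 0
x modᶻ suc n = x %ℕ suc n

remainder-unique : ∀ {r s} n k → r < suc n → s < suc n → + r ≡ + s +ᶻ k *ᶻ + suc n → r ≡ s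
remainder-unique {r} {s} n (+ k) r< s< eq =
  trans (sym (ℕ-DivMod.m<n⇒m%n≡m r<)) (trans (cong (_% suc n) r≡) (trans (ℕ-DivMod.[m+kn]%n≡m%n s k (suc n)) (ℕ-DivMod.m<n⇒m%n≡m s<)))
  where
  r≡ : r ≡ s + k * suc n
  r≡ = ℤₚ.+-injective (trans eq (trans (cong (+ s +ᶻ_) (sym (ℤₚ.pos-* k (suc n)))) (sym (ℤₚ.pos-+ s (k * suc n)))))
-- A negative quotient becomes a positive one when r and s trade places.
remainder-unique {r} {s} n -[1+ k ] r< s< eq =
  sym (remainder-unique n (+ suc k) s< r< (trans (lem (+ s) -[1+ k ] (+ suc n)) (cong (λ x → x +ᶻ + suc k *ᶻ + suc n) (sym eq))))
  where
  lem : ∀ s k n → s ≡ s +ᶻ k *ᶻ n +ᶻ (-ᶻ k) *ᶻ n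
  lem = ℤ-Ring.solve-∀

modᶻ-cong : ∀ x y k n → x ≡ y +ᶻ k *ᶻ + n → x modᶻ n ≡ y modᶻ n
modᶻ-cong x y k zero    eq = refl
modᶻ-cong x y k (suc n) eq =
  remainder-unique n (y /ℕ suc n +ᶻ k -ᶻ x /ℕ suc n) (n%ℕd<d x (suc n)) (n%ℕd<d y (suc n))
    (lem x y (+ (x modᶻ suc n)) (+ (y modᶻ suc n)) (x /ℕ suc n) (y /ℕ suc n) k (+ suc n)
         (a≡a%ℕn+[a/ℕn]*n x (suc n)) (a≡a%ℕn+[a/ℕn]*n y (suc n)) eq)
  where
  ring₁ : ∀ r qx n → r ≡ (r +ᶻ qx *ᶻ n) -ᶻ qx *ᶻ n
  ring₁ = ℤ-Ring.solve-∀
  ring₂ : ∀ s qx qy k n → (s +ᶻ qy *ᶻ n +ᶻ k *ᶻ n) -ᶻ qx *ᶻ n ≡ s +ᶻ (qy +ᶻ k -ᶻ qx) *ᶻ n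
  ring₂ = ℤ-Ring.solve-∀
  lem : ∀ x y r s qx qy k n → x ≡ r +ᶻ qx *ᶻ n → y ≡ s +ᶻ qy *ᶻ n → x ≡ y +ᶻ k *ᶻ n →
        r ≡ s +ᶻ (qy +ᶻ k -ᶻ qx) *ᶻ n
  lem x y r s qx qy k n x≡ y≡ x≡y = begin
    r                                     ≡⟨ ring₁ r qx n ⟩
    (r +ᶻ qx *ᶻ n) -ᶻ qx *ᶻ n             ≡⟨ cong (_-ᶻ qx *ᶻ n) (sym x≡) ⟩
    x -ᶻ qx *ᶻ n                          ≡⟨ cong (_-ᶻ qx *ᶻ n) x≡y ⟩
    (y +ᶻ k *ᶻ n) -ᶻ qx *ᶻ n              ≡⟨ cong (λ z → (z +ᶻ k *ᶻ n) -ᶻ qx *ᶻ n) y≡ ⟩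
    (s +ᶻ qy *ᶻ n +ᶻ k *ᶻ n) -ᶻ qx *ᶻ n   ≡⟨ ring₂ s qx qy k n ⟩
    s +ᶻ (qy +ᶻ k -ᶻ qx) *ᶻ n             ∎
    where open ≡-Reasoning

modᶻ-decompose : ∀ x n → 1 ≤ n → ∃[ k ] + (x modᶻ n) ≡ x +ᶻ k *ᶻ + n
modᶻ-decompose x (suc n) _ = -ᶻ (x /ℕ suc n) ,
  trans (lem (+ (x modᶻ suc n)) (x /ℕ suc n) (+ suc n))
        (cong (λ z → z +ᶻ (-ᶻ (x /ℕ suc n)) *ᶻ + suc n) (sym (a≡a%ℕn+[a/ℕn]*n x (suc n))))
  where
  lem : ∀ r q n → r ≡ (r +ᶻ q *ᶻ n) +ᶻ (-ᶻ q) *ᶻ n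
  lem = ℤ-Ring.solve-∀

modᶻ-absorb : ∀ x a n → (+ (x modᶻ n) +ᶻ a) modᶻ n ≡ (x +ᶻ a) modᶻ n
modᶻ-absorb x a zero = refl
modᶻ-absorb x a n@(suc _) with modᶻ-decompose x n (s≤s z≤n)
... | k , eq = modᶻ-cong _ (x +ᶻ a) k n (trans (cong (_+ᶻ a) eq) (lem x a (k *ᶻ + n)))
  where
  lem : ∀ x a y → (x +ᶻ y) +ᶻ a ≡ (x +ᶻ a) +ᶻ y
  lem = ℤ-Ring.solve-∀

_⊕_ : ∀ {d} → Vec ℤ d → Vec ℤ d → Vec ℤ d
_⊕_ = Vec.zipWith _+ᶻ_

_⊙_ : ∀ {d} → ℤ → Vec ℤ d → Vec ℤ d
k ⊙ h = Vec.map (k *ᶻ_) h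

infixl 6 _⊕_
infixl 7 _⊙_

-- Displacements are integer vectors, so that steps in direction -1 and time differences s - t need
-- no case distinction.
translate : ∀ {d} → Vec ℕ d → Vec ℤ d → Vec ℕ d → Vec ℕ d
translate []       []      []      = []
translate (n ∷ ns) (a ∷ h) (i ∷ p) = (+ i +ᶻ a) modᶻ n ∷ translate ns h p

translate-∘ : ∀ {d} (ns : Vec ℕ d) h h′ p →
              translate ns h (translate ns h′ p) ≡ translate ns (h ⊕ h′) p
translate-∘ []       []      []       []      = refl
translate-∘ (n ∷ ns) (a ∷ h) (b ∷ h′) (i ∷ p) = cong₂ _∷_
  (trans (modᶻ-absorb (+ i +ᶻ b) a n) (cong (_modᶻ n) (lem (+ i) a b)))
  (translate-∘ ns h h′ p)
  where
  lem : ∀ i a b → i +ᶻ b +ᶻ a ≡ i +ᶻ (a +ᶻ b)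
  lem = ℤ-Ring.solve-∀

-- Raising the shift by one drops the term at b and gains the term at n + b, which agree modulo n.
-- So the sum does not depend on the shift, and integer induction brings any shift to 0.
∑-rotate : ∀ n (f : ℕ → ℤ) a → ∑ (upTo n) (λ i → f ((+ i +ᶻ a) modᶻ n)) ≡ ∑ (upTo n) f
∑-rotate zero f a = refl
∑-rotate n@(suc n′) f a = trans (constant a) at-zero
  where
  F : ℤ → ℤ
  F x = f (x modᶻ n)
  R : ℤ → ℤ
  R b = ∑ (downFrom n) (λ i → F (+ i +ᶻ b))
  shifted : ∀ m b → ∑ (downFrom m) (λ i → F (+ i +ᶻ ℤ.suc b)) +ᶻ F b ≡
                    ∑ (downFrom m) (λ i → F (+ i +ᶻ b)) +ᶻ F (+ m +ᶻ b)
  shifted zero    b = cong (λ x → 0ℤ +ᶻ F x) (sym (ℤₚ.+-identityˡ b))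
  shifted (suc m) b = begin
    F (+ m +ᶻ ℤ.suc b) +ᶻ X +ᶻ F b        ≡⟨ ℤₚ.+-assoc (F (+ m +ᶻ ℤ.suc b)) X (F b) ⟩
    F (+ m +ᶻ ℤ.suc b) +ᶻ (X +ᶻ F b)      ≡⟨ cong₂ _+ᶻ_ (cong F (lem₁ (+ m) b)) (shifted m b) ⟩
    F (+ suc m +ᶻ b) +ᶻ (Y +ᶻ F (+ m +ᶻ b)) ≡⟨ lem₂ (F (+ suc m +ᶻ b)) Y (F (+ m +ᶻ b)) ⟩
    F (+ m +ᶻ b) +ᶻ Y +ᶻ F (+ suc m +ᶻ b)  ∎
    where
    open ≡-Reasoning
    X = ∑ (downFrom m) (λ i → F (+ i +ᶻ ℤ.suc b))
    Y = ∑ (downFrom m) (λ i → F (+ i +ᶻ b))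
    lem₁ : ∀ m b → m +ᶻ (1ℤ +ᶻ b) ≡ (1ℤ +ᶻ m) +ᶻ b
    lem₁ = ℤ-Ring.solve-∀
    lem₂ : ∀ x y z → x +ᶻ (y +ᶻ z) ≡ z +ᶻ y +ᶻ x
    lem₂ = ℤ-Ring.solve-∀
  R-suc : ∀ b → R (ℤ.suc b) ≡ R b
  R-suc b = ℤ-Group.∙-cancelʳ (F b) (R (ℤ.suc b)) (R b) (trans (shifted n b) (cong (λ y → R b +ᶻ f y)
    (modᶻ-cong (+ n +ᶻ b) b 1ℤ n (trans (ℤₚ.+-comm (+ n) b) (cong (b +ᶻ_) (sym (ℤₚ.*-identityˡ (+ n))))))))
  R-const : ∀ b → R b ≡ R 0ℤ
  R-const (+ zero)      = refl
  R-const (+ suc b)     = trans (R-suc (+ b)) (R-const (+ b))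
  R-const -[1+ zero ]   = sym (R-suc -[1+ zero ])
  R-const -[1+ suc b ]  = trans (sym (R-suc -[1+ suc b ])) (R-const -[1+ b ])
  constant : ∀ b → ∑ (upTo n) (λ i → F (+ i +ᶻ b)) ≡ ∑ (upTo n) (λ i → F (+ i +ᶻ 0ℤ))
  constant b = trans (∑-upTo n (λ i → F (+ i +ᶻ b))) (trans (R-const b) (sym (∑-upTo n (λ i → F (+ i +ᶻ 0ℤ)))))
  -- A zero shift still reduces modulo n; the indices below n are unaffected.
  at-zero : ∑ (upTo n) (λ i → F (+ i +ᶻ 0ℤ)) ≡ ∑ (upTo n) f
  at-zero = ∑-cong-∈ (upTo n) (λ {i} i∈ → cong f (trans (cong (_modᶻ n) (ℤₚ.+-identityʳ (+ i)))
                                                        (ℕ-DivMod.m<n⇒m%n≡m (∈-upTo⁻ i∈))))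

∑-positions : ∀ {d} n (ns : Vec ℕ d) (Ψ : Vec ℕ (suc d) → ℤ) →
              ∑ (positions (n ∷ ns)) Ψ ≡ ∑ (upTo n) (λ i → ∑ (positions ns) (λ p → Ψ (i ∷ p)))
∑-positions n ns Ψ = trans (∑-concatMap (λ i → map (i ∷_) (positions ns)) (upTo n) Ψ)
                           (∑-cong (upTo n) (λ i → ∑-map (i ∷_) (positions ns) Ψ))

-- This invariance carries every change of variables. Thanks to it all line statistics are sums over
-- the whole torus, and lines are never decomposed into cycles.
∑-translate : ∀ {d} (ns : Vec ℕ d) h (Ψ : Vec ℕ d → ℤ) →
              ∑ (positions ns) (λ p → Ψ (translate ns h p)) ≡ ∑ (positions ns) Ψ
∑-translate []       []      Ψ = refl
∑-translate (n ∷ ns) (a ∷ h) Ψ = begin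
  ∑ (positions (n ∷ ns)) (λ p → Ψ (translate (n ∷ ns) (a ∷ h) p))
    ≡⟨ ∑-positions n ns (λ p → Ψ (translate (n ∷ ns) (a ∷ h) p)) ⟩
  ∑ (upTo n) (λ i → ∑ (positions ns) (λ p → Ψ ((+ i +ᶻ a) modᶻ n ∷ translate ns h p)))
    ≡⟨ ∑-cong (upTo n) (λ i → ∑-translate ns h (λ p → Ψ ((+ i +ᶻ a) modᶻ n ∷ p))) ⟩
  ∑ (upTo n) (λ i → ∑ (positions ns) (λ p → Ψ ((+ i +ᶻ a) modᶻ n ∷ p)))
    ≡⟨ ∑-rotate n (λ j → ∑ (positions ns) (λ p → Ψ (j ∷ p))) a ⟩
  ∑ (upTo n) (λ i → ∑ (positions ns) (λ p → Ψ (i ∷ p)))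
    ≡⟨ ∑-positions n ns Ψ ⟨
  ∑ (positions (n ∷ ns)) Ψ ∎
  where open ≡-Reasoning

∑-positions-const : ∀ {d} (ns : Vec ℕ d) c → ∑ (positions ns) (λ _ → c) ≡ + size ns *ᶻ c
∑-positions-const []       c = trans (ℤₚ.+-identityʳ c) (sym (ℤₚ.*-identityˡ c))
∑-positions-const (n ∷ ns) c = begin
  ∑ (positions (n ∷ ns)) (λ _ → c)                  ≡⟨ ∑-positions n ns (λ _ → c) ⟩
  ∑ (upTo n) (λ _ → ∑ (positions ns) (λ _ → c))     ≡⟨ ∑-const (upTo n) (∑ (positions ns) (λ _ → c)) ⟩
  + length (upTo n) *ᶻ ∑ (positions ns) (λ _ → c)   ≡⟨ cong₂ (λ k x → + k *ᶻ x) (Listₚ.length-upTo n) (∑-positions-const ns c) ⟩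
  + n *ᶻ (+ size ns *ᶻ c)                           ≡⟨ sym (ℤₚ.*-assoc (+ n) (+ size ns) c) ⟩
  + n *ᶻ + size ns *ᶻ c                             ≡⟨ cong (_*ᶻ c) (sym (ℤₚ.pos-* n (size ns))) ⟩
  + size (n ∷ ns) *ᶻ c                              ∎
  where open ≡-Reasoning

size-pos : ∀ {d} {ns : Vec ℕ d} → All (1 ≤_) ns → 1 ≤ size ns
size-pos []       = ℕₚ.≤-refl
size-pos (p ∷ ps) = ℕₚ.*-mono-≤ p (size-pos ps)

-- Directions as integer displacements

dirℤ : Dir → ℤ
dirℤ neg = -1ℤ
dirℤ zer = 0ℤ
dirℤ pos = 1ℤ

⟦_⟧ : ∀ {d} → Vec Dir d → Vec ℤ d
⟦_⟧ = Vec.map dirℤ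

step≡ : ∀ n p v i → 1 ≤ n → step n p v i ≡ (+ p +ᶻ + i *ᶻ dirℤ v) modᶻ n
-- i (n - 1) exceeds -i by exactly i full turns.
step≡ n@(suc n′) p neg i _ = modᶻ-cong (+ (p + i * n′)) (+ p +ᶻ + i *ᶻ -1ℤ) (+ i) n
  (trans (trans (ℤₚ.pos-+ p (i * n′)) (cong (+ p +ᶻ_) (ℤₚ.pos-* i n′))) (lem (+ p) (+ i) (+ n′)))
  where
  lem : ∀ p i n → p +ᶻ i *ᶻ n ≡ p +ᶻ i *ᶻ (-ᶻ 1ℤ) +ᶻ i *ᶻ (1ℤ +ᶻ n)
  lem = ℤ-Ring.solve-∀
step≡ (suc n) p zer i _ = sym (cong (_modᶻ suc n) (trans (cong (+ p +ᶻ_) (ℤₚ.*-zeroʳ (+ i))) (ℤₚ.+-identityʳ (+ p))))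
step≡ (suc n) p pos i _ = cong (_modᶻ suc n) (trans (ℤₚ.pos-+ p i) (cong (+ p +ᶻ_) (sym (ℤₚ.*-identityʳ (+ i)))))

shift≡translate : ∀ {d} {ns : Vec ℕ d} → All (1 ≤_) ns → ∀ p v i →
                  shift ns p v i ≡ translate ns (+ i ⊙ ⟦ v ⟧) p
shift≡translate []                   []      []      i = refl
shift≡translate {ns = n ∷ _} (1≤n ∷ ps) (p ∷ q) (v ∷ u) i = cong₂ _∷_ (step≡ n p v i 1≤n) (shift≡translate ps q u i)

⊙-+ : ∀ {d} n i (h : Vec ℤ d) → + i ⊙ h ⊕ + n ⊙ h ≡ + (n + i) ⊙ h
⊙-+ n i []      = refl
⊙-+ n i (x ∷ h) = cong₂ _∷_ (trans (lem (+ i) (+ n) x) (cong (_*ᶻ x) (sym (ℤₚ.pos-+ n i)))) (⊙-+ n i h)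
  where
  lem : ∀ i n x → i *ᶻ x +ᶻ n *ᶻ x ≡ (n +ᶻ i) *ᶻ x
  lem = ℤ-Ring.solve-∀

-- The second moment of walk sums

cube : ∀ d → List (Vec Bool d)
cube zero    = [] ∷ []
cube (suc d) = map (false ∷_) (cube d) ++ map (true ∷_) (cube d)

∑-cube : ∀ d (f : Vec Bool (suc d) → ℤ) →
         ∑ (cube (suc d)) f ≡ ∑ (cube d) (f ∘ (false ∷_)) +ᶻ ∑ (cube d) (f ∘ (true ∷_))
∑-cube d f = trans (∑-++ (map (false ∷_) (cube d)) (map (true ∷_) (cube d)) f)
                   (cong₂ _+ᶻ_ (∑-map (false ∷_) (cube d) f) (∑-map (true ∷_) (cube d) f))

length-cube : ∀ d → length (cube d) ≡ 2 ^ d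
length-cube zero    = refl
length-cube (suc d) = begin
  length (map (false ∷_) (cube d) ++ map (true ∷_) (cube d))           ≡⟨ Listₚ.length-++ (map (false ∷_) (cube d)) ⟩
  length (map (false ∷_) (cube d)) + length (map (true ∷_) (cube d))   ≡⟨ cong₂ _+_ (Listₚ.length-map _ (cube d)) (Listₚ.length-map _ (cube d)) ⟩
  length (cube d) + length (cube d)                                    ≡⟨ cong (λ n → n + n) (length-cube d) ⟩
  2 ^ d + 2 ^ d                                                        ≡⟨ cong (λ n → 2 ^ d + n) (sym (ℕₚ.+-identityʳ (2 ^ d))) ⟩
  2 ^ suc d                                                            ∎
  where open ≡-Reasoning

bit : Bool → ℤ
bit false = 0ℤ
bit true  = 1ℤ

⟪_⟫ : ∀ {d} → Vec Bool d → Vec ℤ d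
⟪_⟫ = Vec.map bit

bitDiff : Bool → Bool → Dir
bitDiff false false = zer
bitDiff false true  = neg
bitDiff true  false = pos
bitDiff true  true  = zer

_⊖_ : ∀ {d} → Vec Bool d → Vec Bool d → Vec Dir d
_⊖_ = Vec.zipWith bitDiff

dirℤ-bitDiff : ∀ a b → dirℤ (bitDiff a b) ≡ bit a -ᶻ bit b
dirℤ-bitDiff false false = refl
dirℤ-bitDiff false true  = refl
dirℤ-bitDiff true  false = refl
dirℤ-bitDiff true  true  = refl

-- Displacing the base point by s y′ - t y turns s (y - y′) into (s - t) y, and by `shift-second`
-- turns t (y - y′) into (s - t) y′. The correlation along y - y′ thereby becomes a product of one
-- factor in y and the same factor in y′, depending on s - t only.
shift-first : ∀ {d} s t (y y′ : Vec Bool d) →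
              s ⊙ ⟦ y ⊖ y′ ⟧ ⊕ (s ⊙ ⟪ y′ ⟫ ⊕ (-ᶻ t) ⊙ ⟪ y ⟫) ≡ (s -ᶻ t) ⊙ ⟪ y ⟫
shift-first s t []      []       = refl
shift-first s t (a ∷ y) (b ∷ y′) = cong₂ _∷_
  (trans (cong (λ z → s *ᶻ z +ᶻ (s *ᶻ bit b +ᶻ (-ᶻ t) *ᶻ bit a)) (dirℤ-bitDiff a b)) (lem s t (bit a) (bit b)))
  (shift-first s t y y′)
  where
  lem : ∀ s t a b → s *ᶻ (a -ᶻ b) +ᶻ (s *ᶻ b +ᶻ (-ᶻ t) *ᶻ a) ≡ (s -ᶻ t) *ᶻ a
  lem = ℤ-Ring.solve-∀

shift-second : ∀ {d} s t (y y′ : Vec Bool d) →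
               t ⊙ ⟦ y ⊖ y′ ⟧ ⊕ (s ⊙ ⟪ y′ ⟫ ⊕ (-ᶻ t) ⊙ ⟪ y ⟫) ≡ (s -ᶻ t) ⊙ ⟪ y′ ⟫
shift-second s t []      []       = refl
shift-second s t (a ∷ y) (b ∷ y′) = cong₂ _∷_
  (trans (cong (λ z → t *ᶻ z +ᶻ (s *ᶻ bit b +ᶻ (-ᶻ t) *ᶻ bit a)) (dirℤ-bitDiff a b)) (lem s t (bit a) (bit b)))
  (shift-second s t y y′)
  where
  lem : ∀ s t a b → t *ᶻ (a -ᶻ b) +ᶻ (s *ᶻ b +ᶻ (-ᶻ t) *ᶻ a) ≡ (s -ᶻ t) *ᶻ b
  lem = ℤ-Ring.solve-∀

coincide : ∀ {d} → Vec Bool d → Vec Bool d → ℤ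
coincide y y′ = if isNonzero (y ⊖ y′) then 0ℤ else 1ℤ

∑-coincide : ∀ {d} (y : Vec Bool d) → ∑ (cube d) (coincide y) ≡ 1ℤ
∑-coincide []                = refl
∑-coincide {suc d} (false ∷ y) = trans (∑-cube d (coincide (false ∷ y)))
  (cong₂ _+ᶻ_ (∑-coincide y) (trans (∑-const (cube d) 0ℤ) (ℤₚ.*-zeroʳ (+ length (cube d)))))
∑-coincide {suc d} (true ∷ y)  = trans (∑-cube d (coincide (true ∷ y)))
  (cong₂ _+ᶻ_ (trans (∑-const (cube d) 0ℤ) (ℤₚ.*-zeroʳ (+ length (cube d)))) (∑-coincide y))

module SecondMoment {d} (ns : Vec ℕ d) (φ : Vec ℕ d → ℤ) (N : ℕ) where

  P : List (Vec ℕ d)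
  P = positions ns

  walkSum : Vec Dir d → Vec ℕ d → ℤ
  walkSum v p = ∑ (downFrom N) (λ s → φ (translate ns (+ s ⊙ ⟦ v ⟧) p))

  moment : Vec Dir d → ℤ
  moment v = ∑ P (λ p → walkSum v p *ᶻ walkSum v p)

  variance : ℤ
  variance = ∑ P (λ p → φ p *ᶻ φ p)

  cubeSum : ℤ → Vec ℕ d → ℤ
  cubeSum k p = ∑ (cube d) (λ y → φ (translate ns (k ⊙ ⟪ y ⟫) p))

  at : ℤ → Vec Bool d → Vec ℕ d → ℤ
  at k y p = φ (translate ns (k ⊙ ⟪ y ⟫) p)

  correlation : ∀ s t (y y′ : Vec Bool d) →
    ∑ P (λ p → φ (translate ns (+ s ⊙ ⟦ y ⊖ y′ ⟧) p) *ᶻ φ (translate ns (+ t ⊙ ⟦ y ⊖ y′ ⟧) p)) ≡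
    ∑ P (λ p → at (+ s -ᶻ + t) y p *ᶻ at (+ s -ᶻ + t) y′ p)
  correlation s t y y′ = trans
    (sym (∑-translate ns δ (λ p → φ (translate ns (+ s ⊙ ⟦ y ⊖ y′ ⟧) p) *ᶻ φ (translate ns (+ t ⊙ ⟦ y ⊖ y′ ⟧) p))))
    (∑-cong P (λ p → cong₂ (λ a b → φ a *ᶻ φ b)
      (trans (translate-∘ ns (+ s ⊙ ⟦ y ⊖ y′ ⟧) δ p) (cong (λ h → translate ns h p) (shift-first (+ s) (+ t) y y′)))
      (trans (translate-∘ ns (+ t ⊙ ⟦ y ⊖ y′ ⟧) δ p) (cong (λ h → translate ns h p) (shift-second (+ s) (+ t) y y′)))))
    where δ = + s ⊙ ⟪ y′ ⟫ ⊕ (-ᶻ (+ t)) ⊙ ⟪ y ⟫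

  -- For fixed s and t the sum over all pairs of cube points is a sum of
  -- squares; this positivity drives the whole argument.
  total-moment : ∑ (cube d) (λ y → ∑ (cube d) (λ y′ → moment (y ⊖ y′))) ≡
                 ∑ (downFrom N) (λ s → ∑ (downFrom N) (λ t →
                   ∑ P (λ p → cubeSum (+ s -ᶻ + t) p *ᶻ cubeSum (+ s -ᶻ + t) p)))
  total-moment = begin
    ∑ Q (λ y → ∑ Q (λ y′ → moment (y ⊖ y′)))
      ≡⟨ ∑-cong Q (λ y → ∑-cong Q (λ y′ → expand y y′)) ⟩
    ∑ Q (λ y → ∑ Q (λ y′ → ∑ R (λ s → ∑ R (λ t → c s t y y′))))
      ≡⟨ ∑-cong Q (λ y → ∑-swap Q R (λ y′ s → ∑ R (λ t → c s t y y′))) ⟩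
    ∑ Q (λ y → ∑ R (λ s → ∑ Q (λ y′ → ∑ R (λ t → c s t y y′))))
      ≡⟨ ∑-cong Q (λ y → ∑-cong R (λ s → ∑-swap Q R (λ y′ t → c s t y y′))) ⟩
    ∑ Q (λ y → ∑ R (λ s → ∑ R (λ t → ∑ Q (λ y′ → c s t y y′))))
      ≡⟨ ∑-swap Q R (λ y s → ∑ R (λ t → ∑ Q (λ y′ → c s t y y′))) ⟩
    ∑ R (λ s → ∑ Q (λ y → ∑ R (λ t → ∑ Q (λ y′ → c s t y y′))))
      ≡⟨ ∑-cong R (λ s → ∑-swap Q R (λ y t → ∑ Q (λ y′ → c s t y y′))) ⟩
    ∑ R (λ s → ∑ R (λ t → ∑ Q (λ y → ∑ Q (λ y′ → c s t y y′))))
      ≡⟨ ∑-cong R (λ s → ∑-cong R (λ t → collect (+ s -ᶻ + t))) ⟩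
    ∑ R (λ s → ∑ R (λ t → ∑ P (λ p → cubeSum (+ s -ᶻ + t) p *ᶻ cubeSum (+ s -ᶻ + t) p))) ∎
    where
    open ≡-Reasoning
    Q = cube d
    R = downFrom N
    c : ℕ → ℕ → Vec Bool d → Vec Bool d → ℤ
    c s t y y′ = ∑ P (λ p → at (+ s -ᶻ + t) y p *ᶻ at (+ s -ᶻ + t) y′ p)
    expand : ∀ y y′ → moment (y ⊖ y′) ≡ ∑ R (λ s → ∑ R (λ t → c s t y y′))
    expand y y′ = begin
      ∑ P (λ p → walkSum v p *ᶻ walkSum v p)
        ≡⟨ ∑-cong P (λ p → square-of-sum R (λ s → g s p)) ⟩
      ∑ P (λ p → ∑ R (λ s → ∑ R (λ t → g s p *ᶻ g t p)))
        ≡⟨ ∑-swap P R (λ p s → ∑ R (λ t → g s p *ᶻ g t p)) ⟩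
      ∑ R (λ s → ∑ P (λ p → ∑ R (λ t → g s p *ᶻ g t p)))
        ≡⟨ ∑-cong R (λ s → ∑-swap P R (λ p t → g s p *ᶻ g t p)) ⟩
      ∑ R (λ s → ∑ R (λ t → ∑ P (λ p → g s p *ᶻ g t p)))
        ≡⟨ ∑-cong R (λ s → ∑-cong R (λ t → correlation s t y y′)) ⟩
      ∑ R (λ s → ∑ R (λ t → c s t y y′)) ∎
      where
      v = y ⊖ y′
      g : ℕ → Vec ℕ d → ℤ
      g s p = φ (translate ns (+ s ⊙ ⟦ v ⟧) p)
    collect : ∀ k → ∑ Q (λ y → ∑ Q (λ y′ → ∑ P (λ p → at k y p *ᶻ at k y′ p))) ≡
                    ∑ P (λ p → cubeSum k p *ᶻ cubeSum k p)
    collect k = begin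
      ∑ Q (λ y → ∑ Q (λ y′ → ∑ P (λ p → at k y p *ᶻ at k y′ p)))
        ≡⟨ ∑-cong Q (λ y → ∑-swap Q P (λ y′ p → at k y p *ᶻ at k y′ p)) ⟩
      ∑ Q (λ y → ∑ P (λ p → ∑ Q (λ y′ → at k y p *ᶻ at k y′ p)))
        ≡⟨ ∑-swap Q P (λ y p → ∑ Q (λ y′ → at k y p *ᶻ at k y′ p)) ⟩
      ∑ P (λ p → ∑ Q (λ y → ∑ Q (λ y′ → at k y p *ᶻ at k y′ p)))
        ≡⟨ ∑-cong P (λ p → ∑-product Q Q (λ y → at k y p) (λ y → at k y p)) ⟩
      ∑ P (λ p → cubeSum k p *ᶻ cubeSum k p) ∎

  q : ℤ
  q = + length (cube d)

  -- At equal times all cube points are displaced by 0, so the cube sum is q copies of one value.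
  diagonal : ∀ s → ∑ P (λ p → cubeSum (+ s -ᶻ + s) p *ᶻ cubeSum (+ s -ᶻ + s) p) ≡ (q *ᶻ q) *ᶻ variance
  diagonal s = begin
    ∑ P (λ p → cubeSum (+ s -ᶻ + s) p *ᶻ cubeSum (+ s -ᶻ + s) p)
      ≡⟨ ∑-cong P (λ p → cong (λ x → x *ᶻ x) (constant p)) ⟩
    ∑ P (λ p → (q *ᶻ φ (translate ns 0s p)) *ᶻ (q *ᶻ φ (translate ns 0s p)))
      -- Translation by 0 is reduction modulo the shape rather than the identity; under the sum it
      -- disappears.
      ≡⟨ ∑-translate ns 0s (λ p → (q *ᶻ φ p) *ᶻ (q *ᶻ φ p)) ⟩
    ∑ P (λ p → (q *ᶻ φ p) *ᶻ (q *ᶻ φ p))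
      ≡⟨ ∑-cong P (λ p → lem q (φ p)) ⟩
    ∑ P (λ p → (q *ᶻ q) *ᶻ (φ p *ᶻ φ p))
      ≡⟨ ∑-*ˡ P (q *ᶻ q) (λ p → φ p *ᶻ φ p) ⟩
    (q *ᶻ q) *ᶻ variance ∎
    where
    open ≡-Reasoning
    0s = Vec.replicate d 0ℤ
    lem : ∀ q x → (q *ᶻ x) *ᶻ (q *ᶻ x) ≡ (q *ᶻ q) *ᶻ (x *ᶻ x)
    lem = ℤ-Ring.solve-∀
    zeros : ∀ {e} (h : Vec ℤ e) → 0ℤ ⊙ h ≡ Vec.replicate e 0ℤ
    zeros []      = refl
    zeros (a ∷ h) = cong₂ _∷_ (ℤₚ.*-zeroˡ a) (zeros h)
    constant : ∀ p → cubeSum (+ s -ᶻ + s) p ≡ q *ᶻ φ (translate ns 0s p)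
    constant p = trans (∑-cong (cube d) (λ y → cong (λ h → φ (translate ns h p))
      (trans (cong (_⊙ ⟪ y ⟫) (ℤₚ.+-inverseʳ (+ s))) (zeros ⟪ y ⟫)))) (∑-const (cube d) _)

  -- Every (s, t) term of `total-moment` is a sum of squares; only the N terms with s = t are kept.
  moment-lower : + N *ᶻ ((q *ᶻ q) *ᶻ variance) ≤ᶻ ∑ (cube d) (λ y → ∑ (cube d) (λ y′ → moment (y ⊖ y′)))
  moment-lower = begin
    + N *ᶻ ((q *ᶻ q) *ᶻ variance)
      ≡⟨ cong (λ n → + n *ᶻ ((q *ᶻ q) *ᶻ variance)) (sym (Listₚ.length-downFrom N)) ⟩
    + length R *ᶻ ((q *ᶻ q) *ᶻ variance)
      ≡⟨ ∑-const R ((q *ᶻ q) *ᶻ variance) ⟨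
    ∑ R (λ _ → (q *ᶻ q) *ᶻ variance)
      ≤⟨ diag-≤ R (λ x → x) ⟩
    ∑ R (λ s → ∑ R (λ t → E s t))
      ≡⟨ total-moment ⟨
    ∑ (cube d) (λ y → ∑ (cube d) (λ y′ → moment (y ⊖ y′))) ∎
    where
    open ℤₚ.≤-Reasoning
    R = downFrom N
    E : ℕ → ℕ → ℤ
    E s t = ∑ P (λ p → cubeSum (+ s -ᶻ + t) p *ᶻ cubeSum (+ s -ᶻ + t) p)
    diag-≤ : ∀ xs → (∀ {x} → x ∈ xs → x ∈ R) → ∑ xs (λ _ → (q *ᶻ q) *ᶻ variance) ≤ᶻ ∑ xs (λ s → ∑ R (E s))
    diag-≤ []       _   = ℤₚ.≤-refl
    diag-≤ (x ∷ xs) sub = ℤₚ.+-mono-≤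
      (ℤₚ.≤-trans (ℤₚ.≤-reflexive (sym (diagonal x)))
                  (∑-term (E x) (λ t → ∑-nonneg P (λ p → 0≤sq (cubeSum (+ x -ᶻ + t) p))) (sub (here refl))))
      (diag-≤ xs (sub ∘ there))

  -- Meant for the zero direction, where the walk stays in place and no discrepancy bound is
  -- available.
  moment-trivial : ∀ v → moment v ≤ᶻ (+ N *ᶻ + N) *ᶻ variance
  moment-trivial v = begin
    ∑ P (λ p → walkSum v p *ᶻ walkSum v p)
      ≤⟨ ∑-mono P (λ p → cauchy-schwarz R (λ s → φ (translate ns (+ s ⊙ ⟦ v ⟧) p))) ⟩
    ∑ P (λ p → + length R *ᶻ ∑ R (λ s → sq s p))
      ≡⟨ ∑-*ˡ P (+ length R) (λ p → ∑ R (λ s → sq s p)) ⟩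
    + length R *ᶻ ∑ P (λ p → ∑ R (λ s → sq s p))
      ≡⟨ cong (+ length R *ᶻ_) (∑-swap P R (λ p s → sq s p)) ⟩
    + length R *ᶻ ∑ R (λ s → ∑ P (sq s))
      ≡⟨ cong (+ length R *ᶻ_) (∑-cong R (λ s → ∑-translate ns (+ s ⊙ ⟦ v ⟧) (λ p → φ p *ᶻ φ p))) ⟩
    + length R *ᶻ ∑ R (λ _ → variance)
      ≡⟨ cong (+ length R *ᶻ_) (∑-const R variance) ⟩
    + length R *ᶻ (+ length R *ᶻ variance)
      ≡⟨ ℤₚ.*-assoc (+ length R) (+ length R) variance ⟨
    (+ length R *ᶻ + length R) *ᶻ variance
      ≡⟨ cong (λ n → (+ n *ᶻ + n) *ᶻ variance) (Listₚ.length-downFrom N) ⟩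
    (+ N *ᶻ + N) *ᶻ variance ∎
    where
    open ℤₚ.≤-Reasoning
    R = downFrom N
    sq : ℕ → Vec ℕ d → ℤ
    sq s p = φ (translate ns (+ s ⊙ ⟦ v ⟧) p) *ᶻ φ (translate ns (+ s ⊙ ⟦ v ⟧) p)

  -- For each y only y′ = y gives the zero direction. These q pairs receive the trivial bound, and B
  -- is charged to all q² pairs alike.
  second-moment : ∀ {B} → 0ℤ ≤ᶻ B → (∀ v → isNonzero v ≡ true → moment v ≤ᶻ B) →
    + N *ᶻ ((q *ᶻ q) *ᶻ variance) ≤ᶻ q *ᶻ ((+ N *ᶻ + N) *ᶻ variance +ᶻ q *ᶻ B)
  second-moment {B} 0≤B bound = ℤₚ.≤-trans moment-lower (begin
    ∑ (cube d) (λ y → ∑ (cube d) (λ y′ → moment (y ⊖ y′)))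
      ≤⟨ ∑-mono (cube d) (λ y → ∑-mono (cube d) (λ y′ → pointwise (y ⊖ y′))) ⟩
    ∑ (cube d) (λ y → ∑ (cube d) (λ y′ → coincide y y′ *ᶻ V +ᶻ B))
      ≡⟨ ∑-cong (cube d) (λ y → row y) ⟩
    ∑ (cube d) (λ _ → V +ᶻ q *ᶻ B)
      ≡⟨ ∑-const (cube d) (V +ᶻ q *ᶻ B) ⟩
    q *ᶻ (V +ᶻ q *ᶻ B) ∎)
    where
    open ℤₚ.≤-Reasoning
    V = (+ N *ᶻ + N) *ᶻ variance
    pointwise : ∀ v → moment v ≤ᶻ (if isNonzero v then 0ℤ else 1ℤ) *ᶻ V +ᶻ B
    pointwise v with isNonzero v in eq
    ... | true  = ℤₚ.≤-trans (bound v eq) (ℤₚ.≤-reflexive (sym (trans (cong (_+ᶻ B) (ℤₚ.*-zeroˡ V)) (ℤₚ.+-identityˡ B))))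
    ... | false = ℤₚ.≤-trans (moment-trivial v) (≤-by B 0≤B (cong (_+ᶻ B) (ℤₚ.*-identityˡ V)))
    row : ∀ y → ∑ (cube d) (λ y′ → coincide y y′ *ᶻ V +ᶻ B) ≡ V +ᶻ q *ᶻ B
    row y = trans (∑-+ (cube d) (λ y′ → coincide y y′ *ᶻ V) (λ _ → B))
      (cong₂ _+ᶻ_ (trans (∑-*ʳ (cube d) V (coincide y)) (trans (cong (_*ᶻ V) (∑-coincide y)) (ℤₚ.*-identityˡ V)))
                  (∑-const (cube d) B))

-- Occurrences of the word on a line

record Greatest (P : ℕ → Set) (n : ℕ) : Set where
  field
    value   : ℕ
    value<  : value < n
    holds   : P value
    maximal : ∀ {m} → m < n → P m → m ≤ value

greatest : ∀ {P : ℕ → Set} → (∀ m → Dec (P m)) → P 0 → ∀ n → Greatest P (suc n)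
greatest P? P0 zero = record { value = 0 ; value< = s≤s z≤n ; holds = P0 ; maximal = λ { (s≤s z≤n) _ → z≤n } }
greatest P? P0 (suc n) with P? (suc n)
... | yes Pn = record { value = suc n ; value< = ℕₚ.≤-refl ; holds = Pn ; maximal = λ { (s≤s m≤) _ → m≤ } }
... | no ¬Pn = record
  { value = value ; value< = ℕₚ.m≤n⇒m≤1+n value< ; holds = holds
  ; maximal = λ { {m} (s≤s m≤1+n) Pm → maximal (ℕₚ.≤∧≢⇒< m≤1+n (λ { refl → ¬Pn Pm })) Pm } }
  where open Greatest (greatest P? P0 n)

indicator : ∀ {P : Set} → Dec P → ℕ
indicator P? = if does P? then 1 else 0

data Kind : Set where
  fwd bwd : Kind

-- The letters of the word are W 0, …, W ℓ′; its length is ℓ = suc ℓ′.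
module Lines (ℓ′ : ℕ) (W : ℕ → ℕ) where

  ℓ : ℕ
  ℓ = suc ℓ′

  Matching : (ℕ → ℕ → ℕ → Set) → ℕ → Set
  Matching R o = ∀ {i} → i < ℓ → ∀ {j} → j < ℓ → R o i j → W i ≡ W j

  -- Free of subtraction, with o the length: a border identifies position i with j = i + ℓ - o, a
  -- palindromic suffix reflects by i + j = 2ℓ - o - 1, and a palindromic prefix by i + j = o - 1.
  Border PalSuffix PalPrefix : ℕ → Set
  Border    = Matching (λ o i j → i + ℓ ≡ j + o)
  PalSuffix = Matching (λ o i j → suc (i + j + o) ≡ ℓ + ℓ)
  PalPrefix = Matching (λ o i j → suc (i + j) ≡ o)

  matching? : ∀ {R : ℕ → ℕ → ℕ → Set} → (∀ o i j → Dec (R o i j)) → ∀ o → Dec (Matching R o)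
  matching? R? o = ℕₚ.allUpTo? (λ i → ℕₚ.allUpTo? (λ j → R? o i j →-dec (W i ≟ W j)) ℓ) ℓ

  abstract
    longestBorder : Greatest Border ℓ
    longestBorder = greatest (matching? (λ o i j → i + ℓ ≟ j + o))
      (λ {i} _ {j} j<ℓ eq → ⊥-elim (ℕₚ.<⇒≱ j<ℓ (ℕₚ.≤-trans (ℕₚ.m≤n+m ℓ i) (ℕₚ.≤-reflexive (trans eq (ℕₚ.+-identityʳ j)))))) ℓ′

    longestPalSuffix : Greatest PalSuffix ℓ
    longestPalSuffix = greatest (matching? (λ o i j → suc (i + j + o) ≟ ℓ + ℓ))
      (λ {i} i<ℓ {j} j<ℓ eq → ⊥-elim (ℕₚ.<-irrefl (trans (cong suc (sym (ℕₚ.+-identityʳ (i + j)))) eq)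
         (ℕₚ.≤-trans (ℕₚ.≤-reflexive (cong suc (sym (ℕₚ.+-suc i j)))) (ℕₚ.+-mono-≤ i<ℓ j<ℓ)))) ℓ′

    longestPalPrefix : Greatest PalPrefix ℓ
    longestPalPrefix = greatest (matching? (λ o i j → suc (i + j) ≟ o)) (λ _ _ ()) ℓ′

  open Greatest longestBorder    public renaming (value to b; value< to b<ℓ; holds to b-border; maximal to b-max)
  open Greatest longestPalSuffix public renaming (value to q; value< to q<ℓ; holds to q-pal; maximal to q-max)
  open Greatest longestPalPrefix public renaming (value to r; value< to r<ℓ; holds to r-pal; maximal to r-max)

  abstract
    M D : ℕ
    M = (b + b) ⊔ (q + r)
    D = ℓ + ℓ ∸ M

    M≤ : M ≤ ℓ′ + ℓ′
    M≤ = ℕₚ.⊔-lub (ℕₚ.+-mono-≤ (ℕₚ.≤-pred b<ℓ) (ℕₚ.≤-pred b<ℓ)) (ℕₚ.+-mono-≤ (ℕₚ.≤-pred q<ℓ) (ℕₚ.≤-pred r<ℓ))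

    D+M : D + M ≡ ℓ + ℓ
    D+M = ℕₚ.m∸n+n≡m (ℕₚ.≤-trans M≤ (ℕₚ.+-mono-≤ (ℕₚ.n≤1+n ℓ′) (ℕₚ.n≤1+n ℓ′)))

    2b≤M : b + b ≤ M
    2b≤M = ℕₚ.m≤m⊔n (b + b) (q + r)

    q+r≤M : q + r ≤ M
    q+r≤M = ℕₚ.m≤n⊔m (b + b) (q + r)

    D≤ : D ≤ ℓ + ℓ
    D≤ = ℕₚ.m∸n≤m (ℓ + ℓ) M

    D-pos : 1 ≤ D
    D-pos = ℕₚ.+-cancelʳ-≤ M 1 D (ℕₚ.≤-trans (s≤s M≤) (ℕₚ.≤-trans (ℕₚ.+-mono-≤ (ℕₚ.≤-refl {ℓ}) (ℕₚ.n≤1+n ℓ′)) (ℕₚ.≤-reflexive (sym D+M))))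

    M-cases : M ≡ b + b ⊎ M ≡ q + r
    M-cases = ℕₚ.⊔-sel (b + b) (q + r)

    M-lub : ∀ {n} → b + b ≤ n → q + r ≤ n → M ≤ n
    M-lub = ℕₚ.⊔-lub

  letter : Kind → ℕ → ℕ
  letter fwd i = W i
  letter bwd i = W (ℓ′ ∸ i)

  Reads : Kind → (ℕ → ℕ) → ℕ → Set
  Reads k g s = ∀ {i} → i < ℓ → g (s + i) ≡ letter k i

  reads? : ∀ k g s → Dec (Reads k g s)
  reads? k g s = ℕₚ.allUpTo? (λ i → g (s + i) ≟ letter k i) ℓ

  reads-fwd : ∀ g s → Reads fwd g s → ∀ {y i} → i < ℓ → y ≡ s + i → g y ≡ W i
  reads-fwd g s R i<ℓ refl = R i<ℓ

  reads-bwd : ∀ g s → Reads bwd g s → ∀ {y j} → j < ℓ → y + j ≡ s + ℓ′ → g y ≡ W j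
  reads-bwd g s R {y} {j} j<ℓ eq = begin
    g y              ≡⟨ cong g y≡ ⟩
    g (s + (ℓ′ ∸ j)) ≡⟨ R (s≤s (ℕₚ.m∸n≤m ℓ′ j)) ⟩
    W (ℓ′ ∸ (ℓ′ ∸ j)) ≡⟨ cong W (ℕₚ.m∸[m∸n]≡n j≤) ⟩
    W j              ∎
    where
    open ≡-Reasoning
    j≤ = ℕₚ.≤-pred j<ℓ
    y≡ : y ≡ s + (ℓ′ ∸ j)
    y≡ = ℕₚ.+-cancelʳ-≡ j y (s + (ℓ′ ∸ j)) (trans eq (sym (trans (ℕₚ.+-assoc s (ℓ′ ∸ j) j) (cong (λ z → s + z) (ℕₚ.m∸n+n≡m j≤)))))

  -- The end of w followed by its own reversal overlaps in a palindromic suffix, and the opposite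
  -- order overlaps in a palindromic prefix. Equal kinds give borders, since w and its reversal have
  -- borders of the same lengths.
  Overlap : Kind → Kind → ℕ → Set
  Overlap fwd fwd = Border
  Overlap bwd bwd = Border
  Overlap fwd bwd = PalSuffix
  Overlap bwd fwd = PalPrefix

  -- With the second occurrence placed at ℓ, an occurrence starting at s ends at s + ℓ - 1, so the
  -- common part has exactly s letters.
  overlaps : ∀ g s k k′ → Reads k g s → Reads k′ g ℓ → Overlap k k′ s
  overlaps g s fwd fwd R R′ {i} i<ℓ {j} j<ℓ eq =
    trans (sym (reads-fwd g ℓ R′ i<ℓ refl)) (reads-fwd g s R j<ℓ (lem i ℓ s j eq))
    where
    lem : ∀ i l s j → i + l ≡ j + s → l + i ≡ s + j
    lem i l s j eq = trans (ℕₚ.+-comm l i) (trans eq (ℕₚ.+-comm j s))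
  overlaps g s fwd bwd R R′ {i} i<ℓ {j} j<ℓ eq =
    trans (sym (reads-fwd g s R i<ℓ refl)) (reads-bwd g ℓ R′ j<ℓ (lem i j s eq))
    where
    arr : ∀ i j s → suc (s + i + j) ≡ suc (i + j + s)
    arr = ℕ-Ring.solve-∀
    lem : ∀ i j s → suc (i + j + s) ≡ ℓ + ℓ → s + i + j ≡ ℓ + ℓ′
    lem i j s eq = ℕₚ.suc-injective (trans (arr i j s) (trans eq (ℕₚ.+-suc ℓ ℓ′)))
  overlaps g _ bwd fwd R R′ {i} i<ℓ {j} j<ℓ refl =
    trans (sym (reads-fwd g ℓ R′ i<ℓ refl)) (reads-bwd g (suc (i + j)) R j<ℓ (lem i j ℓ′))
    where
    lem : ∀ i j l → suc l + i + j ≡ suc (i + j) + l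
    lem = ℕ-Ring.solve-∀
  overlaps g s bwd bwd R R′ {i} i<ℓ {j} j<ℓ eq =
    trans (sym (reads-bwd g s R i<ℓ (ℕₚ.+-cancelʳ-≡ j _ _ y+i+j))) (reads-bwd g ℓ R′ j<ℓ y+j)
    where
    y = ℓ + (ℓ′ ∸ j)
    y+j : y + j ≡ ℓ + ℓ′
    y+j = trans (ℕₚ.+-assoc ℓ (ℓ′ ∸ j) j) (cong (λ z → ℓ + z) (ℕₚ.m∸n+n≡m (ℕₚ.≤-pred j<ℓ)))
    arr₁ : ∀ y i j → y + i + j ≡ y + j + i
    arr₁ = ℕ-Ring.solve-∀
    arr₂ : ∀ l m i → l + m + i ≡ (i + l) + m
    arr₂ = ℕ-Ring.solve-∀
    arr₃ : ∀ j s m → (j + s) + m ≡ s + m + j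
    arr₃ = ℕ-Ring.solve-∀
    y+i+j : y + i + j ≡ s + ℓ′ + j
    y+i+j = trans (arr₁ y i j) (trans (cong (_+ i) y+j) (trans (arr₂ ℓ ℓ′ i) (trans (cong (_+ ℓ′) eq) (arr₃ j s ℓ′))))

  -- The preference for `fwd` makes each occurrence of a palindromic word count once; `multiplicity`
  -- later restores the factor 2.
  kindAt : (ℕ → ℕ) → ℕ → Maybe Kind
  kindAt g s = if does (reads? fwd g s) then just fwd else (if does (reads? bwd g s) then just bwd else nothing)

  kindAt-reads : ∀ g s {k} → kindAt g s ≡ just k → Reads k g s
  kindAt-reads g s eq with reads? fwd g s | reads? bwd g s
  kindAt-reads g s refl | yes R | _     = R
  kindAt-reads g s refl | no _  | yes R = R

  kindAt-cong : ∀ {g g′ s s′} → (∀ i → g (s + i) ≡ g′ (s′ + i)) → kindAt g s ≡ kindAt g′ s′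
  kindAt-cong {g} {g′} {s} {s′} eq = cong₂ (λ x y → if x then just fwd else (if y then just bwd else nothing)) (same fwd) (same bwd)
    where
    same : ∀ k → does (reads? k g s) ≡ does (reads? k g′ s′)
    same k = does-⇔ (mk⇔ to from) (reads? k g s) (reads? k g′ s′)
      where
      to : Reads k g s → Reads k g′ s′
      to R i<ℓ = trans (sym (eq _)) (R i<ℓ)
      from : Reads k g′ s′ → Reads k g s
      from R i<ℓ = trans (eq _) (R i<ℓ)

  -- just (k , t): the latest occurrence in sight is of kind k and starts t
  -- letters before the current one.
  State : Set
  State = Maybe (Kind × ℕ)

  latest : (ℕ → ℕ) → ℕ → ℕ → State
  latest g zero    t = nothing
  latest g (suc n) t = maybe′ (λ k → just (k , t)) (latest g n (suc t)) (kindAt g n)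

  -- The current letter is the one at ℓ′: occurrences starting at 0, ..., ℓ′ are exactly those that
  -- cover it.
  state : (ℕ → ℕ) → State
  state g = latest g ℓ 0

  starts : (ℕ → ℕ) → ℕ → ℕ
  starts g s = maybe′ (λ _ → 1) 0 (kindAt g s)

  fresh : (ℕ → ℕ) → ℕ
  fresh g = starts g ℓ′

  age : State → State
  age = mapᴹ (map₂ suc)

  latest-suc : ∀ g n t → latest g n (suc t) ≡ age (latest g n t)
  latest-suc g zero    t = refl
  latest-suc g (suc n) t with kindAt g n
  ... | just k  = refl
  ... | nothing = latest-suc g n (suc t)

  latest-spec : ∀ g n t {k t′} → latest g n t ≡ just (k , t′) → ∃[ s ] kindAt g s ≡ just k × t′ + suc s ≡ t + n
  latest-spec g (suc n) t eq with kindAt g n in eqₖ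
  latest-spec g (suc n) t refl | just k = n , eqₖ , refl
  latest-spec g (suc n) t eq | nothing with latest-spec g n (suc t) eq
  ... | s , kₛ , sum≡ = s , kₛ , trans sum≡ (sym (ℕₚ.+-suc t n))

  state-spec : ∀ g {k t} → state g ≡ just (k , t) → ∃[ s ] Reads k g s × t + suc s ≡ ℓ
  state-spec g eq with latest-spec g ℓ 0 eq
  ... | s , kₛ , sum≡ = s , kindAt-reads g s kₛ , sum≡

  state-letter : ∀ g {k t} → state g ≡ just (k , t) → t < ℓ × g ℓ′ ≡ letter k t
  state-letter g {k} {t} eq with state-spec g eq
  ... | s , R , sum≡ = t<ℓ , trans (cong g (sym s+t)) (R t<ℓ)
    where
    t<ℓ : t < ℓ
    t<ℓ = ℕₚ.≤-trans (ℕₚ.m<m+n t (s≤s z≤n)) (ℕₚ.≤-reflexive sum≡)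
    s+t : s + t ≡ ℓ′
    s+t = ℕₚ.suc-injective (trans (cong suc (ℕₚ.+-comm s t)) (trans (sym (ℕₚ.+-suc t s)) sum≡))

  -- The start 0 is the oldest and has the lowest priority, so it matters only if the scan of the
  -- later starts finds nothing.
  latest-shift : ∀ {g g′} → (∀ i → g′ i ≡ g (suc i)) → ∀ n t →
                 latest g (suc n) t ≡ (latest g′ n t <∣> mapᴹ (_, t + n) (kindAt g 0))
  latest-shift {g} g′≡ zero t rewrite ℕₚ.+-identityʳ t with kindAt g 0
  ... | just k  = refl
  ... | nothing = refl
  latest-shift {g} {g′} g′≡ (suc n) t rewrite kindAt-cong {g′} {g} {n} {suc n} (λ i → g′≡ (n + i)) with kindAt g (suc n)
  ... | just k  = refl
  ... | nothing = trans (latest-shift {g} g′≡ n (suc t)) (cong (λ m → latest g′ n (suc t) <∣> mapᴹ (_, m) (kindAt g 0)) (sym (ℕₚ.+-suc t n)))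

  -- One letter forward, the occurrence in sight ages, is superseded by one starting at the new
  -- letter, or has just ended. The last index is the number of new starts. In `join` the starts are
  -- t + 1 apart, which leaves an overlap of s letters.
  data Step : State → State → ℕ → Set where
    extend : ∀ {k t} → Step (just (k , t)) (just (k , suc t)) 0
    join   : ∀ {k k′ t} s → t + suc s ≡ ℓ → Overlap k k′ s → Step (just (k , t)) (just (k′ , 0)) 1
    lose   : ∀ {k} → Step (just (k , ℓ′)) nothing 0
    start  : ∀ {k} → Step nothing (just (k , 0)) 1
    idle   : Step nothing nothing 0

  steps : ∀ {g g′} → (∀ i → g′ i ≡ g (suc i)) → Step (state g) (state g′) (fresh g′)
  steps {g} {g′} g′≡ with kindAt g′ ℓ′ in eq′
  ... | just k′ = joined (state g) refl
    where
    R′ : Reads k′ g ℓ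
    R′ i<ℓ = trans (sym (g′≡ _)) (kindAt-reads g′ ℓ′ eq′ i<ℓ)
    joined : ∀ σ → state g ≡ σ → Step σ (just (k′ , 0)) 1
    joined nothing        eq = start
    joined (just (k , t)) eq with state-spec g eq
    ... | s , R , sum≡ = join s sum≡ (overlaps g s k k′ R R′)
  -- Without a new start the two states scan the same starts, except that the older one also sees
  -- start 0, at age ℓ′, which now leaves the window.
  ... | nothing rewrite latest-suc g′ ℓ′ 0 | latest-shift {g} {g′} g′≡ ℓ′ 0 with latest g′ ℓ′ 0
  ...   | just (k , t) = extend
  ...   | nothing with kindAt g 0
  ...     | just k  = lose
  ...     | nothing = idle

  -- The energy inequality

  weight : Kind → ℕ
  weight fwd = q
  weight bwd = r

  -- Each letter contributes 2, and a new start has to pay D out of what has accumulated. The value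
  -- 2ℓ - 1 for an uncovered letter makes all three transitions through `nothing` strictly wasteful:
  -- 2ℓ is available when an occurrence is lost, and D plus a weight is at most D + M = 2ℓ when one
  -- starts.
  energy : State → ℕ
  energy nothing        = ℓ + ℓ′
  energy (just (k , t)) = weight k + (t + t)

  weight≤M : ∀ k → weight k ≤ M
  weight≤M fwd = ℕₚ.≤-trans (ℕₚ.m≤m+n q r) q+r≤M
  weight≤M bwd = ℕₚ.≤-trans (ℕₚ.m≤n+m r q) q+r≤M

  -- The weights q and r are the potential that turns the bounds q and r on
  -- mixed overlaps into the single average bound M / 2.
  overlap-bound : ∀ k k′ {s} → s < ℓ → Overlap k k′ s → weight k′ + (s + s) ≤ M + weight k
  overlap-bound fwd fwd s< o = ℕₚ.≤-trans (ℕₚ.+-monoʳ-≤ q (ℕₚ.≤-trans (ℕₚ.+-mono-≤ (b-max s< o) (b-max s< o)) 2b≤M)) (ℕₚ.≤-reflexive (ℕₚ.+-comm q M))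
  overlap-bound bwd bwd s< o = ℕₚ.≤-trans (ℕₚ.+-monoʳ-≤ r (ℕₚ.≤-trans (ℕₚ.+-mono-≤ (b-max s< o) (b-max s< o)) 2b≤M)) (ℕₚ.≤-reflexive (ℕₚ.+-comm r M))
  overlap-bound fwd bwd s< o = ℕₚ.≤-trans (ℕₚ.+-monoʳ-≤ r (ℕₚ.+-mono-≤ (q-max s< o) (q-max s< o)))
    (ℕₚ.≤-trans (ℕₚ.≤-reflexive (lem r q)) (ℕₚ.+-monoˡ-≤ q q+r≤M))
    where
    lem : ∀ r q → r + (q + q) ≡ q + r + q
    lem = ℕ-Ring.solve-∀
  overlap-bound bwd fwd s< o = ℕₚ.≤-trans (ℕₚ.+-monoʳ-≤ q (ℕₚ.+-mono-≤ (r-max s< o) (r-max s< o)))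
    (ℕₚ.≤-trans (ℕₚ.≤-reflexive (lem r q)) (ℕₚ.+-monoˡ-≤ r q+r≤M))
    where
    lem : ∀ r q → q + (r + r) ≡ q + r + r
    lem = ℕ-Ring.solve-∀

  overlap< : ∀ {t s} → t + suc s ≡ ℓ → s < ℓ
  overlap< {t} {s} eq = ℕₚ.≤-trans (ℕₚ.m≤n+m (suc s) t) (ℕₚ.≤-reflexive eq)

  -- From D + M = 2ℓ = 2 (t + 1 + s): the energy inequality at a new start has the same slack as
  -- `overlap-bound`. This yields the inequality, and also transfers the case of equality.
  join-identity : ∀ {t s} k k′ → t + suc s ≡ ℓ →
    (D * 1 + (weight k′ + 0)) + (M + weight k) ≡ (2 + (weight k + (t + t))) + (weight k′ + (s + s))
  join-identity {t} {s} k k′ eq = trans (arr₁ D M (weight k′) (weight k)) (trans (cong (_+ (weight k′ + weight k)) (trans D+M (cong (λ x → x + x) (sym eq)))) (arr₂ t s (weight k′) (weight k)))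
    where
    arr₁ : ∀ D M x y → (D * 1 + (x + 0)) + (M + y) ≡ (D + M) + (x + y)
    arr₁ = ℕ-Ring.solve-∀
    arr₂ : ∀ t s x y → (t + suc s) + (t + suc s) + (x + y) ≡ (2 + (y + (t + t))) + (x + (s + s))
    arr₂ = ℕ-Ring.solve-∀

  step-lose : ∀ k → D * 0 + energy nothing < 2 + energy (just (k , ℓ′))
  step-lose k = ℕₚ.≤-trans (ℕₚ.≤-reflexive (cong (λ x → suc (x + (ℓ + ℓ′))) (ℕₚ.*-zeroʳ D))) (s≤s (s≤s (ℕₚ.m≤n+m (ℓ′ + ℓ′) (weight k))))

  step-start : ∀ k → D * 1 + energy (just (k , 0)) < 2 + energy nothing
  step-start k = ℕₚ.+-cancelʳ-≤ M _ _ (begin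
    suc (D * 1 + (weight k + 0)) + M   ≡⟨ arr D M (weight k) ⟩
    suc (weight k + (D + M))           ≡⟨ cong (λ x → suc (weight k + x)) D+M ⟩
    suc (weight k + (ℓ + ℓ))           ≤⟨ s≤s (ℕₚ.+-monoˡ-≤ (ℓ + ℓ) (weight≤M k)) ⟩
    suc (M + (ℓ + ℓ))                  ≡⟨ arr₂ M ℓ′ ⟩
    2 + (ℓ + ℓ′) + M                   ∎)
    where
    open ℕₚ.≤-Reasoning
    arr : ∀ D M x → suc (D * 1 + (x + 0)) + M ≡ suc (x + (D + M))
    arr = ℕ-Ring.solve-∀
    arr₂ : ∀ M l → suc (M + (suc l + suc l)) ≡ 2 + (suc l + l) + M
    arr₂ = ℕ-Ring.solve-∀

  step-idle : D * 0 + energy nothing < 2 + energy nothing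
  step-idle = ℕₚ.≤-trans (ℕₚ.≤-reflexive (cong (λ x → suc (x + (ℓ + ℓ′))) (ℕₚ.*-zeroʳ D))) (s≤s (ℕₚ.n≤1+n _))

  energy-step : ∀ {σ σ′ f} → Step σ σ′ f → D * f + energy σ′ ≤ 2 + energy σ
  energy-step {just (k , t)} extend = ℕₚ.≤-reflexive (trans (cong (_+ (weight k + (suc t + suc t))) (ℕₚ.*-zeroʳ D)) (lem (weight k) t))
    where
    lem : ∀ x t → 0 + (x + (suc t + suc t)) ≡ 2 + (x + (t + t))
    lem = ℕ-Ring.solve-∀
  energy-step {just (k , t)} {just (k′ , _)} (join s eq o) = ℕₚ.+-cancelʳ-≤ (M + weight k) _ _
    (ℕₚ.≤-trans (ℕₚ.≤-reflexive (join-identity k k′ eq)) (ℕₚ.+-monoʳ-≤ (2 + (weight k + (t + t))) (overlap-bound k k′ (overlap< eq) o)))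
  energy-step (lose {k})  = ℕₚ.<⇒≤ (step-lose k)
  energy-step (start {k}) = ℕₚ.<⇒≤ (step-start k)
  energy-step idle        = ℕₚ.<⇒≤ step-idle

  -- `Reads bwd W 0` says that w is a palindrome; every place that shows w then shows its reversal
  -- too.
  multiplicity : ℕ
  multiplicity = if does (reads? bwd W 0) then 2 else 1

  reads-both : ∀ g s → indicator (reads? fwd g s) + indicator (reads? bwd g s) ≡ multiplicity * starts g s
  reads-both g s with reads? fwd g s | reads? bwd g s | reads? bwd W 0
  ... | yes _  | yes _  | yes _  = refl
  ... | yes F  | yes B  | no ¬p  = ⊥-elim (¬p (λ i<ℓ → trans (sym (F i<ℓ)) (B i<ℓ)))
  ... | yes F  | no ¬B  | yes p  = ⊥-elim (¬B (λ i<ℓ → trans (F i<ℓ) (p i<ℓ)))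
  ... | yes _  | no _   | no _   = refl
  ... | no ¬F  | yes B  | yes p  = ⊥-elim (¬F (λ i<ℓ → trans (B i<ℓ) (sym (p i<ℓ))))
  ... | no _   | yes _  | no _   = refl
  ... | no _   | no _   | yes _  = refl
  ... | no _   | no _   | no _   = refl

  defect : State → State → ℕ → ℕ
  defect σ σ′ f = (2 + energy σ) ∸ (D * f + energy σ′)

  defect-step : ∀ {σ σ′ f} → Step σ σ′ f → D * f + energy σ′ + defect σ σ′ f ≡ 2 + energy σ
  defect-step st = ℕₚ.m+[n∸m]≡n (energy-step st)

-- Letter counts on optimal lines

tally : (ℕ → ℕ) → ℕ → ℕ
tally f zero    = 0
tally f (suc n) = tally f n + f n

tally-cong : ∀ {f g} n → (∀ {i} → i < n → f i ≡ g i) → tally f n ≡ tally g n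
tally-cong zero    eq = refl
tally-cong (suc n) eq = cong₂ _+_ (tally-cong n (λ i<n → eq (ℕₚ.m≤n⇒m≤1+n i<n))) (eq ℕₚ.≤-refl)

tally-+ : ∀ f m n → tally f (m + n) ≡ tally f m + tally (λ i → f (m + i)) n
tally-+ f m zero    = trans (cong (tally f) (ℕₚ.+-identityʳ m)) (sym (ℕₚ.+-identityʳ _))
tally-+ f m (suc n) = trans (cong (tally f) (ℕₚ.+-suc m n))
  (trans (cong (_+ f (m + n)) (tally-+ f m n)) (ℕₚ.+-assoc (tally f m) _ _))

tally-head : ∀ f n → tally f (suc n) ≡ f 0 + tally (f ∘ suc) n
tally-head f n = tally-+ f 1 n

tally-reverse : ∀ f n m → tally (λ i → f (n + m ∸ suc i)) n + tally f m ≡ tally f (n + m)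
tally-reverse f zero    m = refl
tally-reverse f (suc n) m = begin
  tally (λ i → f (suc n + m ∸ suc i)) (suc n) + tally f m           ≡⟨ cong (_+ tally f m) (tally-head (λ i → f (suc n + m ∸ suc i)) n) ⟩
  f (n + m) + tally (λ i → f (n + m ∸ suc i)) n + tally f m         ≡⟨ ℕₚ.+-assoc (f (n + m)) _ _ ⟩
  f (n + m) + (tally (λ i → f (n + m ∸ suc i)) n + tally f m)       ≡⟨ cong (λ z → f (n + m) + z) (tally-reverse f n m) ⟩
  f (n + m) + tally f (n + m)                                       ≡⟨ ℕₚ.+-comm (f (n + m)) _ ⟩
  tally f (suc n + m)                                               ∎
  where open ≡-Reasoning

tally-≤ : ∀ f → (∀ i → f i ≤ 1) → ∀ n → tally f n ≤ n
tally-≤ f f≤1 zero    = z≤n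
tally-≤ f f≤1 (suc n) = ℕₚ.≤-trans (ℕₚ.+-mono-≤ (tally-≤ f f≤1 n) (f≤1 n)) (ℕₚ.≤-reflexive (ℕₚ.+-comm n 1))

module LetterCount (ℓ′ : ℕ) (W : ℕ → ℕ) (A : ℕ) where

  open Lines ℓ′ W

  isA : ℕ → ℕ
  isA x = if does (x ≟ A) then 1 else 0

  isA≤1 : ∀ x → isA x ≤ 1
  isA≤1 x with does (x ≟ A)
  ... | true  = ℕₚ.≤-refl
  ... | false = z≤n

  count : Kind → ℕ → ℕ
  count k n = tally (isA ∘ letter k) n

  count≤ : ∀ k n → count k n ≤ n
  count≤ k n = tally-≤ (isA ∘ letter k) (λ i → isA≤1 (letter k i)) n

  -- The first m letters of the reversal are the last m letters of w.
  count-complement : ∀ m n → m + n ≡ ℓ → count bwd m + count fwd n ≡ count fwd ℓ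
  count-complement m n eq = begin
    count bwd m + count fwd n                                 ≡⟨ cong (_+ count fwd n) (tally-cong m (λ {i} _ → cong (λ x → isA (W (x ∸ suc i))) (sym eq))) ⟩
    tally (λ i → isA (W (m + n ∸ suc i))) m + count fwd n     ≡⟨ tally-reverse (isA ∘ W) m n ⟩
    count fwd (m + n)                                         ≡⟨ cong (count fwd) eq ⟩
    count fwd ℓ                                               ∎
    where open ≡-Reasoning

  b̂ q̂ r̂ : ℕ
  b̂ = ℓ ∸ b
  q̂ = ℓ ∸ q
  r̂ = ℓ ∸ r

  b̂+b : b̂ + b ≡ ℓ
  b̂+b = ℕₚ.m∸n+n≡m (ℕₚ.<⇒≤ b<ℓ)
  q̂+q : q̂ + q ≡ ℓ
  q̂+q = ℕₚ.m∸n+n≡m (ℕₚ.<⇒≤ q<ℓ)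
  r̂+r : r̂ + r ≡ ℓ
  r̂+r = ℕₚ.m∸n+n≡m (ℕₚ.<⇒≤ r<ℓ)

  count-border : count fwd b̂ + count fwd b ≡ count fwd ℓ
  count-border = begin
    count fwd b̂ + count fwd b                              ≡⟨ cong (λ z → count fwd b̂ + z) (tally-cong b (λ i<b → cong isA (same i<b))) ⟩
    count fwd b̂ + tally (λ i → isA (W (b̂ + i))) b          ≡⟨ tally-+ (isA ∘ W) b̂ b ⟨
    count fwd (b̂ + b)                                      ≡⟨ cong (count fwd) b̂+b ⟩
    count fwd ℓ                                            ∎
    where
    open ≡-Reasoning
    arr : ∀ i x b → i + (x + b) ≡ x + i + b
    arr = ℕ-Ring.solve-∀
    same : ∀ {i} → i < b → W i ≡ W (b̂ + i)
    same {i} i<b = b-border (ℕₚ.<-trans i<b b<ℓ) (ℕₚ.≤-trans (ℕₚ.+-monoʳ-< b̂ i<b) (ℕₚ.≤-reflexive b̂+b))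
                            (trans (cong (λ z → i + z) (sym b̂+b)) (arr i b̂ b))

  count-bwd-border : count bwd b̂ ≡ count fwd b̂
  count-bwd-border = ℕₚ.+-cancelʳ-≡ (count fwd b) _ _ (trans (count-complement b̂ b b̂+b) (sym count-border))

  -- If the two ways of overlapping are equally efficient, the border
  -- and one palindrome account for the letters of the other palindrome.
  count-exchange : b + b ≡ q + r → count fwd b̂ + count fwd r ≡ count fwd q̂ + count fwd b
  count-exchange tie with ℕₚ.≤-total b q
  ... | inj₁ b≤q = begin
      count fwd b̂ + count fwd r                                       ≡⟨ cong (λ x → count fwd x + count fwd r) b̂≡ ⟩
      count fwd (q̂ + k) + count fwd r                                 ≡⟨ cong (_+ count fwd r) (tally-+ (isA ∘ W) q̂ k) ⟩
      count fwd q̂ + tally (λ i → isA (W (q̂ + i))) k + count fwd r     ≡⟨ cong (λ x → count fwd q̂ + x + count fwd r) (tally-cong k (λ i<k → cong isA (mirror i<k))) ⟩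
      count fwd q̂ + tally (λ i → isA (W (k + r ∸ suc i))) k + count fwd r ≡⟨ ℕₚ.+-assoc (count fwd q̂) _ _ ⟩
      count fwd q̂ + (tally (λ i → isA (W (k + r ∸ suc i))) k + count fwd r) ≡⟨ cong (λ z → count fwd q̂ + z) (tally-reverse (isA ∘ W) k r) ⟩
      count fwd q̂ + count fwd (k + r)                                 ≡⟨ cong (λ x → count fwd q̂ + count fwd x) k+r ⟩
      count fwd q̂ + count fwd b                                       ∎
    where
    open ≡-Reasoning
    k = q ∸ b
    k+b : k + b ≡ q
    k+b = ℕₚ.m∸n+n≡m b≤q
    arr₁ : ∀ k b r → k + r + b ≡ k + b + r
    arr₁ = ℕ-Ring.solve-∀
    k+r : k + r ≡ b
    k+r = ℕₚ.+-cancelʳ-≡ b (k + r) b (trans (arr₁ k b r) (trans (cong (_+ r) k+b) (sym tie)))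
    arr₂ : ∀ x k b → x + k + b ≡ x + (k + b)
    arr₂ = ℕ-Ring.solve-∀
    b̂≡ : b̂ ≡ q̂ + k
    b̂≡ = ℕₚ.+-cancelʳ-≡ b b̂ (q̂ + k) (trans b̂+b (trans (sym q̂+q) (trans (cong (λ z → q̂ + z) (sym k+b)) (sym (arr₂ q̂ k b)))))
    mirror : ∀ {i} → i < k → W (q̂ + i) ≡ W (k + r ∸ suc i)
    -- The palindromic suffix reflects q̂ + i to ℓ - 1 - i, and the border moves this to b - 1 - i,
    -- where b = k + r.
    mirror {i} i<k = trans (q-pal q̂+i<ℓ j<ℓ eq₁) (sym (b-border m<ℓ j<ℓ eq₂))
      where
      i<b = ℕₚ.<-≤-trans i<k (ℕₚ.≤-trans (ℕₚ.m≤m+n k r) (ℕₚ.≤-reflexive k+r))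
      i<ℓ = ℕₚ.<-trans i<b b<ℓ
      j = ℓ ∸ suc i
      m = k + r ∸ suc i
      j+ : j + suc i ≡ ℓ
      j+ = ℕₚ.m∸n+n≡m i<ℓ
      m+ : m + suc i ≡ b
      m+ = trans (ℕₚ.m∸n+n≡m (ℕₚ.≤-trans i<b (ℕₚ.≤-reflexive (sym k+r)))) k+r
      j<ℓ : j < ℓ
      j<ℓ = ℕₚ.≤-trans (ℕₚ.m<m+n j (s≤s z≤n)) (ℕₚ.≤-reflexive j+)
      m<ℓ : m < ℓ
      m<ℓ = ℕₚ.<-trans (ℕₚ.≤-trans (ℕₚ.m<m+n m (s≤s z≤n)) (ℕₚ.≤-reflexive m+)) b<ℓ
      q̂+i<ℓ : q̂ + i < ℓ
      q̂+i<ℓ = ℕₚ.≤-trans (ℕₚ.+-monoʳ-< q̂ (ℕₚ.<-≤-trans i<k (ℕₚ.≤-trans (ℕₚ.m≤m+n k b) (ℕₚ.≤-reflexive k+b)))) (ℕₚ.≤-reflexive q̂+q)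
      arr₃ : ∀ x i j q → suc (x + i + j + q) ≡ (x + q) + (j + suc i)
      arr₃ = ℕ-Ring.solve-∀
      eq₁ : suc (q̂ + i + j + q) ≡ ℓ + ℓ
      eq₁ = trans (arr₃ q̂ i j q) (cong₂ _+_ q̂+q j+)
      arr₄ : ∀ m j i → m + (j + suc i) ≡ j + (m + suc i)
      arr₄ = ℕ-Ring.solve-∀
      eq₂ : m + ℓ ≡ j + b
      eq₂ = trans (cong (λ z → m + z) (sym j+)) (trans (arr₄ m j i) (cong (λ z → j + z) m+))
  ... | inj₂ q≤b = sym (begin
      count fwd q̂ + count fwd b                                       ≡⟨ cong (λ x → count fwd x + count fwd b) q̂≡ ⟩
      count fwd (b̂ + k) + count fwd b                                 ≡⟨ cong (_+ count fwd b) (tally-+ (isA ∘ W) b̂ k) ⟩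
      count fwd b̂ + tally (λ i → isA (W (b̂ + i))) k + count fwd b     ≡⟨ cong (λ x → count fwd b̂ + x + count fwd b) (tally-cong k (λ i<k → cong isA (mirror i<k))) ⟩
      count fwd b̂ + tally (λ i → isA (W (k + b ∸ suc i))) k + count fwd b ≡⟨ ℕₚ.+-assoc (count fwd b̂) _ _ ⟩
      count fwd b̂ + (tally (λ i → isA (W (k + b ∸ suc i))) k + count fwd b) ≡⟨ cong (λ z → count fwd b̂ + z) (tally-reverse (isA ∘ W) k b) ⟩
      count fwd b̂ + count fwd (k + b)                                 ≡⟨ cong (λ x → count fwd b̂ + count fwd x) k+b ⟩
      count fwd b̂ + count fwd r                                       ∎)
    where
    open ≡-Reasoning
    k = b ∸ q
    k+q : k + q ≡ b
    k+q = ℕₚ.m∸n+n≡m q≤b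
    arr₁ : ∀ k b q → k + b + q ≡ (k + q) + b
    arr₁ = ℕ-Ring.solve-∀
    k+b : k + b ≡ r
    k+b = ℕₚ.+-cancelʳ-≡ q (k + b) r (trans (arr₁ k b q) (trans (cong (_+ b) k+q) (trans tie (ℕₚ.+-comm q r))))
    q̂≡ : q̂ ≡ b̂ + k
    q̂≡ = ℕₚ.+-cancelʳ-≡ q q̂ (b̂ + k) (trans q̂+q (trans (sym b̂+b) (trans (cong (λ z → b̂ + z) (sym k+q)) (sym (ℕₚ.+-assoc b̂ k q)))))
    mirror : ∀ {i} → i < k → W (b̂ + i) ≡ W (k + b ∸ suc i)
    -- Here the border acts first, taking b̂ + i to i, and the palindromic prefix reflects i to r -
    -- 1 - i, where r = k + b.
    mirror {i} i<k = trans (sym (b-border i<ℓ b̂+i<ℓ eq₂)) (r-pal i<ℓ m<ℓ eq₁)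
      where
      i<b = ℕₚ.<-≤-trans i<k (ℕₚ.≤-trans (ℕₚ.m≤m+n k q) (ℕₚ.≤-reflexive k+q))
      i<ℓ = ℕₚ.<-trans i<b b<ℓ
      m = k + b ∸ suc i
      m+ : m + suc i ≡ r
      m+ = trans (ℕₚ.m∸n+n≡m (ℕₚ.≤-trans i<b (ℕₚ.m≤n+m b k))) k+b
      m<ℓ : m < ℓ
      m<ℓ = ℕₚ.<-trans (ℕₚ.≤-trans (ℕₚ.m<m+n m (s≤s z≤n)) (ℕₚ.≤-reflexive m+)) r<ℓ
      b̂+i<ℓ : b̂ + i < ℓ
      b̂+i<ℓ = ℕₚ.≤-trans (ℕₚ.+-monoʳ-< b̂ i<b) (ℕₚ.≤-reflexive b̂+b)
      eq₁ : suc (i + m) ≡ r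
      eq₁ = trans (ℕₚ.+-comm (suc i) m) m+
      arr₂ : ∀ i x b → i + (x + b) ≡ x + i + b
      arr₂ = ℕ-Ring.solve-∀
      eq₂ : i + ℓ ≡ b̂ + i + b
      eq₂ = trans (cong (λ z → i + z) (sym b̂+b)) (arr₂ i b̂ b)

  -- In a tie two periods b̂ and one period q̂ + r̂ have the same length D. They must contain
  -- equally many A, or no single κ would centre the counts on every optimal line.
  count-tie : b + b ≡ q + r → count fwd b̂ + count fwd b̂ ≡ count fwd q̂ + count bwd r̂
  count-tie tie = ℕₚ.+-cancelʳ-≡ (count fwd r) _ _ (begin
    count fwd b̂ + count fwd b̂ + count fwd r     ≡⟨ ℕₚ.+-assoc (count fwd b̂) _ _ ⟩
    count fwd b̂ + (count fwd b̂ + count fwd r)   ≡⟨ cong (λ z → count fwd b̂ + z) (count-exchange tie) ⟩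
    count fwd b̂ + (count fwd q̂ + count fwd b)   ≡⟨ arr (count fwd b̂) (count fwd q̂) (count fwd b) ⟩
    count fwd q̂ + (count fwd b̂ + count fwd b)   ≡⟨ cong (λ z → count fwd q̂ + z) (trans count-border (sym (count-complement r̂ r r̂+r))) ⟩
    count fwd q̂ + (count bwd r̂ + count fwd r)   ≡⟨ ℕₚ.+-assoc (count fwd q̂) _ _ ⟨
    count fwd q̂ + count bwd r̂ + count fwd r     ∎)
    where
    open ≡-Reasoning
    arr : ∀ x y z → x + (y + z) ≡ y + (x + z)
    arr = ℕ-Ring.solve-∀

  -- On a line without defects, D consecutive letters contain κ letters A
  -- on average.
  abstract
    κ : ℕ
    κ with q + r ≤? b + b
    ... | yes _ = count fwd b̂ + count fwd b̂
    ... | no _  = count fwd q̂ + count bwd r̂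

    κ-border : M ≡ b + b → κ ≡ count fwd b̂ + count fwd b̂
    κ-border M≡ with q + r ≤? b + b
    ... | yes _ = refl
    ... | no ≰ = ⊥-elim (≰ (ℕₚ.≤-trans q+r≤M (ℕₚ.≤-reflexive M≡)))

    κ-palindromes : M ≡ q + r → κ ≡ count fwd q̂ + count bwd r̂
    κ-palindromes M≡ with q + r ≤? b + b
    ... | yes ≤ = count-tie (ℕₚ.≤-antisym (ℕₚ.≤-trans 2b≤M (ℕₚ.≤-reflexive M≡)) ≤)
    ... | no _ = refl

    κ≤ : κ ≤ ℓ + ℓ
    κ≤ with q + r ≤? b + b
    ... | yes _ = ℕₚ.+-mono-≤ (bound fwd b) (bound fwd b)
      where
      bound : ∀ k m → count k (ℓ ∸ m) ≤ ℓ
      bound k m = ℕₚ.≤-trans (count≤ k (ℓ ∸ m)) (ℕₚ.m∸n≤m ℓ m)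
    ... | no _ = ℕₚ.+-mono-≤ (bound fwd q) (bound bwd r)
      where
      bound : ∀ k m → count k (ℓ ∸ m) ≤ ℓ
      bound k m = ℕₚ.≤-trans (count≤ k (ℓ ∸ m)) (ℕₚ.m∸n≤m ℓ m)

  D-border : M ≡ b + b → D ≡ b̂ + b̂
  D-border M≡ = ℕₚ.+-cancelʳ-≡ M D (b̂ + b̂) (trans D+M (trans (cong (λ x → x + x) (sym b̂+b)) (trans (arr b̂ b) (cong (λ z → b̂ + b̂ + z) (sym M≡)))))
    where
    arr : ∀ x b → x + b + (x + b) ≡ x + x + (b + b)
    arr = ℕ-Ring.solve-∀

  D-palindromes : M ≡ q + r → D ≡ q̂ + r̂
  D-palindromes M≡ = ℕₚ.+-cancelʳ-≡ M D (q̂ + r̂) (trans D+M (trans (cong₂ _+_ (sym q̂+q) (sym r̂+r)) (trans (arr q̂ q r̂ r) (cong (λ z → q̂ + r̂ + z) (sym M≡)))))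
    where
    arr : ∀ x q y r → x + q + (y + r) ≡ x + y + (q + r)
    arr = ℕ-Ring.solve-∀

  -- D times the indicator of A centred at the density κ / D of optimal lines; the factor D keeps it
  -- integral.
  φ : ℕ → ℤ
  φ x = + D *ᶻ + isA x -ᶻ + κ

  excess : Kind → ℕ → ℤ
  excess k n = + D *ᶻ + count k n -ᶻ + κ *ᶻ + n

  excess-suc : ∀ k n → excess k (suc n) ≡ excess k n +ᶻ φ (letter k n)
  excess-suc k n = trans (cong (λ x → + D *ᶻ x -ᶻ + κ *ᶻ + suc n) (ℤₚ.pos-+ (count k n) (isA (letter k n))))
                         (lem (+ D) (+ count k n) (+ isA (letter k n)) (+ κ) (+ n))
    where
    lem : ∀ D c i κ n → D *ᶻ (c +ᶻ i) -ᶻ κ *ᶻ (1ℤ +ᶻ n) ≡ D *ᶻ c -ᶻ κ *ᶻ n +ᶻ (D *ᶻ i -ᶻ κ)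
    lem = ℤ-Ring.solve-∀

  excess-one : ∀ k → excess k 1 ≡ φ (letter k 0)
  excess-one k = trans (excess-suc k 0) (lem (+ D) (+ κ) (φ (letter k 0)))
    where
    lem : ∀ D κ x → D *ᶻ 0ℤ -ᶻ κ *ᶻ 0ℤ +ᶻ x ≡ x
    lem = ℤ-Ring.solve-∀

  -- A tight change from forward to backward happens after q̂ letters, so backward occurrences begin
  -- at the height reached there. The tight change back, after r̂ letters, returns to 0 by
  -- `excess-palindromes`.
  offset : Kind → ℤ
  offset fwd = 0ℤ
  offset bwd = excess fwd q̂

  height : State → ℤ
  height nothing        = 0ℤ
  height (just (k , t)) = excess k (suc t) +ᶻ offset k

  -- If borders are optimal, D = 2 b̂ and κ is twice the count on b̂ letters, so one period carries
  -- exactly its share of A.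
  excess-border : ∀ k → M ≡ b + b → excess k b̂ ≡ 0ℤ
  excess-border k M≡ = begin
    + D *ᶻ + count k b̂ -ᶻ + κ *ᶻ + b̂
      ≡⟨ cong₂ (λ x y → + x *ᶻ + count k b̂ -ᶻ + y *ᶻ + b̂) (D-border M≡) (κ-border M≡) ⟩
    (+ (b̂ + b̂)) *ᶻ + count k b̂ -ᶻ (+ (count fwd b̂ + count fwd b̂)) *ᶻ + b̂
      ≡⟨ cong (λ c → (+ (b̂ + b̂)) *ᶻ + c -ᶻ (+ (count fwd b̂ + count fwd b̂)) *ᶻ + b̂) (same k) ⟩
    (+ (b̂ + b̂)) *ᶻ + count fwd b̂ -ᶻ (+ (count fwd b̂ + count fwd b̂)) *ᶻ + b̂
      ≡⟨ cong₂ (λ x y → x *ᶻ + count fwd b̂ -ᶻ y *ᶻ + b̂) (ℤₚ.pos-+ b̂ b̂) (ℤₚ.pos-+ (count fwd b̂) (count fwd b̂)) ⟩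
    (+ b̂ +ᶻ + b̂) *ᶻ + count fwd b̂ -ᶻ (+ count fwd b̂ +ᶻ + count fwd b̂) *ᶻ + b̂
      ≡⟨ lem (+ b̂) (+ count fwd b̂) ⟩
    0ℤ ∎
    where
    open ≡-Reasoning
    same : ∀ k → count k b̂ ≡ count fwd b̂
    same fwd = refl
    same bwd = count-bwd-border
    lem : ∀ x c → (x +ᶻ x) *ᶻ c -ᶻ (c +ᶻ c) *ᶻ x ≡ 0ℤ
    lem = ℤ-Ring.solve-∀

  excess-palindromes : M ≡ q + r → excess bwd r̂ +ᶻ excess fwd q̂ ≡ 0ℤ
  excess-palindromes M≡ = begin
    excess bwd r̂ +ᶻ excess fwd q̂
      ≡⟨ cong₂ (λ x y → + x *ᶻ + count bwd r̂ -ᶻ + y *ᶻ + r̂ +ᶻ (+ x *ᶻ + count fwd q̂ -ᶻ + y *ᶻ + q̂)) (D-palindromes M≡) (κ-palindromes M≡) ⟩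
    (+ (q̂ + r̂)) *ᶻ + count bwd r̂ -ᶻ (+ (count fwd q̂ + count bwd r̂)) *ᶻ + r̂ +ᶻ ((+ (q̂ + r̂)) *ᶻ + count fwd q̂ -ᶻ (+ (count fwd q̂ + count bwd r̂)) *ᶻ + q̂)
      ≡⟨ cong₂ (λ x y → x *ᶻ + count bwd r̂ -ᶻ y *ᶻ + r̂ +ᶻ (x *ᶻ + count fwd q̂ -ᶻ y *ᶻ + q̂)) (ℤₚ.pos-+ q̂ r̂) (ℤₚ.pos-+ (count fwd q̂) (count bwd r̂)) ⟩
    _ ≡⟨ lem (+ q̂) (+ r̂) (+ count fwd q̂) (+ count bwd r̂) ⟩
    0ℤ ∎
    where
    open ≡-Reasoning
    lem : ∀ q r c d → (q +ᶻ r) *ᶻ d -ᶻ (c +ᶻ d) *ᶻ r +ᶻ ((q +ᶻ r) *ᶻ c -ᶻ (c +ᶻ d) *ᶻ q) ≡ 0ℤ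
    lem = ℤ-Ring.solve-∀

  half-≤ : ∀ {m n} → m + m ≤ n + n → m ≤ n
  half-≤ {m} {n} le with m ≤? n
  ... | yes m≤n = m≤n
  ... | no m≰n  = ⊥-elim (ℕₚ.<⇒≱ (ℕₚ.+-mono-< (ℕₚ.≰⇒> m≰n) (ℕₚ.≰⇒> m≰n)) le)

  -- Equality says 2s = M, and 2s ≤ 2b ≤ M leaves no room.
  tight-pure : ∀ {s} x → s < ℓ → Border s → x + (s + s) ≡ M + x → s ≡ b × M ≡ b + b
  tight-pure {s} x s< o eq = s≡b , trans (sym 2s≡M) (cong (λ y → y + y) s≡b)
    where
    2s≡M : s + s ≡ M
    2s≡M = ℕₚ.+-cancelˡ-≡ x (s + s) M (trans eq (ℕₚ.+-comm M x))
    s≡b : s ≡ b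
    s≡b = ℕₚ.≤-antisym (b-max s< o) (half-≤ (ℕₚ.≤-trans 2b≤M (ℕₚ.≤-reflexive (sym 2s≡M))))

  -- The chain y + 2s ≤ y + 2x ≤ M + x collapses.
  tight-mixed : ∀ {s} x y → s ≤ x → x + y ≤ M → y + (s + s) ≡ M + x → s ≡ x × M ≡ x + y
  tight-mixed {s} x y s≤x x+y≤M eq = s≡x , ℕₚ.+-cancelʳ-≡ x M (x + y) (trans (sym eq) (trans (cong (λ z → y + (z + z)) s≡x) (arr x y)))
    where
    arr : ∀ x y → y + (x + x) ≡ x + y + x
    arr = ℕ-Ring.solve-∀
    s≡x : s ≡ x
    s≡x = ℕₚ.≤-antisym s≤x (half-≤ (ℕₚ.+-cancelˡ-≤ y (x + x) (s + s)
      (ℕₚ.≤-trans (ℕₚ.≤-reflexive (arr x y)) (ℕₚ.≤-trans (ℕₚ.+-monoˡ-≤ x x+y≤M) (ℕₚ.≤-reflexive (sym eq))))))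

  gap : ∀ {t s m n} → t + suc s ≡ ℓ → n + m ≡ ℓ → s ≡ m → suc t ≡ n
  gap {t} {s} {m} {n} eq n+m refl = ℕₚ.+-cancelʳ-≡ s (suc t) n (trans (sym (ℕₚ.+-suc t s)) (trans eq (sym n+m)))

  -- A tight join has overlap b, q or r, so the distance between the starts is b̂, q̂ or r̂. The
  -- offsets are chosen to make the height continuous at precisely these distances.
  join-balance : ∀ k k′ {t s} → t + suc s ≡ ℓ → Overlap k k′ s → weight k′ + (s + s) ≡ M + weight k →
                 excess k (suc t) +ᶻ offset k ≡ offset k′
  join-balance fwd fwd eq o tight with tight-pure q (overlap< eq) o tight
  ... | s≡b , M≡ = trans (cong (λ n → excess fwd n +ᶻ 0ℤ) (gap eq b̂+b s≡b)) (trans (ℤₚ.+-identityʳ (excess fwd b̂)) (excess-border fwd M≡))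
  join-balance bwd bwd eq o tight with tight-pure r (overlap< eq) o tight
  ... | s≡b , M≡ = trans (cong (λ n → excess bwd n +ᶻ offset bwd) (gap eq b̂+b s≡b)) (trans (cong (_+ᶻ offset bwd) (excess-border bwd M≡)) (ℤₚ.+-identityˡ (offset bwd)))
  join-balance fwd bwd eq o tight with tight-mixed q r (q-max (overlap< eq) o) q+r≤M tight
  ... | s≡q , M≡ = trans (cong (λ n → excess fwd n +ᶻ 0ℤ) (gap eq q̂+q s≡q)) (ℤₚ.+-identityʳ (excess fwd q̂))
  join-balance bwd fwd eq o tight with tight-mixed r q (r-max (overlap< eq) o) (ℕₚ.≤-trans (ℕₚ.≤-reflexive (ℕₚ.+-comm r q)) q+r≤M) tight
  ... | s≡r , M≡ = trans (cong (λ n → excess bwd n +ᶻ excess fwd q̂) (gap eq r̂+r s≡r)) (excess-palindromes (trans M≡ (ℕₚ.+-comm r q)))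

  -- The transitions through `nothing` are strict, so a step without slack ends inside an
  -- occurrence. Its state then determines the current letter, and the height rises by φ of that
  -- letter.
  tight-step : ∀ {σ σ′ f} → Step σ σ′ f → D * f + energy σ′ ≡ 2 + energy σ →
               ∃[ k ] ∃[ t ] σ′ ≡ just (k , t) × φ (letter k t) ≡ height σ′ -ᶻ height σ
  tight-step (extend {k} {t}) _ = k , suc t , refl , sym (trans (cong (λ x → x +ᶻ offset k -ᶻ height (just (k , t))) (excess-suc k (suc t)))
    (lem (excess k (suc t)) (φ (letter k (suc t))) (offset k)))
    where
    lem : ∀ e p o → (e +ᶻ p) +ᶻ o -ᶻ (e +ᶻ o) ≡ p
    lem = ℤ-Ring.solve-∀
  tight-step (join {k} {k′} {t} s eq o) tight = k′ , 0 , refl , sym (trans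
    (cong₂ (λ x y → x +ᶻ offset k′ -ᶻ y) (excess-one k′) (join-balance k k′ eq o tight′)) (lem (φ (letter k′ 0)) (offset k′)))
    where
    lem : ∀ p o → p +ᶻ o -ᶻ o ≡ p
    lem = ℤ-Ring.solve-∀
    tight′ : weight k′ + (s + s) ≡ M + weight k
    tight′ = ℕₚ.+-cancelˡ-≡ (2 + (weight k + (t + t))) _ _ (trans (sym (join-identity k k′ eq)) (cong (_+ (M + weight k)) tight))
  tight-step (lose {k})  tight = ⊥-elim (ℕₚ.<-irrefl tight (step-lose k))
  tight-step (start {k}) tight = ⊥-elim (ℕₚ.<-irrefl tight (step-start k))
  tight-step idle        tight = ⊥-elim (ℕₚ.<-irrefl tight step-idle)

  err : (ℕ → ℕ) → (ℕ → ℕ) → ℤ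
  err g g′ = φ (g′ ℓ′) -ᶻ (height (state g′) -ᶻ height (state g))

  abstract
    L : ℕ
    -- D and κ are at most 2ℓ, counts and lengths at most ℓ. `H` doubles this because a height is an
    -- excess plus an offset.
    L = (ℓ + ℓ) * ℓ + (ℓ + ℓ) * ℓ

    L-def : L ≡ (ℓ + ℓ) * ℓ + (ℓ + ℓ) * ℓ
    L-def = refl

    L-bound : ∀ {c n} → c ≤ ℓ → n ≤ ℓ → D * c + κ * n ≤ L
    L-bound c≤ℓ n≤ℓ = ℕₚ.+-mono-≤ (ℕₚ.*-mono-≤ D≤ c≤ℓ) (ℕₚ.*-mono-≤ κ≤ n≤ℓ)

  H : ℕ
  H = L + L

  ∣φ∣≤ : ∀ x → abs (φ x) ≤ L
  ∣φ∣≤ x = begin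
    abs (+ D *ᶻ + isA x -ᶻ + κ)            ≤⟨ ℤₚ.∣i-j∣≤∣i∣+∣j∣ (+ D *ᶻ + isA x) (+ κ) ⟩
    abs (+ D *ᶻ + isA x) + κ               ≡⟨ cong (_+ κ) (ℤₚ.∣i*j∣≡∣i∣*∣j∣ (+ D) (+ isA x)) ⟩
    D * isA x + κ                        ≡⟨ cong (λ z → D * isA x + z) (sym (ℕₚ.*-identityʳ κ)) ⟩
    D * isA x + κ * 1                    ≤⟨ L-bound (ℕₚ.≤-trans (isA≤1 x) (s≤s z≤n)) (s≤s z≤n) ⟩
    L                                    ∎
    where open ℕₚ.≤-Reasoning

  ∣excess∣≤ : ∀ k {n} → n ≤ ℓ → abs (excess k n) ≤ L
  ∣excess∣≤ k {n} n≤ℓ = begin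
    abs (+ D *ᶻ + count k n -ᶻ + κ *ᶻ + n)       ≤⟨ ℤₚ.∣i-j∣≤∣i∣+∣j∣ (+ D *ᶻ + count k n) (+ κ *ᶻ + n) ⟩
    abs (+ D *ᶻ + count k n) + abs (+ κ *ᶻ + n)    ≡⟨ cong₂ _+_ (ℤₚ.∣i*j∣≡∣i∣*∣j∣ (+ D) (+ count k n)) (ℤₚ.∣i*j∣≡∣i∣*∣j∣ (+ κ) (+ n)) ⟩
    D * count k n + κ * n                      ≤⟨ L-bound (ℕₚ.≤-trans (count≤ k n) n≤ℓ) n≤ℓ ⟩
    L                                          ∎
    where open ℕₚ.≤-Reasoning

  ∣height∣≤ : ∀ g → abs (height (state g)) ≤ H
  ∣height∣≤ g = bound (state g) refl
    where
    ∣offset∣≤ : ∀ k → abs (offset k) ≤ L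
    ∣offset∣≤ fwd = z≤n
    ∣offset∣≤ bwd = ∣excess∣≤ fwd (ℕₚ.m∸n≤m ℓ q)
    bound : ∀ σ → state g ≡ σ → abs (height σ) ≤ H
    bound nothing        eq = z≤n
    bound (just (k , t)) eq = ℕₚ.≤-trans (ℤₚ.∣i+j∣≤∣i∣+∣j∣ (excess k (suc t)) (offset k))
      (ℕₚ.+-mono-≤ (∣excess∣≤ k (proj₁ (state-letter g eq))) (∣offset∣≤ k))

  C : ℕ
  C = (L + (H + H)) * (L + (H + H))

  square-abs : ∀ x → x *ᶻ x ≡ + (abs x * abs x)
  square-abs (+ n)      = sym (ℤₚ.pos-* n n)
  square-abs (-[1+ n ]) = refl

  square-≤ : ∀ {x m} → abs x ≤ m → x *ᶻ x ≤ᶻ + (m * m)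
  square-≤ {x} le = ℤₚ.≤-trans (ℤₚ.≤-reflexive (square-abs x)) (ℤ.+≤+ (ℕₚ.*-mono-≤ le le))

  -- A defect is an integer: it is 0, and then the error vanishes by `tight-step`, or at least 1,
  -- and then the crude bound C on the squared error suffices.
  err-bound : ∀ {g g′} → (∀ i → g′ i ≡ g (suc i)) →
              err g g′ *ᶻ err g g′ ≤ᶻ + C *ᶻ + defect (state g) (state g′) (fresh g′)
  err-bound {g} {g′} g′≡ with defect (state g) (state g′) (fresh g′) in eq
  ... | zero = ℤₚ.≤-reflexive (trans (cong (λ x → x *ᶻ x) err≡0) (sym (ℤₚ.*-zeroʳ (+ C))))
    where
    st = steps {g} {g′} g′≡
    err≡0 : err g g′ ≡ 0ℤ
    err≡0 with tight-step st (ℕₚ.≤-antisym (energy-step st) (ℕₚ.m∸n≡0⇒m≤n eq))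
    ... | k , t , σ′≡ , φ≡ = trans (cong (_-ᶻ (height (state g′) -ᶻ height (state g))) (trans (cong φ (proj₂ (state-letter g′ σ′≡))) φ≡))
                                  (ℤₚ.+-inverseʳ (height (state g′) -ᶻ height (state g)))
  ... | suc n = ℤₚ.≤-trans (square-≤ {err g g′} err≤) (ℤₚ.≤-trans (ℤ.+≤+ (ℕₚ.m≤m*n C (suc n))) (ℤₚ.≤-reflexive (ℤₚ.pos-* C (suc n))))
    where
    err≤ : abs (err g g′) ≤ L + (H + H)
    err≤ = ℕₚ.≤-trans (ℤₚ.∣i-j∣≤∣i∣+∣j∣ (φ (g′ ℓ′)) (height (state g′) -ᶻ height (state g)))
      (ℕₚ.+-mono-≤ (∣φ∣≤ (g′ ℓ′)) (ℕₚ.≤-trans (ℤₚ.∣i-j∣≤∣i∣+∣j∣ (height (state g′)) (height (state g))) (ℕₚ.+-mono-≤ (∣height∣≤ g′) (∣height∣≤ g))))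

-- Counting appearances in a grid

-- Out-of-range entries are 0.
nth : List ℕ → ℕ → ℕ
nth []      i       = 0
nth (a ∷ w) zero    = a
nth (a ∷ w) (suc i) = nth w i

negate : Dir → Dir
negate neg = pos
negate zer = zer
negate pos = neg

opposite : ∀ {d} → Vec Dir d → Vec Dir d
opposite = Vec.map negate

isNonzero-opposite : ∀ {d} (v : Vec Dir d) → isNonzero (opposite v) ≡ isNonzero v
isNonzero-opposite []        = refl
isNonzero-opposite (neg ∷ v) = refl
isNonzero-opposite (zer ∷ v) = isNonzero-opposite v
isNonzero-opposite (pos ∷ v) = refl

opposite-shift : ∀ {d} (v : Vec Dir d) n i j → i + j ≡ n → + i ⊙ ⟦ opposite v ⟧ ⊕ + n ⊙ ⟦ v ⟧ ≡ + j ⊙ ⟦ v ⟧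
opposite-shift []      n i j eq   = refl
opposite-shift (a ∷ v) n i j refl = cong₂ _∷_ (trans (cong₂ (λ x y → + i *ᶻ x +ᶻ y *ᶻ dirℤ a) (neg≡ a) (ℤₚ.pos-+ i j)) (lem (+ i) (+ j) (dirℤ a)))
                                              (opposite-shift v n i j refl)
  where
  neg≡ : ∀ a → dirℤ (negate a) ≡ -ᶻ dirℤ a
  neg≡ neg = refl
  neg≡ zer = refl
  neg≡ pos = refl
  lem : ∀ i j a → i *ᶻ (-ᶻ a) +ᶻ (i +ᶻ j) *ᶻ a ≡ j *ᶻ a
  lem = ℤ-Ring.solve-∀

∑-directions : ∀ d (F : Vec Dir (suc d) → ℤ) →
  ∑ (allDirVecs (suc d)) F ≡ ∑ (allDirVecs d) (λ v → F (neg ∷ v) +ᶻ (F (zer ∷ v) +ᶻ (F (pos ∷ v) +ᶻ 0ℤ)))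
∑-directions d F = ∑-concatMap (λ v → map (_∷ v) (neg ∷ zer ∷ pos ∷ [])) (allDirVecs d) F

∑-opposite : ∀ d (F : Vec Dir d → ℤ) → ∑ (allDirVecs d) (F ∘ opposite) ≡ ∑ (allDirVecs d) F
∑-opposite zero    F = refl
∑-opposite (suc d) F = begin
  ∑ (allDirVecs (suc d)) (F ∘ opposite)
    ≡⟨ ∑-directions d (F ∘ opposite) ⟩
  ∑ (allDirVecs d) (λ v → F (pos ∷ opposite v) +ᶻ (F (zer ∷ opposite v) +ᶻ (F (neg ∷ opposite v) +ᶻ 0ℤ)))
    ≡⟨ ∑-opposite d (λ v → F (pos ∷ v) +ᶻ (F (zer ∷ v) +ᶻ (F (neg ∷ v) +ᶻ 0ℤ))) ⟩
  ∑ (allDirVecs d) (λ v → F (pos ∷ v) +ᶻ (F (zer ∷ v) +ᶻ (F (neg ∷ v) +ᶻ 0ℤ)))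
    ≡⟨ ∑-cong (allDirVecs d) (λ v → lem (F (pos ∷ v)) (F (zer ∷ v)) (F (neg ∷ v))) ⟩
  ∑ (allDirVecs d) (λ v → F (neg ∷ v) +ᶻ (F (zer ∷ v) +ᶻ (F (pos ∷ v) +ᶻ 0ℤ)))
    ≡⟨ ∑-directions d F ⟨
  ∑ (allDirVecs (suc d)) F ∎
  where
  open ≡-Reasoning
  lem : ∀ a b c → a +ᶻ (b +ᶻ (c +ᶻ 0ℤ)) ≡ c +ᶻ (b +ᶻ (a +ᶻ 0ℤ))
  lem = ℤ-Ring.solve-∀

nonzero : ∀ {d} → Vec Dir d → ℤ
nonzero v = if isNonzero v then 1ℤ else 0ℤ

nonzero≥0 : ∀ {d} (v : Vec Dir d) → 0ℤ ≤ᶻ nonzero v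
nonzero≥0 v with isNonzero v
... | true  = 0≤+
... | false = 0≤+

∑-directions-const : ∀ d → ∑ (allDirVecs d) (λ _ → 1ℤ) ≡ + (3 ^ d)
∑-directions-const zero    = refl
∑-directions-const (suc d) = begin
  ∑ (allDirVecs (suc d)) (λ _ → 1ℤ)         ≡⟨ ∑-directions d (λ _ → 1ℤ) ⟩
  ∑ (allDirVecs d) (λ _ → (+ 3) *ᶻ 1ℤ)        ≡⟨ ∑-*ˡ (allDirVecs d) (+ 3) (λ _ → 1ℤ) ⟩
  (+ 3) *ᶻ ∑ (allDirVecs d) (λ _ → 1ℤ)        ≡⟨ cong ((+ 3) *ᶻ_) (∑-directions-const d) ⟩
  (+ 3) *ᶻ + (3 ^ d)                          ≡⟨ ℤₚ.pos-* 3 (3 ^ d) ⟨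
  + (3 ^ suc d)                             ∎
  where open ≡-Reasoning

∑-nonzero : ∀ d → ∑ (allDirVecs d) nonzero +ᶻ 1ℤ ≡ + (3 ^ d)
∑-nonzero zero    = refl
∑-nonzero (suc d) = begin
  ∑ (allDirVecs (suc d)) nonzero +ᶻ 1ℤ
    ≡⟨ cong (_+ᶻ 1ℤ) (∑-directions d nonzero) ⟩
  ∑ (allDirVecs d) (λ v → 1ℤ +ᶻ (nonzero v +ᶻ (1ℤ +ᶻ 0ℤ))) +ᶻ 1ℤ
    ≡⟨ cong (_+ᶻ 1ℤ) (∑-cong (allDirVecs d) (λ v → lem₁ (nonzero v))) ⟩
  ∑ (allDirVecs d) (λ v → nonzero v +ᶻ (+ 2) *ᶻ 1ℤ) +ᶻ 1ℤ
    ≡⟨ cong (_+ᶻ 1ℤ) (trans (∑-+ (allDirVecs d) nonzero (λ _ → (+ 2) *ᶻ 1ℤ)) (cong (∑ (allDirVecs d) nonzero +ᶻ_) (∑-*ˡ (allDirVecs d) (+ 2) (λ _ → 1ℤ)))) ⟩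
  ∑ (allDirVecs d) nonzero +ᶻ (+ 2) *ᶻ ∑ (allDirVecs d) (λ _ → 1ℤ) +ᶻ 1ℤ
    ≡⟨ lem₂ (∑ (allDirVecs d) nonzero) (∑ (allDirVecs d) (λ _ → 1ℤ)) ⟩
  (∑ (allDirVecs d) nonzero +ᶻ 1ℤ) +ᶻ (+ 2) *ᶻ ∑ (allDirVecs d) (λ _ → 1ℤ)
    ≡⟨ cong₂ (λ x y → x +ᶻ (+ 2) *ᶻ y) (∑-nonzero d) (∑-directions-const d) ⟩
  + (3 ^ d) +ᶻ (+ 2) *ᶻ + (3 ^ d)
    ≡⟨ lem₃ (+ (3 ^ d)) ⟩
  (+ 3) *ᶻ + (3 ^ d)
    ≡⟨ ℤₚ.pos-* 3 (3 ^ d) ⟨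
  + (3 ^ suc d) ∎
  where
  open ≡-Reasoning
  lem₁ : ∀ n → 1ℤ +ᶻ (n +ᶻ (1ℤ +ᶻ 0ℤ)) ≡ n +ᶻ (+ 2) *ᶻ 1ℤ
  lem₁ = ℤ-Ring.solve-∀
  lem₂ : ∀ x y → x +ᶻ (+ 2) *ᶻ y +ᶻ 1ℤ ≡ (x +ᶻ 1ℤ) +ᶻ (+ 2) *ᶻ y
  lem₂ = ℤ-Ring.solve-∀
  lem₃ : ∀ x → x +ᶻ (+ 2) *ᶻ x ≡ (+ 3) *ᶻ x
  lem₃ = ℤ-Ring.solve-∀

-- Since 3^d is odd, the integer division in `K` is exact.
K-spec : ∀ d → suc (K d * 2) ≡ 3 ^ d
K-spec d with half d
  where
  half : ∀ d → ∃[ m ] 3 ^ d ≡ suc (m * 2)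
  half zero    = 0 , refl
  half (suc d) with half d
  ... | m , eq = 1 + m * 3 , trans (cong (3 *_) eq) (lem m)
    where
    lem : ∀ m → 3 * suc (m * 2) ≡ suc ((1 + m * 3) * 2)
    lem = ℕ-Ring.solve-∀
... | m , eq rewrite eq = cong (λ x → suc (x * 2)) (ℕ-DivMod.m*n/n≡m m 2)

∑-nonzero-K : ∀ d → ∑ (allDirVecs d) nonzero ≡ (+ 2) *ᶻ + K d
∑-nonzero-K d = ℤ-Group.∙-cancelʳ 1ℤ _ _ (trans (∑-nonzero d) (trans (cong +_ (sym (K-spec d)))
  (trans (ℤₚ.pos-+ 1 (K d * 2)) (trans (cong (1ℤ +ᶻ_) (ℤₚ.pos-* (K d) 2)) (lem (+ K d))))))
  where
  lem : ∀ k → 1ℤ +ᶻ k *ᶻ (+ 2) ≡ (+ 2) *ᶻ k +ᶻ 1ℤ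
  lem = ℤ-Ring.solve-∀

module GridLines (a₀ : ℕ) (w′ : List ℕ) {d} (Γ : Grid d) where

  w : List ℕ
  w = a₀ ∷ w′

  open Lines (length w′) (nth w) public

  ns : Vec ℕ d
  ns = shape Γ

  P : List (Vec ℕ d)
  P = positions ns

  T : Vec ℤ d → Vec ℕ d → Vec ℕ d
  T = translate ns

  line : Vec Dir d → Vec ℕ d → ℕ → ℕ
  line v p i = label Γ (T (+ i ⊙ ⟦ v ⟧) p)

  line-shift : ∀ v p n i → line v (T (+ n ⊙ ⟦ v ⟧) p) i ≡ line v p (n + i)
  line-shift v p n i = cong (label Γ) (trans (translate-∘ ns (+ i ⊙ ⟦ v ⟧) (+ n ⊙ ⟦ v ⟧) p)
    (cong (λ h → T h p) (⊙-+ n i ⟦ v ⟧)))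

  line-suc : ∀ v p i → line v (T (+ 1 ⊙ ⟦ v ⟧) p) i ≡ line v p (suc i)
  line-suc v p = line-shift v p 1

  -- Stated for an arbitrary decision `u?`, so that the recursion can continue with a decision
  -- transported to the tail of the word.
  appearsFrom-does : ∀ p v i u (u? : Dec (∀ {j} → j < length u → line v p (i + j) ≡ nth u j)) →
                     appearsFrom Γ p v i u ≡ does u?
  appearsFrom-does p v i []      u? = sym (dec-true u? (λ ()))
  appearsFrom-does p v i (a ∷ u) u? =
    trans (cong (λ y → does (label Γ y ≟ a) ∧ appearsFrom Γ p v (suc i) u) (shift≡translate (shapePos Γ) p v i))
          (split (line v p i ≟ a))
    where
    tail : (∀ {j} → j < suc (length u) → line v p (i + j) ≡ nth (a ∷ u) j) → (∀ {j} → j < length u → line v p (suc i + j) ≡ nth u j)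
    tail all {j} j< = trans (cong (line v p) (sym (ℕₚ.+-suc i j))) (all (s≤s j<))
    cons : line v p i ≡ a → (∀ {j} → j < length u → line v p (suc i + j) ≡ nth u j) → (∀ {j} → j < suc (length u) → line v p (i + j) ≡ nth (a ∷ u) j)
    cons ≡a all {zero}  _        = trans (cong (line v p) (ℕₚ.+-identityʳ i)) ≡a
    cons ≡a all {suc j} (s≤s j<) = trans (cong (line v p) (ℕₚ.+-suc i j)) (all j<)
    split : (a? : Dec (line v p i ≡ a)) → does a? ∧ appearsFrom Γ p v (suc i) u ≡ does u?
    split (no ≢a)  = sym (dec-false u? (λ all → ≢a (trans (cong (line v p) (sym (ℕₚ.+-identityʳ i))) (all (s≤s z≤n)))))
    split (yes ≡a) = appearsFrom-does p v (suc i) u (map′ tail (cons ≡a) u?)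

  found : Vec Dir d → ℤ
  found v = ∑ P (λ p → + indicator (reads? fwd (line v p) 0))

  -- The reversal read from p along v is w read from the far end p + ℓ′ v along -v, and p ↦ p + ℓ′ v
  -- does not change the sum.
  found-bwd : ∀ v → ∑ P (λ p → + indicator (reads? bwd (line v p) 0)) ≡ found (opposite v)
  found-bwd v = trans (∑-cong P (λ p → cong (λ x → + (if x then 1 else 0))
      (does-⇔ (mk⇔ (to p) (from p)) (reads? bwd (line v p) 0) (reads? fwd (line (opposite v) (end p)) 0))))
    (∑-translate ns (+ length w′ ⊙ ⟦ v ⟧) (λ p → + indicator (reads? fwd (line (opposite v) p) 0)))
    where
    end : Vec ℕ d → Vec ℕ d
    end p = T (+ length w′ ⊙ ⟦ v ⟧) p
    reversed : ∀ p i j → i + j ≡ length w′ → line (opposite v) (end p) i ≡ line v p j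
    reversed p i j eq = cong (label Γ) (trans (translate-∘ ns (+ i ⊙ ⟦ opposite v ⟧) (+ length w′ ⊙ ⟦ v ⟧) p)
      (cong (λ h → T h p) (opposite-shift v (length w′) i j eq)))
    to : ∀ p → Reads bwd (line v p) 0 → Reads fwd (line (opposite v) (end p)) 0
    to p R {i} i<ℓ = trans (reversed p i (length w′ ∸ i) (ℕₚ.m+[n∸m]≡n (ℕₚ.≤-pred i<ℓ)))
      (reads-bwd (line v p) 0 R i<ℓ (ℕₚ.m∸n+n≡m (ℕₚ.≤-pred i<ℓ)))
    from : ∀ p → Reads fwd (line (opposite v) (end p)) 0 → Reads bwd (line v p) 0
    from p R {i} i<ℓ = trans (sym (reversed p (length w′ ∸ i) i (ℕₚ.m∸n+n≡m (ℕₚ.≤-pred i<ℓ))))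
      (R (s≤s (ℕₚ.m∸n≤m (length w′) i)))

  ∑-appearances : + appearances w Γ ≡ ∑ (allDirVecs d) (λ v → nonzero v *ᶻ found v)
  ∑-appearances = begin
    + appearances w Γ
      ≡⟨ ∑-sum (concatMap (λ p → map (λ v → if appears Γ p v w then 1 else 0) V) P) ⟩
    ∑ (concatMap (λ p → map (λ v → if appears Γ p v w then 1 else 0) V) P) (λ x → + x)
      ≡⟨ ∑-concatMap (λ p → map (λ v → if appears Γ p v w then 1 else 0) V) P (λ x → + x) ⟩
    ∑ P (λ p → ∑ (map (λ v → if appears Γ p v w then 1 else 0) V) (λ x → + x))
      ≡⟨ ∑-cong P (λ p → ∑-map (λ v → if appears Γ p v w then 1 else 0) V (λ x → + x)) ⟩
    ∑ P (λ p → ∑ V (λ v → + (if appears Γ p v w then 1 else 0)))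
      ≡⟨ ∑-swap P V (λ p v → + (if appears Γ p v w then 1 else 0)) ⟩
    ∑ V (λ v → ∑ P (λ p → + (if appears Γ p v w then 1 else 0)))
      ≡⟨ ∑-cong V (λ v → ∑-cong P (λ p → single v p)) ⟩
    ∑ V (λ v → ∑ P (λ p → nonzero v *ᶻ + indicator (reads? fwd (line v p) 0)))
      ≡⟨ ∑-cong V (λ v → ∑-*ˡ P (nonzero v) (λ p → + indicator (reads? fwd (line v p) 0))) ⟩
    ∑ V (λ v → nonzero v *ᶻ found v) ∎
    where
    open ≡-Reasoning
    V = allDirVecs d
    single : ∀ v p → + (if appears Γ p v w then 1 else 0) ≡ nonzero v *ᶻ + indicator (reads? fwd (line v p) 0)
    single v p with isNonzero v
    ... | true  = trans (cong (λ x → + (if x then 1 else 0)) (appearsFrom-does p v 0 w (reads? fwd (line v p) 0)))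
                        (sym (ℤₚ.*-identityˡ (+ indicator (reads? fwd (line v p) 0))))
    ... | false = refl

  occurrences : Vec Dir d → ℤ
  occurrences v = ∑ P (λ p → + starts (line v p) 0)

  found-both : ∀ v → found v +ᶻ found (opposite v) ≡ + multiplicity *ᶻ occurrences v
  found-both v = begin
    found v +ᶻ found (opposite v)
      ≡⟨ cong (found v +ᶻ_) (sym (found-bwd v)) ⟩
    found v +ᶻ ∑ P (λ p → + indicator (reads? bwd (line v p) 0))
      ≡⟨ ∑-+ P (λ p → + indicator (reads? fwd (line v p) 0)) (λ p → + indicator (reads? bwd (line v p) 0)) ⟨
    ∑ P (λ p → + indicator (reads? fwd (line v p) 0) +ᶻ + indicator (reads? bwd (line v p) 0))
      ≡⟨ ∑-cong P (λ p → trans (sym (ℤₚ.pos-+ (indicator (reads? fwd (line v p) 0)) (indicator (reads? bwd (line v p) 0))))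
           (trans (cong +_ (reads-both (line v p) 0)) (ℤₚ.pos-* multiplicity (starts (line v p) 0)))) ⟩
    ∑ P (λ p → + multiplicity *ᶻ + starts (line v p) 0)
      ≡⟨ ∑-*ˡ P (+ multiplicity) (λ p → + starts (line v p) 0) ⟩
    + multiplicity *ᶻ occurrences v ∎
    where open ≡-Reasoning

  next : Vec Dir d → Vec ℕ d → Vec ℕ d
  next v p = T (+ 1 ⊙ ⟦ v ⟧) p

  defectAt : Vec Dir d → Vec ℕ d → ℕ
  defectAt v p = defect (state (line v p)) (state (line v (next v p))) (fresh (line v (next v p)))

  defects : Vec Dir d → ℤ
  defects v = ∑ P (λ p → + defectAt v p)

  G : ℤ
  G = + size ns

  ∑-fresh : ∀ v → ∑ P (λ p → + fresh (line v (next v p))) ≡ occurrences v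
  ∑-fresh v = begin
    ∑ P (λ p → + fresh (line v (next v p)))
      ≡⟨ ∑-translate ns (+ 1 ⊙ ⟦ v ⟧) (λ p → + fresh (line v p)) ⟩
    ∑ P (λ p → + fresh (line v p))
      ≡⟨ ∑-cong P (λ p → cong (λ m → + maybe′ (λ _ → 1) 0 m)
           (kindAt-cong {line v p} {line v (T (+ length w′ ⊙ ⟦ v ⟧) p)} {length w′} {0} (λ i → sym (line-shift v p (length w′) i)))) ⟩
    ∑ P (λ p → + starts (line v (T (+ length w′ ⊙ ⟦ v ⟧) p)) 0)
      ≡⟨ ∑-translate ns (+ length w′ ⊙ ⟦ v ⟧) (λ p → + starts (line v p) 0) ⟩
    occurrences v ∎
    where
    open ≡-Reasoning

  -- The sum of `defect-step` over the torus. The energies before and after the step have equal sums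
  -- and cancel, leaving 2 for each position.
  line-balance : ∀ v → + D *ᶻ occurrences v +ᶻ defects v ≡ (+ 2) *ᶻ G
  line-balance v = ℤ-Group.∙-cancelʳ Etot _ _ (begin
    + D *ᶻ occurrences v +ᶻ defects v +ᶻ Etot
      ≡⟨ cong₂ (λ x y → + D *ᶻ x +ᶻ defects v +ᶻ y) (sym (∑-fresh v)) (sym (∑-translate ns (+ 1 ⊙ ⟦ v ⟧) e)) ⟩
    + D *ᶻ ∑ P f +ᶻ ∑ P δ +ᶻ ∑ P (λ p → e (next v p))
      ≡⟨ cong (λ x → x +ᶻ ∑ P δ +ᶻ ∑ P (λ p → e (next v p))) (sym (∑-*ˡ P (+ D) f)) ⟩
    ∑ P (λ p → + D *ᶻ f p) +ᶻ ∑ P δ +ᶻ ∑ P (λ p → e (next v p))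
      ≡⟨ cong (_+ᶻ ∑ P (λ p → e (next v p))) (sym (∑-+ P (λ p → + D *ᶻ f p) δ)) ⟩
    ∑ P (λ p → + D *ᶻ f p +ᶻ δ p) +ᶻ ∑ P (λ p → e (next v p))
      ≡⟨ ∑-+ P (λ p → + D *ᶻ f p +ᶻ δ p) (λ p → e (next v p)) ⟨
    ∑ P (λ p → + D *ᶻ f p +ᶻ δ p +ᶻ e (next v p))
      ≡⟨ ∑-cong P pointwise ⟩
    ∑ P (λ p → (+ 2) +ᶻ e p)
      ≡⟨ ∑-+ P (λ _ → + 2) e ⟩
    ∑ P (λ _ → + 2) +ᶻ Etot
      ≡⟨ cong (_+ᶻ Etot) (trans (∑-positions-const ns (+ 2)) (ℤₚ.*-comm G (+ 2))) ⟩
    (+ 2) *ᶻ G +ᶻ Etot ∎)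
    where
    open ≡-Reasoning
    e f δ : Vec ℕ d → ℤ
    e p = + energy (state (line v p))
    f p = + fresh (line v (next v p))
    δ p = + defectAt v p
    Etot = ∑ P e
    lem : ∀ x y z → x +ᶻ y +ᶻ z ≡ x +ᶻ z +ᶻ y
    lem = ℤ-Ring.solve-∀
    pointwise : ∀ p → + D *ᶻ f p +ᶻ δ p +ᶻ e (next v p) ≡ (+ 2) +ᶻ e p
    pointwise p = begin
      + D *ᶻ f p +ᶻ δ p +ᶻ e (next v p)  ≡⟨ lem (+ D *ᶻ f p) (δ p) (e (next v p)) ⟩
      + D *ᶻ f p +ᶻ e (next v p) +ᶻ δ p  ≡⟨ cong (λ x → x +ᶻ e (next v p) +ᶻ δ p) (sym (ℤₚ.pos-* D fr)) ⟩
      + (D * fr) +ᶻ e (next v p) +ᶻ δ p  ≡⟨ cong (_+ᶻ δ p) (sym (ℤₚ.pos-+ (D * fr) en)) ⟩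
      + (D * fr + en) +ᶻ δ p             ≡⟨ ℤₚ.pos-+ (D * fr + en) (defectAt v p) ⟨
      + (D * fr + en + defectAt v p)     ≡⟨ cong +_ (defect-step (steps {line v p} {line v (next v p)} (line-suc v p))) ⟩
      + (2 + energy (state (line v p)))  ≡⟨ ℤₚ.pos-+ 2 _ ⟩
      (+ 2) +ᶻ e p                       ∎
      where
      fr = fresh (line v (next v p))
      en = energy (state (line v (next v p)))

  totalDefects : ℤ
  totalDefects = ∑ (allDirVecs d) (λ v → nonzero v *ᶻ defects v)

  -- The inequality C_d ≤ K_d C₁ as an exact identity, with the total defect as the deficit. Adding
  -- the appearances along v and -v counts each one twice, and there are 2 K_d nonzero directions.
  grid-balance : (+ 2) *ᶻ (+ D *ᶻ + appearances w Γ) +ᶻ + multiplicity *ᶻ totalDefects ≡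
                 (+ 4) *ᶻ (+ multiplicity *ᶻ (+ K d *ᶻ G))
  grid-balance = begin
    (+ 2) *ᶻ (+ D *ᶻ a) +ᶻ m *ᶻ totalDefects
      ≡⟨ lem₁ (+ D) a (m *ᶻ totalDefects) ⟩
    + D *ᶻ (a +ᶻ a) +ᶻ m *ᶻ totalDefects
      ≡⟨ cong (λ x → + D *ᶻ x +ᶻ m *ᶻ totalDefects) twice ⟩
    + D *ᶻ ∑ V (λ v → m *ᶻ (nonzero v *ᶻ occurrences v)) +ᶻ m *ᶻ totalDefects
      ≡⟨ cong₂ _+ᶻ_ (trans (cong (+ D *ᶻ_) (∑-*ˡ V m (λ v → nonzero v *ᶻ occurrences v))) (lem₂ (+ D) m (∑ V (λ v → nonzero v *ᶻ occurrences v)))) refl ⟩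
    m *ᶻ (+ D *ᶻ ∑ V (λ v → nonzero v *ᶻ occurrences v)) +ᶻ m *ᶻ totalDefects
      ≡⟨ ℤₚ.*-distribˡ-+ m (+ D *ᶻ ∑ V (λ v → nonzero v *ᶻ occurrences v)) totalDefects ⟨
    m *ᶻ (+ D *ᶻ ∑ V (λ v → nonzero v *ᶻ occurrences v) +ᶻ totalDefects)
      ≡⟨ cong (m *ᶻ_) summed ⟩
    m *ᶻ (((+ 2) *ᶻ + K d) *ᶻ ((+ 2) *ᶻ G))
      ≡⟨ lem₃ m (+ K d) G ⟩
    (+ 4) *ᶻ (m *ᶻ (+ K d *ᶻ G)) ∎
    where
    open ≡-Reasoning
    V = allDirVecs d
    a = + appearances w Γ
    m = + multiplicity
    lem₁ : ∀ D a t → (+ 2) *ᶻ (D *ᶻ a) +ᶻ t ≡ D *ᶻ (a +ᶻ a) +ᶻ t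
    lem₁ = ℤ-Ring.solve-∀
    lem₂ : ∀ D m t → D *ᶻ (m *ᶻ t) ≡ m *ᶻ (D *ᶻ t)
    lem₂ = ℤ-Ring.solve-∀
    lem₃ : ∀ m k g → m *ᶻ (((+ 2) *ᶻ k) *ᶻ ((+ 2) *ᶻ g)) ≡ (+ 4) *ᶻ (m *ᶻ (k *ᶻ g))
    lem₃ = ℤ-Ring.solve-∀
    reversed : a ≡ ∑ V (λ v → nonzero v *ᶻ found (opposite v))
    reversed = trans ∑-appearances (trans (sym (∑-opposite d (λ v → nonzero v *ᶻ found v)))
      (∑-cong V (λ v → cong (λ x → (if x then 1ℤ else 0ℤ) *ᶻ found (opposite v)) (isNonzero-opposite v))))
    twice : a +ᶻ a ≡ ∑ V (λ v → m *ᶻ (nonzero v *ᶻ occurrences v))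
    twice = begin
      a +ᶻ a
        ≡⟨ cong₂ _+ᶻ_ ∑-appearances reversed ⟩
      ∑ V (λ v → nonzero v *ᶻ found v) +ᶻ ∑ V (λ v → nonzero v *ᶻ found (opposite v))
        ≡⟨ ∑-+ V (λ v → nonzero v *ᶻ found v) (λ v → nonzero v *ᶻ found (opposite v)) ⟨
      ∑ V (λ v → nonzero v *ᶻ found v +ᶻ nonzero v *ᶻ found (opposite v))
        ≡⟨ ∑-cong V (λ v → trans (sym (ℤₚ.*-distribˡ-+ (nonzero v) (found v) (found (opposite v))))
             (trans (cong (nonzero v *ᶻ_) (found-both v)) (lem₂ (nonzero v) m (occurrences v)))) ⟩
      ∑ V (λ v → m *ᶻ (nonzero v *ᶻ occurrences v)) ∎
    summed : + D *ᶻ ∑ V (λ v → nonzero v *ᶻ occurrences v) +ᶻ totalDefects ≡ ((+ 2) *ᶻ + K d) *ᶻ ((+ 2) *ᶻ G)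
    summed = begin
      + D *ᶻ ∑ V (λ v → nonzero v *ᶻ occurrences v) +ᶻ totalDefects
        ≡⟨ cong (_+ᶻ totalDefects) (sym (∑-*ˡ V (+ D) (λ v → nonzero v *ᶻ occurrences v))) ⟩
      ∑ V (λ v → + D *ᶻ (nonzero v *ᶻ occurrences v)) +ᶻ totalDefects
        ≡⟨ ∑-+ V (λ v → + D *ᶻ (nonzero v *ᶻ occurrences v)) (λ v → nonzero v *ᶻ defects v) ⟨
      ∑ V (λ v → + D *ᶻ (nonzero v *ᶻ occurrences v) +ᶻ nonzero v *ᶻ defects v)
        ≡⟨ ∑-cong V (λ v → trans (lem₄ (+ D) (nonzero v) (occurrences v) (defects v)) (cong (nonzero v *ᶻ_) (line-balance v))) ⟩
      ∑ V (λ v → nonzero v *ᶻ ((+ 2) *ᶻ G))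
        ≡⟨ ∑-*ʳ V ((+ 2) *ᶻ G) nonzero ⟩
      ∑ V nonzero *ᶻ ((+ 2) *ᶻ G)
        ≡⟨ cong (_*ᶻ ((+ 2) *ᶻ G)) (∑-nonzero-K d) ⟩
      ((+ 2) *ᶻ + K d) *ᶻ ((+ 2) *ᶻ G) ∎
      where
      lem₄ : ∀ D n o t → D *ᶻ (n *ᶻ o) +ᶻ n *ᶻ t ≡ n *ᶻ (D *ᶻ o +ᶻ t)
      lem₄ = ℤ-Ring.solve-∀

  defects≥0 : ∀ v → 0ℤ ≤ᶻ defects v
  defects≥0 v = ∑-nonneg P (λ p → 0≤+)

  totalDefects≥0 : 0ℤ ≤ᶻ totalDefects
  totalDefects≥0 = ∑-nonneg (allDirVecs d) (λ v → 0≤-* (nonzero≥0 v) (defects≥0 v))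

  appearances-upper : D * appearances w Γ ≤ 2 * multiplicity * (K d * size ns)
  appearances-upper = ℤₚ.drop‿+≤+ (ℤₚ.*-cancelˡ-≤-pos (+ (D * a)) (+ (2 * multiplicity * (K d * size ns))) (+ 2) (≤-by (m *ᶻ totalDefects)
    (0≤-* {m} 0≤+ totalDefects≥0) (begin
      (+ 2) *ᶻ + (2 * multiplicity * (K d * size ns))
        ≡⟨ cong ((+ 2) *ᶻ_) (trans (ℤₚ.pos-* (2 * multiplicity) (K d * size ns)) (cong₂ _*ᶻ_ (ℤₚ.pos-* 2 multiplicity) (ℤₚ.pos-* (K d) (size ns)))) ⟩
      (+ 2) *ᶻ ((+ 2) *ᶻ m *ᶻ (+ K d *ᶻ G))
        ≡⟨ lem m (+ K d *ᶻ G) ⟩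
      (+ 4) *ᶻ (m *ᶻ (+ K d *ᶻ G))
        ≡⟨ grid-balance ⟨
      (+ 2) *ᶻ (+ D *ᶻ + a) +ᶻ m *ᶻ totalDefects
        ≡⟨ cong (λ x → (+ 2) *ᶻ x +ᶻ m *ᶻ totalDefects) (sym (ℤₚ.pos-* D a)) ⟩
      (+ 2) *ᶻ + (D * a) +ᶻ m *ᶻ totalDefects ∎)))
    where
    open ≡-Reasoning
    a = appearances w Γ
    m = + multiplicity
    lem : ∀ m x → (+ 2) *ᶻ ((+ 2) *ᶻ m *ᶻ x) ≡ (+ 4) *ᶻ (m *ᶻ x)
    lem = ℤ-Ring.solve-∀

-- Discrepancy against variance

∈-allDirVecs : ∀ {d} (v : Vec Dir d) → v ∈ allDirVecs d
∈-allDirVecs []      = here refl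
∈-allDirVecs {suc d} (a ∷ v) = ∈-concatMap⁺ (λ u → map (_∷ u) (neg ∷ zer ∷ pos ∷ [])) {xs = allDirVecs d}
  (Any.map (λ { refl → ∈-map⁺ (_∷ v) (dir∈ a) }) (∈-allDirVecs v))
  where
  dir∈ : ∀ a → a ∈ neg ∷ zer ∷ pos ∷ []
  dir∈ neg = here refl
  dir∈ zer = there (here refl)
  dir∈ pos = there (there (here refl))

∈⇒nth : ∀ {a w} → a ∈ w → ∃[ i ] i < length w × nth w i ≡ a
∈⇒nth (here refl) = 0 , s≤s z≤n , refl
∈⇒nth (there a∈w) with ∈⇒nth a∈w
... | i , i< , eq = suc i , s≤s i< , eq

sq-+ : ∀ x y → (x +ᶻ y) *ᶻ (x +ᶻ y) ≤ᶻ (+ 2) *ᶻ (x *ᶻ x) +ᶻ (+ 2) *ᶻ (y *ᶻ y)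
sq-+ x y = ≤-by ((x -ᶻ y) *ᶻ (x -ᶻ y)) (0≤sq (x -ᶻ y)) (lem x y)
  where
  lem : ∀ x y → (+ 2) *ᶻ (x *ᶻ x) +ᶻ (+ 2) *ᶻ (y *ᶻ y) ≡ (x +ᶻ y) *ᶻ (x +ᶻ y) +ᶻ (x -ᶻ y) *ᶻ (x -ᶻ y)
  lem = ℤ-Ring.solve-∀

1≤sq : ∀ x → x ≢ 0ℤ → 1ℤ ≤ᶻ x *ᶻ x
1≤sq (+ zero)   x≢0 = ⊥-elim (x≢0 refl)
1≤sq (+ suc n)  x≢0 = ℤ.+≤+ (s≤s z≤n)
1≤sq (-[1+ n ]) x≢0 = ℤ.+≤+ (s≤s z≤n)

*-monoˡ : ∀ n {x y} → x ≤ᶻ y → + n *ᶻ x ≤ᶻ + n *ᶻ y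
*-monoˡ n = ℤₚ.*-monoˡ-≤-nonNeg (+ n)

module Discrepancy (a₀ : ℕ) (w′ : List ℕ) {d} (Γ : Grid d) (A : ℕ) (N : ℕ) where

  open GridLines a₀ w′ Γ
  open LetterCount (length w′) (nth w) A
  open SecondMoment ns (φ ∘ label Γ) N hiding (P; q)

  heightAt errAt : Vec Dir d → Vec ℕ d → ℤ
  heightAt v p = height (state (line v p))
  errAt v p = err (line v p) (line v (next v p))

  along : Vec Dir d → Vec ℕ d → ℕ → Vec ℕ d
  along v p s = T (+ s ⊙ ⟦ v ⟧) p

  next-along : ∀ v p s → next v (along v p s) ≡ along v p (suc s)
  next-along v p s = trans (translate-∘ ns (+ 1 ⊙ ⟦ v ⟧) (+ s ⊙ ⟦ v ⟧) p)
    (cong (λ h → T h p) (trans (⊙-+ s 1 ⟦ v ⟧) (cong (λ n → + n ⊙ ⟦ v ⟧) (ℕₚ.+-comm s 1))))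

  -- The state at a position describes the letter ℓ′ steps ahead, and the next state the letter ℓ
  -- steps ahead; hence the walk starts at distance ℓ.
  φ-along : ∀ v p s → φ (line v (along v p ℓ) s) ≡ (heightAt v (along v p (suc s)) -ᶻ heightAt v (along v p s)) +ᶻ errAt v (along v p s)
  φ-along v p s = begin
    φ (line v (along v p ℓ) s)                ≡⟨ cong φ (line-shift v p ℓ s) ⟩
    φ (line v p (ℓ + s))                      ≡⟨ cong (φ ∘ line v p) (ℕₚ.+-comm ℓ s) ⟩
    φ (line v p (s + ℓ))                      ≡⟨ cong φ (line-shift v p s ℓ) ⟨
    φ (line v pₛ ℓ)                           ≡⟨ cong φ (line-suc v pₛ (length w′)) ⟨
    φ (line v (next v pₛ) (length w′))        ≡⟨ lem (φ (line v (next v pₛ) (length w′))) (heightAt v (next v pₛ) -ᶻ heightAt v pₛ) ⟩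
    (heightAt v (next v pₛ) -ᶻ heightAt v pₛ) +ᶻ errAt v pₛ
      ≡⟨ cong (λ x → (heightAt v x -ᶻ heightAt v pₛ) +ᶻ errAt v pₛ) (next-along v p s) ⟩
    (heightAt v (along v p (suc s)) -ᶻ heightAt v pₛ) +ᶻ errAt v pₛ ∎
    where
    open ≡-Reasoning
    pₛ = along v p s
    lem : ∀ x y → x ≡ y +ᶻ (x -ᶻ y)
    lem = ℤ-Ring.solve-∀

  walkSum-split : ∀ v p → walkSum v (along v p ℓ) ≡
    (heightAt v (along v p N) -ᶻ heightAt v (along v p 0)) +ᶻ ∑ (downFrom N) (λ s → errAt v (along v p s))
  walkSum-split v p = trans (∑-cong (downFrom N) (φ-along v p))
    (trans (∑-+ (downFrom N) (λ s → heightAt v (along v p (suc s)) -ᶻ heightAt v (along v p s)) (λ s → errAt v (along v p s)))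
           (cong (_+ᶻ ∑ (downFrom N) (λ s → errAt v (along v p s))) (telescope N (λ s → heightAt v (along v p s)))))

  B₀ : ℕ
  B₀ = (H + H) * (H + H)

  -- The heights telescope to a difference of two, with square at most B₀ = (2H)². The N errors are
  -- squared by Cauchy-Schwarz and charged to the defects.
  moment-bound : ∀ v → moment v ≤ᶻ G *ᶻ ((+ 2) *ᶻ + B₀) +ᶻ (+ 2) *ᶻ ((+ N *ᶻ + N) *ᶻ (+ C *ᶻ defects v))
  moment-bound v = begin
    moment v
      ≡⟨ ∑-translate ns (+ ℓ ⊙ ⟦ v ⟧) (λ p → walkSum v p *ᶻ walkSum v p) ⟨
    ∑ P (λ p → walkSum v (along v p ℓ) *ᶻ walkSum v (along v p ℓ))
      ≡⟨ ∑-cong P (λ p → cong (λ x → x *ᶻ x) (walkSum-split v p)) ⟩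
    ∑ P (λ p → (X p +ᶻ Y p) *ᶻ (X p +ᶻ Y p))
      ≤⟨ ∑-mono P (λ p → ℤₚ.≤-trans (sq-+ (X p) (Y p)) (ℤₚ.+-mono-≤ (*-monoˡ 2 (X² p)) (*-monoˡ 2 (cauchy-schwarz R (λ s → errAt v (along v p s)))))) ⟩
    ∑ P (λ p → (+ 2) *ᶻ + B₀ +ᶻ (+ 2) *ᶻ (+ length R *ᶻ Z p))
      ≡⟨ ∑-+ P (λ _ → (+ 2) *ᶻ + B₀) (λ p → (+ 2) *ᶻ (+ length R *ᶻ Z p)) ⟩
    ∑ P (λ _ → (+ 2) *ᶻ + B₀) +ᶻ ∑ P (λ p → (+ 2) *ᶻ (+ length R *ᶻ Z p))
      ≡⟨ cong₂ _+ᶻ_ (∑-positions-const ns ((+ 2) *ᶻ + B₀))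
           (trans (∑-*ˡ P (+ 2) (λ p → + length R *ᶻ Z p)) (cong ((+ 2) *ᶻ_) (∑-*ˡ P (+ length R) Z))) ⟩
    G *ᶻ ((+ 2) *ᶻ + B₀) +ᶻ (+ 2) *ᶻ (+ length R *ᶻ ∑ P Z)
      ≡⟨ cong (λ z → G *ᶻ ((+ 2) *ᶻ + B₀) +ᶻ (+ 2) *ᶻ (+ length R *ᶻ z)) ∑Z ⟩
    G *ᶻ ((+ 2) *ᶻ + B₀) +ᶻ (+ 2) *ᶻ (+ length R *ᶻ (+ length R *ᶻ S))
      ≡⟨ cong (λ z → G *ᶻ ((+ 2) *ᶻ + B₀) +ᶻ (+ 2) *ᶻ z)
           (trans (sym (ℤₚ.*-assoc (+ length R) (+ length R) S)) (cong (λ n → (+ n *ᶻ + n) *ᶻ S) (Listₚ.length-downFrom N))) ⟩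
    G *ᶻ ((+ 2) *ᶻ + B₀) +ᶻ (+ 2) *ᶻ ((+ N *ᶻ + N) *ᶻ S)
      ≤⟨ ℤₚ.+-monoʳ-≤ (G *ᶻ ((+ 2) *ᶻ + B₀)) (*-monoˡ 2 (NN-mono S≤)) ⟩
    G *ᶻ ((+ 2) *ᶻ + B₀) +ᶻ (+ 2) *ᶻ ((+ N *ᶻ + N) *ᶻ (+ C *ᶻ defects v)) ∎
    where
    open ℤₚ.≤-Reasoning
    R = downFrom N
    X Y Z : Vec ℕ d → ℤ
    X p = heightAt v (along v p N) -ᶻ heightAt v (along v p 0)
    Y p = ∑ R (λ s → errAt v (along v p s))
    Z p = ∑ R (λ s → errAt v (along v p s) *ᶻ errAt v (along v p s))
    S = ∑ P (λ p → errAt v p *ᶻ errAt v p)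
    X² : ∀ p → X p *ᶻ X p ≤ᶻ + B₀
    X² p = square-≤ {X p} (ℕₚ.≤-trans (ℤₚ.∣i-j∣≤∣i∣+∣j∣ (heightAt v (along v p N)) (heightAt v (along v p 0)))
      (ℕₚ.+-mono-≤ (∣height∣≤ (line v (along v p N))) (∣height∣≤ (line v (along v p 0)))))
    ∑Z : ∑ P Z ≡ + length R *ᶻ S
    ∑Z = trans (∑-swap P R (λ p s → errAt v (along v p s) *ᶻ errAt v (along v p s)))
      (trans (∑-cong R (λ s → ∑-translate ns (+ s ⊙ ⟦ v ⟧) (λ p → errAt v p *ᶻ errAt v p))) (∑-const R S))
    S≤ : S ≤ᶻ + C *ᶻ defects v
    S≤ = ℤₚ.≤-trans (∑-mono P (λ p → err-bound {line v p} {line v (next v p)} (line-suc v p)))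
                    (ℤₚ.≤-reflexive (∑-*ˡ P (+ C) (λ p → + defectAt v p)))
    NN-mono : ∀ {x y} → x ≤ᶻ y → (+ N *ᶻ + N) *ᶻ x ≤ᶻ (+ N *ᶻ + N) *ᶻ y
    NN-mono {x} {y} le = subst₂ _≤ᶻ_ (cong (_*ᶻ x) (ℤₚ.pos-* N N)) (cong (_*ᶻ y) (ℤₚ.pos-* N N)) (*-monoˡ (N * N) le)

  defects≤total : ∀ v → isNonzero v ≡ true → defects v ≤ᶻ totalDefects
  defects≤total v nz = ℤₚ.≤-trans (ℤₚ.≤-reflexive (sym (trans (cong (λ x → (if x then 1ℤ else 0ℤ) *ᶻ defects v) nz) (ℤₚ.*-identityˡ (defects v)))))
    (∑-term (λ u → nonzero u *ᶻ defects u) (λ u → 0≤-* (nonzero≥0 u) (defects≥0 u)) (∈-allDirVecs v))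

  frequency : ℕ → ℤ
  frequency x = ∑ P (λ p → + indicator (label Γ p ≟ x))

  -- An occurrence of w or of its reversal shows x at distance i or ℓ′ - i from its start.
  occurrences≤ : ∀ v {i} x → i < ℓ → nth w i ≡ x → occurrences v ≤ᶻ frequency x +ᶻ frequency x
  occurrences≤ v {i} x i<ℓ wᵢ≡x = begin
    ∑ P (λ p → + starts (line v p) 0)
      ≤⟨ ∑-mono P (λ p → pointwise p) ⟩
    ∑ P (λ p → + ind (line v p i) +ᶻ + ind (line v p (length w′ ∸ i)))
      ≡⟨ ∑-+ P (λ p → + ind (line v p i)) (λ p → + ind (line v p (length w′ ∸ i))) ⟩
    ∑ P (λ p → + ind (line v p i)) +ᶻ ∑ P (λ p → + ind (line v p (length w′ ∸ i)))
      ≡⟨ cong₂ _+ᶻ_ (∑-translate ns (+ i ⊙ ⟦ v ⟧) (λ p → + ind (label Γ p))) (∑-translate ns (+ (length w′ ∸ i) ⊙ ⟦ v ⟧) (λ p → + ind (label Γ p))) ⟩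
    frequency x +ᶻ frequency x ∎
    where
    open ℤₚ.≤-Reasoning
    ind : ℕ → ℕ
    ind y = indicator (y ≟ x)
    ind≡1 : ∀ {y} → y ≡ x → ind y ≡ 1
    ind≡1 {y} y≡x = cong (λ c → if c then 1 else 0) (dec-true (y ≟ x) y≡x)
    pointwise : ∀ p → + starts (line v p) 0 ≤ᶻ + ind (line v p i) +ᶻ + ind (line v p (length w′ ∸ i))
    pointwise p with kindAt (line v p) 0 in eq
    ... | just fwd = subst (λ n → + 1 ≤ᶻ + n +ᶻ + ind (line v p (length w′ ∸ i)))
                           (sym (ind≡1 (trans (kindAt-reads (line v p) 0 eq i<ℓ) wᵢ≡x))) (ℤ.+≤+ (s≤s z≤n))
    ... | just bwd = subst (λ n → + 1 ≤ᶻ + ind (line v p i) +ᶻ + n)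
                           (sym (ind≡1 (trans (reads-bwd (line v p) 0 (kindAt-reads (line v p) 0 eq) i<ℓ (ℕₚ.m∸n+n≡m (ℕₚ.≤-pred i<ℓ))) wᵢ≡x)))
                           (ℤ.+≤+ (ℕₚ.m≤n+m 1 (ind (line v p i))))
    ... | nothing = ℤ.+≤+ z≤n

  variance-frequency : ∀ x → φ x ≢ 0ℤ → frequency x ≤ᶻ variance
  variance-frequency x φ≢0 = ∑-mono P (λ p → pointwise (label Γ p) (label Γ p ≟ x))
    where
    pointwise : ∀ y (y? : Dec (y ≡ x)) → + indicator y? ≤ᶻ φ y *ᶻ φ y
    pointwise y (yes refl) = 1≤sq (φ y) φ≢0
    pointwise y (no _)     = 0≤sq (φ y)

  occurrences≤variance : ∀ v {x} → x ∈ w → φ x ≢ 0ℤ → occurrences v ≤ᶻ (+ 2) *ᶻ variance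
  occurrences≤variance v {x} x∈w φ≢0 with ∈⇒nth x∈w
  ... | i , i<ℓ , wᵢ≡x = ℤₚ.≤-trans (occurrences≤ v x i<ℓ wᵢ≡x)
    (ℤₚ.≤-trans (ℤₚ.+-mono-≤ (variance-frequency x φ≢0) (variance-frequency x φ≢0)) (ℤₚ.≤-reflexive (lem variance)))
    where
    lem : ∀ x → x +ᶻ x ≡ (+ 2) *ᶻ x
    lem = ℤ-Ring.solve-∀

  φ-A : κ ≡ 0 → φ A ≢ 0ℤ
  φ-A κ≡0 φ≡0 = ℕₚ.<⇒≢ D-pos (sym (ℤₚ.+-injective (trans (sym φA) φ≡0)))
    where
    φA : φ A ≡ + D
    φA = trans (cong₂ (λ c k → + D *ᶻ + (if c then 1 else 0) -ᶻ + k) (dec-true (A ≟ A) refl) κ≡0)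
               (trans (ℤₚ.+-identityʳ (+ D *ᶻ 1ℤ)) (ℤₚ.*-identityʳ (+ D)))

  φ-other : ∀ {y} → A ≢ y → κ ≢ 0 → φ y ≢ 0ℤ
  φ-other {y} A≢y κ≢0 φ≡0 = κ≢0 (ℤₚ.+-injective (trans (sym (ℤₚ.neg-involutive (+ κ))) (cong -ᶻ_ (trans (sym φy) φ≡0))))
    where
    φy : φ y ≡ -ᶻ (+ κ)
    φy = trans (cong (λ c → + D *ᶻ + (if c then 1 else 0) -ᶻ + κ) (dec-false (y ≟ A) (A≢y ∘ sym)))
               (trans (cong (_-ᶻ + κ) (ℤₚ.*-zeroʳ (+ D))) (ℤₚ.+-identityˡ (-ᶻ (+ κ))))

  -- φ is D at A if κ = 0, and -κ at every other letter if κ ≠ 0. So one of two distinct letters of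
  -- w has φ ≠ 0, and each occurrence of w contains that letter.
  variance-lower : ∀ {B} → A ≢ B → A ∈ w → B ∈ w → ∀ v → occurrences v ≤ᶻ (+ 2) *ᶻ variance
  variance-lower {B} A≢B A∈w B∈w v with κ ≟ 0
  ... | yes κ≡0 = occurrences≤variance v A∈w (φ-A κ≡0)
  ... | no κ≢0  = occurrences≤variance v B∈w (φ-other A≢B κ≢0)

  -- With V the variance and 2^d = 2N, `second-moment` reads 4N³V ≤ 2N³V + 4N² Bd, that is N V ≤ 2
  -- Bd. Inserting G ≤ 2DV and Bd = (2B₀ + 2) G gives N ≤ 8D (1 + B₀).
  N-bound : ∀ {B} → A ≢ B → A ∈ w → B ∈ w → 1 ≤ N → 2 ^ d ≡ N + N → (v₀ : Vec Dir d) → isNonzero v₀ ≡ true →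
            + suc (N * N * C) *ᶻ totalDefects ≤ᶻ G → N ≤ 8 * D * suc B₀
  N-bound A≢B A∈w B∈w 1≤N@(s≤s {n = N′} z≤n) 2^d≡ v₀ nz₀ few = ℤₚ.drop‿+≤+ (ℤₚ.*-cancelʳ-≤-pos (+ N) (+ (8 * D * suc B₀)) G {{G-pos}} (begin
    + N *ᶻ G
      ≤⟨ *-monoˡ N G≤ ⟩
    + N *ᶻ (+ D *ᶻ ((+ 2) *ᶻ variance))
      ≡⟨ lem₁ (+ N) (+ D) variance ⟩
    (+ 2) *ᶻ (+ D *ᶻ (+ N *ᶻ variance))
      ≤⟨ *-monoˡ 2 (*-monoˡ D NV≤) ⟩
    (+ 2) *ᶻ (+ D *ᶻ ((+ 2) *ᶻ Bd))
      ≡⟨ lem₂ (+ D) G (+ B₀) ⟩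
    ((+ 8) *ᶻ + D *ᶻ (1ℤ +ᶻ + B₀)) *ᶻ G
      ≡⟨ cong (_*ᶻ G) (sym (trans (ℤₚ.pos-* (8 * D) (suc B₀)) (cong (_*ᶻ + suc B₀) (ℤₚ.pos-* 8 D)))) ⟩
    + (8 * D * suc B₀) *ᶻ G ∎))
    where
    open ℤₚ.≤-Reasoning
    G-pos : ℤ.Positive G
    G-pos = ℤ.positive (ℤ.+<+ (size-pos (shapePos Γ)))
    -- The multiplier N²C + 1 is split: N²C controls the errors in the moments, and the remaining 1
    -- gives `total≤G`.
    NNC-total : + (N * N * C) *ᶻ totalDefects ≤ᶻ G
    NNC-total = ℤₚ.≤-trans (≤-by totalDefects totalDefects≥0 (trans (sym (suc-*-pos (N * N * C) totalDefects)) (ℤₚ.+-comm totalDefects _))) few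
    total≤G : totalDefects ≤ᶻ G
    total≤G = ℤₚ.≤-trans (≤-by (+ (N * N * C) *ᶻ totalDefects) (0≤-* {+ (N * N * C)} 0≤+ totalDefects≥0) (sym (suc-*-pos (N * N * C) totalDefects))) few
    -- Of the 2G in `line-balance` at most G are defects, so the occurrences along v₀ account for at
    -- least G.
    G≤ : G ≤ᶻ + D *ᶻ ((+ 2) *ᶻ variance)
    G≤ = ℤₚ.≤-trans (≤-by (G -ᶻ defects v₀) (∸-nonneg (ℤₚ.≤-trans (defects≤total v₀ nz₀) total≤G))
           (trans (lem₃ (+ D *ᶻ occurrences v₀) (defects v₀)) (trans (cong (_-ᶻ defects v₀) (line-balance v₀)) (lem₄ G (defects v₀)))))
         (*-monoˡ D (variance-lower A≢B A∈w B∈w v₀))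
      where
      lem₃ : ∀ x y → x ≡ x +ᶻ y -ᶻ y
      lem₃ = ℤ-Ring.solve-∀
      lem₄ : ∀ g y → (+ 2) *ᶻ g -ᶻ y ≡ g +ᶻ (g -ᶻ y)
      lem₄ = ℤ-Ring.solve-∀
    Bd = G *ᶻ ((+ 2) *ᶻ + B₀) +ᶻ (+ 2) *ᶻ G
    Bd≥0 : 0ℤ ≤ᶻ Bd
    Bd≥0 = 0≤-+ (0≤-* {G} 0≤+ (0≤-* {+ 2} {+ B₀} 0≤+ 0≤+)) (0≤-* {+ 2} {G} 0≤+ 0≤+)
    bounded : ∀ v → isNonzero v ≡ true → moment v ≤ᶻ Bd
    bounded v nz = ℤₚ.≤-trans (moment-bound v) (ℤₚ.+-monoʳ-≤ (G *ᶻ ((+ 2) *ᶻ + B₀)) (*-monoˡ 2 (begin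
      (+ N *ᶻ + N) *ᶻ (+ C *ᶻ defects v)     ≡⟨ trans (sym (ℤₚ.*-assoc (+ N *ᶻ + N) (+ C) (defects v))) (cong (_*ᶻ defects v) NNC) ⟩
      + (N * N * C) *ᶻ defects v             ≤⟨ *-monoˡ (N * N * C) (defects≤total v nz) ⟩
      + (N * N * C) *ᶻ totalDefects          ≤⟨ NNC-total ⟩
      G                                      ∎)))
      where
      NNC : + N *ᶻ + N *ᶻ + C ≡ + (N * N * C)
      NNC = sym (trans (ℤₚ.pos-* (N * N) C) (cong (_*ᶻ + C) (ℤₚ.pos-* N N)))
    cardinality : + length (cube d) ≡ + N +ᶻ + N
    cardinality = trans (cong +_ (trans (length-cube d) 2^d≡)) (ℤₚ.pos-+ N N)
    second : + N *ᶻ (((+ N +ᶻ + N) *ᶻ (+ N +ᶻ + N)) *ᶻ variance) ≤ᶻ (+ N +ᶻ + N) *ᶻ ((+ N *ᶻ + N) *ᶻ variance +ᶻ (+ N +ᶻ + N) *ᶻ Bd)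
    second = subst (λ c → + N *ᶻ ((c *ᶻ c) *ᶻ variance) ≤ᶻ c *ᶻ ((+ N *ᶻ + N) *ᶻ variance +ᶻ c *ᶻ Bd)) cardinality (second-moment Bd≥0 bounded)
    NV≤ : + N *ᶻ variance ≤ᶻ (+ 2) *ᶻ Bd
    NV≤ = ℤₚ.*-cancelˡ-≤-pos (+ N *ᶻ variance) ((+ 2) *ᶻ Bd) ((+ 2) *ᶻ (+ N *ᶻ + N))
      (≤-by _ (∸-nonneg second) (lem₅ (+ N) variance Bd))
      where
      lem₅ : ∀ n v b → ((+ 2) *ᶻ (n *ᶻ n)) *ᶻ ((+ 2) *ᶻ b) ≡ ((+ 2) *ᶻ (n *ᶻ n)) *ᶻ (n *ᶻ v) +ᶻ
             ((n +ᶻ n) *ᶻ ((n *ᶻ n) *ᶻ v +ᶻ (n +ᶻ n) *ᶻ b) -ᶻ n *ᶻ (((n +ᶻ n) *ᶻ (n +ᶻ n)) *ᶻ v))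
      lem₅ = ℤ-Ring.solve-∀
    lem₁ : ∀ n d v → n *ᶻ (d *ᶻ ((+ 2) *ᶻ v)) ≡ (+ 2) *ᶻ (d *ᶻ (n *ᶻ v))
    lem₁ = ℤ-Ring.solve-∀
    lem₂ : ∀ d g b → (+ 2) *ᶻ (d *ᶻ ((+ 2) *ᶻ (g *ᶻ ((+ 2) *ᶻ b) +ᶻ (+ 2) *ᶻ g))) ≡ ((+ 8) *ᶻ d *ᶻ (1ℤ +ᶻ b)) *ᶻ g
    lem₂ = ℤ-Ring.solve-∀

-- Optimal one-dimensional grids

∑-two-terms : ∀ (f : ℕ → ℤ) → (∀ i → 0ℤ ≤ᶻ f i) → ∀ {i j} n → i < j → j < n → f i +ᶻ f j ≤ᶻ ∑ (downFrom n) f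
∑-two-terms f f≥0 {i} {j} (suc n) i<j (s≤s j≤n) with ℕₚ.m≤n⇒m<n∨m≡n j≤n
... | inj₁ j<n  = ℤₚ.≤-trans (∑-two-terms f f≥0 n i<j j<n) (≤-by (f n) (f≥0 n) (ℤₚ.+-comm (f n) (∑ (downFrom n) f)))
... | inj₂ refl = ℤₚ.≤-trans (ℤₚ.≤-reflexive (ℤₚ.+-comm (f i) (f j))) (ℤₚ.+-monoʳ-≤ (f j) (∑-term f f≥0 (∈-downFrom⁺ i<j)))

module OptimalCycle (a₀ : ℕ) (w′ : List ℕ) where

  open Lines (length w′) (nth (a₀ ∷ w′))

  W : ℕ → ℕ
  W = nth (a₀ ∷ w′)

  Period : ℕ → Set
  Period n = ∀ i → i + n < ℓ → W i ≡ W (i + n)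

  period-multiple : ∀ {n} → Period n → ∀ k i → i + k * n < ℓ → W i ≡ W (i + k * n)
  period-multiple per zero    i lt = cong W (sym (ℕₚ.+-identityʳ i))
  period-multiple {n} per (suc k) i lt = trans (period-multiple per k i (ℕₚ.≤-<-trans (ℕₚ.+-monoʳ-≤ i (ℕₚ.m≤n+m (k * n) n)) lt))
    (trans (per (i + k * n) (ℕₚ.≤-<-trans (ℕₚ.≤-reflexive (lem i k n)) lt)) (cong W (lem i k n)))
    where
    lem : ∀ i k n → i + k * n + n ≡ i + (n + k * n)
    lem = ℕ-Ring.solve-∀

  period-mod : ∀ {n} .{{_ : NonZero n}} → Period n → ∀ {i} → i < ℓ → W (i % n) ≡ W i
  period-mod {n} per {i} i<ℓ = trans (period-multiple per (i / n) (i % n) (ℕₚ.≤-<-trans (ℕₚ.≤-reflexive (sym eq)) i<ℓ)) (cong W (sym eq))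
    where
    eq : i ≡ i % n + (i / n) * n
    eq = ℕ-DivMod.m≡m%n+[m/n]*n i n

  cycle : (n : ℕ) → (ℕ → ℕ) → Grid 1
  cycle n lab = record { shape = suc n ∷ [] ; shapePos = s≤s z≤n ∷ [] ; label = λ { (x ∷ []) → lab x } }

  cycle-size : ∀ n lab → size (shape (cycle n lab)) ≡ suc n
  cycle-size n lab = ℕₚ.*-identityʳ (suc n)

  module _ (n : ℕ) (lab : ℕ → ℕ) where

    open GridLines a₀ w′ (cycle n lab) using (line; occurrences; found; ∑-appearances; found-both; G)

    right : Vec Dir 1
    right = pos ∷ []

    cycle-line : ∀ x i → line right (x ∷ []) i ≡ lab ((x + i) % suc n)
    cycle-line x i = cong (λ y → lab (y modᶻ suc n)) (trans (cong (+ x +ᶻ_) (ℤₚ.*-identityʳ (+ i))) (sym (ℤₚ.pos-+ x i)))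

    cycle-appearances : + appearances (a₀ ∷ w′) (cycle n lab) ≡ + multiplicity *ᶻ occurrences right
    cycle-appearances = trans ∑-appearances (trans (lem (found right) (found (neg ∷ [])) (found (zer ∷ []))) (found-both right))
      where
      lem : ∀ x y z → 1ℤ *ᶻ y +ᶻ (0ℤ *ᶻ z +ᶻ (1ℤ *ᶻ x +ᶻ 0ℤ)) ≡ x +ᶻ y
      lem = ℤ-Ring.solve-∀

    starts≡1 : ∀ k {x} → (∀ {i} → i < ℓ → lab ((x + i) % suc n) ≡ letter k i) → starts (line right (x ∷ [])) 0 ≡ 1
    starts≡1 k {x} reads with reads? fwd (line right (x ∷ [])) 0 | reads? bwd (line right (x ∷ [])) 0
    ... | yes _ | _     = refl
    ... | no _  | yes _ = refl
    ... | no ¬F | no ¬B = ⊥-elim (impossible k reads)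
      where
      impossible : ∀ k → (∀ {i} → i < ℓ → lab ((x + i) % suc n) ≡ letter k i) → ⊥
      impossible fwd R = ¬F (λ {i} i<ℓ → trans (cycle-line x i) (R i<ℓ))
      impossible bwd R = ¬B (λ {i} i<ℓ → trans (cycle-line x i) (R i<ℓ))

    occurrences-downFrom : occurrences right ≡ ∑ (downFrom (suc n)) (λ x → + starts (line right (x ∷ [])) 0)
    occurrences-downFrom = trans (∑-positions (suc n) [] (λ p → + starts (line right p) 0))
      (trans (∑-cong (upTo (suc n)) (λ x → ℤₚ.+-identityʳ (+ starts (line right (x ∷ [])) 0)))
             (∑-upTo (suc n) (λ x → + starts (line right (x ∷ [])) 0)))

    one-occurrence : ∀ k {x} → x < suc n → (∀ {i} → i < ℓ → lab ((x + i) % suc n) ≡ letter k i) → 1ℤ ≤ᶻ occurrences right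
    one-occurrence k {x} x< R = subst₂ _≤ᶻ_ (cong +_ (starts≡1 k {x} R)) (sym occurrences-downFrom)
      (∑-term (λ x → + starts (line right (x ∷ [])) 0) (λ _ → 0≤+) (∈-downFrom⁺ x<))

    two-occurrences : ∀ k k′ {x y} → x < y → y < suc n → (∀ {i} → i < ℓ → lab ((x + i) % suc n) ≡ letter k i) →
                      (∀ {i} → i < ℓ → lab ((y + i) % suc n) ≡ letter k′ i) → + 2 ≤ᶻ occurrences right
    two-occurrences k k′ {x} {y} x<y y< R R′ = subst₂ _≤ᶻ_ (cong₂ (λ s t → + s +ᶻ + t) (starts≡1 k {x} R) (starts≡1 k′ {y} R′)) (sym occurrences-downFrom)
      (∑-two-terms (λ x → + starts (line right (x ∷ [])) 0) (λ _ → 0≤+) (suc n) x<y y<)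

  -- The concentration is at least 2 `multiplicity` / D, the upper bound of `appearances-upper` for
  -- dimension 1.
  Optimal : Grid 1 → Set
  Optimal Δ = 2 * multiplicity * size (shape Δ) ≤ D * appearances (a₀ ∷ w′) Δ

  optimal-from : ∀ n lab c → + c ≤ᶻ GridLines.occurrences a₀ w′ (cycle n lab) (right n lab) →
                 2 * suc n ≤ D * c → Optimal (cycle n lab)
  optimal-from n lab c c≤ 2n≤ = ℤₚ.drop‿+≤+ (begin
    + (2 * multiplicity * size (shape (cycle n lab)))   ≡⟨ cong (λ s → + (2 * multiplicity * s)) (cycle-size n lab) ⟩
    + (2 * multiplicity * suc n)                        ≡⟨ cong +_ (lem 2 multiplicity (suc n)) ⟩
    + (multiplicity * (2 * suc n))                      ≤⟨ ℤ.+≤+ (ℕₚ.*-monoʳ-≤ multiplicity 2n≤) ⟩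
    + (multiplicity * (D * c))                          ≡⟨ cong +_ (lem₂ multiplicity D c) ⟩
    + (D * (multiplicity * c))                          ≡⟨ trans (ℤₚ.pos-* D (multiplicity * c)) (cong (+ D *ᶻ_) (ℤₚ.pos-* multiplicity c)) ⟩
    + D *ᶻ (+ multiplicity *ᶻ + c)                      ≤⟨ ℤₚ.*-monoˡ-≤-nonNeg (+ D) (ℤₚ.*-monoˡ-≤-nonNeg (+ multiplicity) c≤) ⟩
    + D *ᶻ (+ multiplicity *ᶻ o)                        ≡⟨ cong (+ D *ᶻ_) (cycle-appearances n lab) ⟨
    + D *ᶻ + appearances (a₀ ∷ w′) (cycle n lab)        ≡⟨ ℤₚ.pos-* D (appearances (a₀ ∷ w′) (cycle n lab)) ⟨
    + (D * appearances (a₀ ∷ w′) (cycle n lab))         ∎)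
    where
    open ℤₚ.≤-Reasoning
    o = GridLines.occurrences a₀ w′ (cycle n lab) (right n lab)
    lem : ∀ a m n → a * m * n ≡ m * (a * n)
    lem = ℕ-Ring.solve-∀
    lem₂ : ∀ a m n → a * (m * n) ≡ m * (a * n)
    lem₂ = ℕ-Ring.solve-∀

  open LetterCount (length w′) W a₀ using (b̂; q̂; r̂; b̂+b; q̂+q; r̂+r; D-border; D-palindromes)

  pos-∸ : ∀ {m n} → m < n → 1 ≤ n ∸ m
  pos-∸ = ℕₚ.m<n⇒0<n∸m

  -- The border makes b̂ a period of w, so w can be wound around a cycle of length b̂ = D / 2, even
  -- if b̂ is much shorter than w.
  border-cycle : M ≡ b + b → ∀ n → suc n ≡ b̂ → Optimal (cycle n W)
  border-cycle M≡ n n≡ = optimal-from n W 1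
    (one-occurrence n W fwd {0} (s≤s z≤n) (period-mod {suc n} period))
    (ℕₚ.≤-reflexive (trans (cong (2 *_) n≡) (trans (lem b̂) (sym (trans (ℕₚ.*-identityʳ D) (D-border M≡))))))
    where
    lem : ∀ x → 2 * x ≡ x + x
    lem = ℕ-Ring.solve-∀
    arr : ∀ i x b → i + (x + b) ≡ i + x + b
    arr = ℕ-Ring.solve-∀
    period : Period (suc n)
    period i lt = b-border (ℕₚ.≤-<-trans (ℕₚ.m≤m+n i (suc n)) lt) lt
      (trans (cong (λ z → i + z) (sym (trans (cong (_+ b) n≡) b̂+b))) (arr i (suc n) b))

  -- On a cycle of length q̂ + r̂, w starts at 0 and its reversal at q̂. Beyond w the label is
  -- letter x - q̂ of the reversal, W (ℓ′ - (x - q̂)).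
  palindrome-label : ℕ → ℕ
  palindrome-label x = if does (x <? ℓ) then W x else W (q̂ + length w′ ∸ x)

  palindrome-cycle : M ≡ q + r → ∀ n → suc n ≡ q̂ + r̂ → Optimal (cycle n palindrome-label)
  palindrome-cycle M≡ n n≡ = optimal-from n palindrome-label 2
    (two-occurrences n palindrome-label fwd bwd {0} {q̂} (pos-∸ q<ℓ) q̂<n forward backward)
    (ℕₚ.≤-reflexive (trans (cong (2 *_) (trans n≡ (sym (D-palindromes M≡)))) (ℕₚ.*-comm 2 D)))
    where
    q̂<n : q̂ < suc n
    q̂<n = ℕₚ.<-≤-trans (ℕₚ.m<m+n q̂ (pos-∸ r<ℓ)) (ℕₚ.≤-reflexive (sym n≡))
    label< : ∀ {x} → x < ℓ → palindrome-label x ≡ W x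
    label< {x} x<ℓ = cong (λ c → if c then W x else W (q̂ + length w′ ∸ x)) (dec-true (x <? ℓ) x<ℓ)
    label≥ : ∀ {x} → ¬ x < ℓ → palindrome-label x ≡ W (q̂ + length w′ ∸ x)
    label≥ {x} x≮ℓ = cong (λ c → if c then W x else W (q̂ + length w′ ∸ x)) (dec-false (x <? ℓ) x≮ℓ)
    -- Composing the reflections of the palindromic prefix and suffix
    -- translates by suc n.
    period : Period (suc n)
    period i lt = trans (r-pal i<ℓ j<ℓ ij) (q-pal j<ℓ lt ji)
      where
      i<ℓ = ℕₚ.≤-<-trans (ℕₚ.m≤m+n i (suc n)) lt
      arr₁ : ∀ i x y → i + (x + y) ≡ y + (i + x)
      arr₁ = ℕ-Ring.solve-∀
      i<r : i < r
      i<r = ℕₚ.≤-<-trans (ℕₚ.m≤m+n i q̂) (ℕₚ.+-cancelˡ-< r̂ (i + q̂) r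
        (ℕₚ.≤-<-trans (ℕₚ.≤-reflexive (trans (sym (arr₁ i q̂ r̂)) (cong (λ z → i + z) (sym n≡)))) (ℕₚ.<-≤-trans lt (ℕₚ.≤-reflexive (sym r̂+r)))))
      j = r ∸ suc i
      ij : suc (i + j) ≡ r
      ij = ℕₚ.m+[n∸m]≡n i<r
      j<ℓ : j < ℓ
      j<ℓ = ℕₚ.≤-<-trans (ℕₚ.m∸n≤m r (suc i)) r<ℓ
      arr₂ : ∀ i j x y q → suc (j + (i + (x + y)) + q) ≡ (x + q) + (y + suc (i + j))
      arr₂ = ℕ-Ring.solve-∀
      ji : suc (j + (i + suc n) + q) ≡ ℓ + ℓ
      ji = trans (cong (λ m → suc (j + (i + m) + q)) n≡) (trans (arr₂ i j q̂ r̂ q) (cong₂ _+_ q̂+q (trans (cong (λ z → r̂ + z) ij) r̂+r)))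
    forward : ∀ {i} → i < ℓ → palindrome-label (i % suc n) ≡ W i
    forward {i} i<ℓ = trans (label< (ℕₚ.≤-<-trans (ℕ-DivMod.m%n≤m i (suc n)) i<ℓ)) (period-mod {suc n} period i<ℓ)
    backward : ∀ {i} → i < ℓ → palindrome-label ((q̂ + i) % suc n) ≡ W (length w′ ∸ i)
    -- Three zones of the reversal: its overlap with w, settled by the palindromic suffix; the
    -- positions labelled by the reversal itself; and the part wrapped onto the beginning of w,
    -- settled by the palindromic prefix.
    backward {i} i<ℓ with q̂ + i <? ℓ | q̂ + i <? suc n
    ... | yes j<ℓ | _ = trans (forward j<ℓ) (q-pal j<ℓ (s≤s (ℕₚ.m∸n≤m (length w′) i)) eq)
      where
      arr : ∀ x i j q → suc (x + i + j + q) ≡ (x + q) + suc (j + i)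
      arr = ℕ-Ring.solve-∀
      eq : suc (q̂ + i + (length w′ ∸ i) + q) ≡ ℓ + ℓ
      eq = trans (arr q̂ i (length w′ ∸ i) q) (cong₂ (λ x y → x + suc y) q̂+q (ℕₚ.m∸n+n≡m (ℕₚ.≤-pred i<ℓ)))
    ... | no j≮ℓ | yes j<n = trans (cong palindrome-label (ℕ-DivMod.m<n⇒m%n≡m j<n))
                            (trans (label≥ j≮ℓ) (cong W (ℕₚ.[m+n]∸[m+o]≡n∸o q̂ (length w′) i)))
    ... | no j≮ℓ | no j≮n = trans (cong palindrome-label wrap) (trans (forward m<ℓ) (r-pal m<ℓ (s≤s (ℕₚ.m∸n≤m (length w′) i)) eq))
      where
      r̂≤i : r̂ ≤ i
      r̂≤i = ℕₚ.+-cancelˡ-≤ q̂ r̂ i (ℕₚ.≤-trans (ℕₚ.≤-reflexive (sym n≡)) (ℕₚ.≮⇒≥ j≮n))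
      m = i ∸ r̂
      r̂+m : r̂ + m ≡ i
      r̂+m = ℕₚ.m+[n∸m]≡n r̂≤i
      m<ℓ : m < ℓ
      m<ℓ = ℕₚ.≤-<-trans (ℕₚ.m∸n≤m i r̂) i<ℓ
      arr₁ : ∀ x y m → x + (y + m) ≡ m + (x + y)
      arr₁ = ℕ-Ring.solve-∀
      wrap : (q̂ + i) % suc n ≡ m % suc n
      wrap = trans (cong (_% suc n) (trans (cong (λ z → q̂ + z) (sym r̂+m)) (trans (arr₁ q̂ r̂ m) (cong (λ z → m + z) (sym n≡))))) (ℕ-DivMod.[m+n]%n≡m%n m (suc n))
      arr₂ : ∀ x m j → x + suc (m + j) ≡ suc (j + (x + m))
      arr₂ = ℕ-Ring.solve-∀
      eq : suc (m + (length w′ ∸ i)) ≡ r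
      eq = ℕₚ.+-cancelˡ-≡ r̂ _ r (trans (arr₂ r̂ m (length w′ ∸ i)) (trans (cong (λ x → suc (length w′ ∸ i + x)) r̂+m)
             (trans (cong suc (ℕₚ.m∸n+n≡m (ℕₚ.≤-pred i<ℓ))) (sym r̂+r))))

  optimal : ∃[ Δ ] Optimal Δ
  optimal with M-cases
  ... | inj₁ M≡ = cycle (ℕ.pred b̂) W , border-cycle M≡ (ℕ.pred b̂) (ℕₚ.suc-pred b̂ {{ℕ.>-nonZero (pos-∸ b<ℓ)}})
  ... | inj₂ M≡ = cycle (ℕ.pred (q̂ + r̂)) palindrome-label ,
    palindrome-cycle M≡ (ℕ.pred (q̂ + r̂)) (ℕₚ.suc-pred (q̂ + r̂) {{ℕ.>-nonZero (ℕₚ.≤-trans (pos-∸ q<ℓ) (ℕₚ.m≤m+n q̂ r̂))}})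

-- Concentrations as rationals, and part (a)

suc-size : ∀ {d} (Γ : Grid d) → suc (size (shape Γ) ∸ 1) ≡ size (shape Γ)
suc-size Γ = ℕₚ.m+[n∸m]≡n (size-pos (shapePos Γ))

scaled-≤⁺ : ∀ k a n b m → b * suc n ≤ k * a * suc m → mkℚᵘ (+ b) m ℚ.≤ mkℚᵘ (+ k) 0 ℚ.* mkℚᵘ (+ a) n
scaled-≤⁺ k a n b m le = ℚ.*≤* (subst₂ _≤ᶻ_
  (trans (ℤₚ.pos-* b (suc n)) (cong (λ x → + b *ᶻ + x) (sym (ℕₚ.*-identityˡ (suc n)))))
  (trans (ℤₚ.pos-* (k * a) (suc m)) (cong (_*ᶻ + suc m) (ℤₚ.pos-* k a)))
  (ℤ.+≤+ le))

≤-scaled⁺ : ∀ k a n b m → k * a * suc m ≤ b * suc n → mkℚᵘ (+ k) 0 ℚ.* mkℚᵘ (+ a) n ℚ.≤ mkℚᵘ (+ b) m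
≤-scaled⁺ k a n b m le = ℚ.*≤* (subst₂ _≤ᶻ_
  (trans (ℤₚ.pos-* (k * a) (suc m)) (cong (_*ᶻ + suc m) (ℤₚ.pos-* k a)))
  (trans (ℤₚ.pos-* b (suc n)) (cong (λ x → + b *ᶻ + x) (sym (ℕₚ.*-identityˡ (suc n)))))
  (ℤ.+≤+ le))

≤-scaled⁻ : ∀ k a n b m e → mkℚᵘ (+ k) 0 ℚ.* mkℚᵘ (+ a) n ℚ.≤ mkℚᵘ (+ b) m ℚ.+ mkℚᵘ (+ 1) e →
            k * a * (suc m * suc e) ≤ (b * suc e + suc m) * suc n
≤-scaled⁻ k a n b m e (ℚ.*≤* le) = ℤₚ.drop‿+≤+ (subst₂ _≤ᶻ_
  (sym (trans (ℤₚ.pos-* (k * a) (suc m * suc e)) (cong (_*ᶻ + (suc m * suc e)) (ℤₚ.pos-* k a))))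
  (sym (trans (ℤₚ.pos-* (b * suc e + suc m) (suc n)) (cong₂ _*ᶻ_
    (trans (ℤₚ.pos-+ (b * suc e) (suc m)) (cong₂ _+ᶻ_ (ℤₚ.pos-* b (suc e)) (sym (ℤₚ.*-identityˡ (+ suc m)))))
    (cong +_ (sym (ℕₚ.*-identityˡ (suc n)))))))
  le)

module _ (a₀ : ℕ) (w′ : List ℕ) where

  private w = a₀ ∷ w′
  open Lines (length w′) (nth w)
  open OptimalCycle a₀ w′ using (optimal)

  conc-≤-scaled : ∀ {d} (Γ : Grid d) (ε : ℚᵘ) → ε ℚ.> 0ℚᵘ → ∃[ Δ ] (conc w Γ ℚ.≤ (mkℚᵘ (+ K d) 0 ℚ.* conc {1} w Δ) ℚ.+ ε)
  conc-≤-scaled {d} Γ ε ε>0 with optimal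
  ... | Δ , opt = Δ , ℚₚ.≤-trans (scaled-≤⁺ (K d) a (n ∸ 1) b′ (m ∸ 1) le) (ℚₚ.p≤p+q (mkℚᵘ (+ K d) 0 ℚ.* conc w Δ) ε {{ℚₚ.pos⇒nonNeg ε {{ℚ.positive ε>0}}}})
    where
    a = appearances w Δ
    b′ = appearances w Γ
    n = size (shape Δ)
    m = size (shape Γ)
    arr₁ : ∀ D b n → D * (b * n) ≡ D * b * n
    arr₁ = ℕ-Ring.solve-∀
    arr₂ : ∀ μ k m n → 2 * μ * (k * m) * n ≡ k * m * (2 * μ * n)
    arr₂ = ℕ-Ring.solve-∀
    arr₃ : ∀ k m D a → k * m * (D * a) ≡ D * (k * a * m)
    arr₃ = ℕ-Ring.solve-∀
    open ℕₚ.≤-Reasoning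
    le : b′ * suc (n ∸ 1) ≤ K d * a * suc (m ∸ 1)
    le = subst₂ (λ x y → b′ * x ≤ K d * a * y) (sym (suc-size Δ)) (sym (suc-size Γ)) (ℕₚ.*-cancelˡ-≤ D {{ℕ.>-nonZero D-pos}} (begin
      D * (b′ * n)                            ≡⟨ arr₁ D b′ n ⟩
      D * b′ * n                              ≤⟨ ℕₚ.*-monoˡ-≤ n (GridLines.appearances-upper a₀ w′ Γ) ⟩
      2 * multiplicity * (K d * m) * n        ≡⟨ arr₂ multiplicity (K d) m n ⟩
      K d * m * (2 * multiplicity * n)        ≤⟨ ℕₚ.*-monoʳ-≤ (K d * m) opt ⟩
      K d * m * (D * a)                       ≡⟨ arr₃ (K d) m D a ⟩
      D * (K d * a * m)                       ∎))

  multiplicity-pos : 1 ≤ multiplicity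
  multiplicity-pos with does (reads? bwd (nth w) 0)
  ... | true  = s≤s z≤n
  ... | false = s≤s z≤n

  -- A grid within ε of the scaled concentration of the optimal cycle has a small deficit in
  -- `grid-balance`, and that deficit consists of defects.
  few-defects : ∀ {d} (X : ℕ) → 1 ≤ X →
    ((Δ : Grid 1) (ε : ℚᵘ) → ε ℚ.> 0ℚᵘ → ∃[ Γ ] (mkℚᵘ (+ K d) 0 ℚ.* conc w Δ ℚ.≤ conc {d} w Γ ℚ.+ ε)) →
    ∃[ Γ ] + X *ᶻ GridLines.totalDefects a₀ w′ {d} Γ ≤ᶻ GridLines.G a₀ w′ Γ
  few-defects {d} X 1≤X approximate with optimal
  -- ε = 1 / (2DX): the defects, weighted by `multiplicity`, total at most 2D ε |G| = |G| / X.
  ... | Δ , opt with approximate Δ (mkℚᵘ (+ 1) (ℕ.pred (2 * D * X))) (ℚ.*<* (ℤ.+<+ (s≤s z≤n)))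
  ...   | Γ , le = Γ , X-bound
    where
    open GridLines a₀ w′ Γ using (totalDefects; totalDefects≥0; grid-balance; G)
    E = 2 * D * X
    a = appearances w Δ
    b′ = appearances w Γ
    n = size (shape Δ)
    m = size (shape Γ)
    μ = multiplicity
    2D-pos : 1 ≤ 2 * D
    2D-pos = ℕₚ.*-mono-≤ {1} {2} (s≤s z≤n) D-pos
    E≡ : suc (ℕ.pred E) ≡ E
    E≡ = ℕₚ.suc-pred E {{ℕ.>-nonZero (ℕₚ.*-mono-≤ {1} 2D-pos 1≤X)}}
    le′ : K d * a * (m * E) ≤ (b′ * E + m) * n
    le′ = subst₂ (λ x y → K d * a * (x * E) ≤ (b′ * E + x) * y) (suc-size Γ) (suc-size Δ)
      (subst (λ y → K d * a * (suc (m ∸ 1) * y) ≤ (b′ * y + suc (m ∸ 1)) * suc (n ∸ 1)) E≡ (≤-scaled⁻ (K d) a (n ∸ 1) b′ (m ∸ 1) (ℕ.pred E) le))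
    arr₁ : ∀ μ n k m e → n * (2 * μ * (k * (m * e))) ≡ k * (m * e) * (2 * μ * n)
    arr₁ = ℕ-Ring.solve-∀
    arr₂ : ∀ D k a x → k * x * (D * a) ≡ D * (k * a * x)
    arr₂ = ℕ-Ring.solve-∀
    arr₃ : ∀ D x n → D * (x * n) ≡ n * (D * x)
    arr₃ = ℕ-Ring.solve-∀
    nearly : 2 * μ * (K d * (m * E)) ≤ D * (b′ * E + m)
    nearly = ℕₚ.*-cancelˡ-≤ n {{ℕ.>-nonZero (size-pos (shapePos Δ))}} (begin
      n * (2 * μ * (K d * (m * E)))      ≡⟨ arr₁ μ n (K d) m E ⟩
      K d * (m * E) * (2 * μ * n)        ≤⟨ ℕₚ.*-monoʳ-≤ (K d * (m * E)) opt ⟩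
      K d * (m * E) * (D * a)            ≡⟨ arr₂ D (K d) a (m * E) ⟩
      D * (K d * a * (m * E))            ≤⟨ ℕₚ.*-monoʳ-≤ D le′ ⟩
      D * ((b′ * E + m) * n)             ≡⟨ arr₃ D (b′ * E + m) n ⟩
      n * (D * (b′ * E + m))             ∎)
      where open ℕₚ.≤-Reasoning
    nearlyᶻ : (+ 2) *ᶻ + μ *ᶻ (+ K d *ᶻ (G *ᶻ + E)) ≤ᶻ + D *ᶻ (+ b′ *ᶻ + E +ᶻ G)
    nearlyᶻ = subst₂ _≤ᶻ_
      (trans (ℤₚ.pos-* (2 * μ) (K d * (m * E))) (cong₂ _*ᶻ_ (ℤₚ.pos-* 2 μ) (trans (ℤₚ.pos-* (K d) (m * E)) (cong (+ K d *ᶻ_) (ℤₚ.pos-* m E)))))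
      (trans (ℤₚ.pos-* D (b′ * E + m)) (cong (+ D *ᶻ_) (trans (ℤₚ.pos-+ (b′ * E) m) (cong (_+ᶻ G) (ℤₚ.pos-* b′ E)))))
      (ℤ.+≤+ nearly)
    E-split : + E ≡ (+ 2) *ᶻ + D *ᶻ + X
    E-split = trans (ℤₚ.pos-* (2 * D) X) (cong (_*ᶻ + X) (ℤₚ.pos-* 2 D))
    ring : ∀ e μ t D b k g → e *ᶻ (μ *ᶻ t) +ᶻ (+ 2) *ᶻ (D *ᶻ (b *ᶻ e +ᶻ g) -ᶻ (+ 2) *ᶻ μ *ᶻ (k *ᶻ (g *ᶻ e))) ≡
           e *ᶻ (((+ 2) *ᶻ (D *ᶻ b) +ᶻ μ *ᶻ t) -ᶻ (+ 4) *ᶻ (μ *ᶻ (k *ᶻ g))) +ᶻ (+ 2) *ᶻ D *ᶻ g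
    ring = ℤ-Ring.solve-∀
    vanish : ∀ e x y → x ≡ y → e *ᶻ (x -ᶻ y) ≡ 0ℤ
    vanish e x .x refl = trans (cong (e *ᶻ_) (ℤₚ.+-inverseʳ x)) (ℤₚ.*-zeroʳ e)
    E-bound : + E *ᶻ (+ μ *ᶻ totalDefects) ≤ᶻ (+ 2) *ᶻ + D *ᶻ G
    E-bound = ≤-by ((+ 2) *ᶻ (+ D *ᶻ (+ b′ *ᶻ + E +ᶻ G) -ᶻ (+ 2) *ᶻ + μ *ᶻ (+ K d *ᶻ (G *ᶻ + E))))
      (0≤-* {+ 2} 0≤+ (∸-nonneg nearlyᶻ))
      (sym (trans (ring (+ E) (+ μ) totalDefects (+ D) (+ b′) (+ K d) G)
        (trans (cong (_+ᶻ (+ 2) *ᶻ + D *ᶻ G) (vanish (+ E) _ _ grid-balance)) (ℤₚ.+-identityˡ ((+ 2) *ᶻ + D *ᶻ G)))))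
    Xμ-bound : + X *ᶻ (+ μ *ᶻ totalDefects) ≤ᶻ G
    Xμ-bound = ℤₚ.*-cancelˡ-≤-pos (+ X *ᶻ (+ μ *ᶻ totalDefects)) G (+ (2 * D)) {{ℤ.positive (ℤ.+<+ 2D-pos)}}
      (subst₂ _≤ᶻ_ (trans (cong (_*ᶻ (+ μ *ᶻ totalDefects)) E-split) (trans (ℤₚ.*-assoc ((+ 2) *ᶻ + D) (+ X) (+ μ *ᶻ totalDefects)) (cong (_*ᶻ (+ X *ᶻ (+ μ *ᶻ totalDefects))) (sym (ℤₚ.pos-* 2 D)))))
                   (cong (_*ᶻ G) (sym (ℤₚ.pos-* 2 D))) E-bound)
    total≤ : totalDefects ≤ᶻ + μ *ᶻ totalDefects
    total≤ = subst (_≤ᶻ + μ *ᶻ totalDefects) (ℤₚ.*-identityˡ totalDefects)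
      (ℤₚ.*-monoʳ-≤-nonNeg totalDefects {{ℤ.nonNegative totalDefects≥0}} (ℤ.+≤+ multiplicity-pos))
    X-bound : + X *ᶻ totalDefects ≤ᶻ G
    X-bound = ℤₚ.≤-trans (*-monoˡ X total≤) Xμ-bound

-- Here L = 4l² and H = 8l², so B₀ = (2H)² = 256 l⁴ and the left side is at most 8 · 2l · 257 l⁴ =
-- 4112 l⁵.
polynomial-bound : ∀ l D y → 1 ≤ l → D ≤ l + l → l ^ 8 ≤ y → let L = (l + l) * l + (l + l) * l; H = L + L in
                   8 * D * suc ((H + H) * (H + H)) < 2 ^ 46 * y
polynomial-bound l D y 1≤l D≤ l⁸≤y = begin-strict
  8 * D * suc (B l)                        ≤⟨ ℕₚ.*-mono-≤ (ℕₚ.*-monoʳ-≤ 8 D≤) sucB≤ ⟩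
  8 * (l + l) * (257 * (l ^ 4))            ≡⟨ arr₁ l ⟩
  4112 * l ^ 5                             ≤⟨ ℕₚ.*-monoʳ-≤ 4112 (ℕₚ.^-monoʳ-≤ l {{ℕ.>-nonZero 1≤l}} (ℕₚ.m≤m+n 5 3)) ⟩
  4112 * l ^ 8                             ≤⟨ ℕₚ.*-monoʳ-≤ 4112 l⁸≤y ⟩
  4112 * y                                 <⟨ ℕₚ.*-monoˡ-< y {{ℕ.>-nonZero (ℕₚ.≤-trans (ℕₚ.m^n>0 l {{ℕ.>-nonZero 1≤l}} 8) l⁸≤y)}} (ℕₚ.≤ᵇ⇒≤ 4113 (2 ^ 46) _) ⟩
  2 ^ 46 * y                               ∎
  where
  open ℕₚ.≤-Reasoning
  B : ℕ → ℕ
  B l = let L = (l + l) * l + (l + l) * l; H = L + L in (H + H) * (H + H)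
  arr₀ : ∀ l → (((l + l) * l + (l + l) * l + ((l + l) * l + (l + l) * l)) + ((l + l) * l + (l + l) * l + ((l + l) * l + (l + l) * l))) *
               (((l + l) * l + (l + l) * l + ((l + l) * l + (l + l) * l)) + ((l + l) * l + (l + l) * l + ((l + l) * l + (l + l) * l))) ≡ 256 * (l * (l * (l * (l * 1))))
  arr₀ = ℕ-Ring.solve-∀
  arr₁ : ∀ l → 8 * (l + l) * (257 * (l * (l * (l * (l * 1))))) ≡ 4112 * (l * (l * (l * (l * (l * 1)))))
  arr₁ = ℕ-Ring.solve-∀
  sucB≤ : suc (B l) ≤ 257 * (l ^ 4)
  sucB≤ = ℕₚ.≤-trans (ℕₚ.≤-reflexive (cong suc (arr₀ l))) (ℕₚ.+-monoˡ-≤ (256 * l ^ 4) (ℕₚ.m^n>0 l {{ℕ.>-nonZero 1≤l}} 4))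

-- The condition d ≥ 8 log₂ ℓ + 47 is expressed as ℓ⁸ ≤ 2^(d - 47), with 47 ≤ d making the truncated
-- subtraction faithful.
not-slantable : (w : List ℕ) → IsWord w → (d : ℕ) → 47 ≤ d → length w ^ 8 ≤ 2 ^ (d ∸ 47) → ¬ Slantable d w
not-slantable []       (_ , _ , _ , () , _)
not-slantable (a₀ ∷ w′) (A , B , A≢B , A∈w , B∈w) (suc d) 47≤d ℓ⁸≤ (_ , approximate) =
  contradict (few-defects a₀ w′ (suc (N * N * C)) (s≤s z≤n) approximate)
  where
  open Lines (length w′) (nth (a₀ ∷ w′))
  open LetterCount (length w′) (nth (a₀ ∷ w′)) A using (C; H; L; L-def)
  y = 2 ^ (suc d ∸ 47)
  -- Half the number of cube points, factored so that y can be compared with ℓ⁸.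
  N = 2 ^ 46 * y
  1≤N : 1 ≤ N
  1≤N = ℕₚ.*-mono-≤ (ℕₚ.m^n>0 2 46) (ℕₚ.m^n>0 2 (suc d ∸ 47))
  2^d≡ : 2 ^ suc d ≡ N + N
  2^d≡ = trans (cong (2 ^_) (sym (ℕₚ.m+[n∸m]≡n 47≤d))) (trans (ℕₚ.^-distribˡ-+-* 2 47 (suc d ∸ 47)) (double (2 ^ 46) y))
    where
    double : ∀ c y → (2 * c) * y ≡ c * y + c * y
    double = ℕ-Ring.solve-∀
  contradict : ∃[ Γ ] + suc (N * N * C) *ᶻ GridLines.totalDefects a₀ w′ {suc d} Γ ≤ᶻ GridLines.G a₀ w′ Γ → ⊥
  contradict (Γ , few) = ℕₚ.<⇒≱ small (Discrepancy.N-bound a₀ w′ Γ A N A≢B A∈w B∈w 1≤N 2^d≡ (Vec.replicate (suc d) pos) refl few)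
    where
    small : 8 * D * suc ((H + H) * (H + H)) < N
    small = subst (λ x → 8 * D * suc ((x + x + (x + x)) * (x + x + (x + x))) < N) (sym L-def)
      (polynomial-bound (length (a₀ ∷ w′)) D y (s≤s z≤n) D≤ ℓ⁸≤)

-- Part (b)

prime-divisor : ∀ g → 2 ≤ g → ∃[ p ] Prime p × p ∣ g
prime-divisor g 2≤g with factorise g {{ℕ.>-nonZero (ℕₚ.≤-trans (s≤s z≤n) 2≤g)}}
... | record { factors = [] ; isFactorisation = eq } = ⊥-elim (ℕₚ.<⇒≢ 2≤g (sym eq))
... | record { factors = p ∷ ps ; isFactorisation = refl ; factorsPrime = p-prime ∷ᴬ _ } = p , p-prime , m∣m*n _

-- A common divisor above 1 has a prime factor p. It divides n, so B ≤ p, and it divides c, so p ≤ c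
-- < B.
coprime-below : ∀ {n c B} → 1 ≤ n → 1 ≤ c → c < B → (∀ p → Prime p → p ∣ n → B ≤ p) → Coprime n c
coprime-below {n} {c} 1≤n 1≤c c<B large {zero}        (0∣n , _) = ⊥-elim (ℕₚ.<⇒≢ 1≤n (sym (lem 0∣n)))
  where
  lem : 0 ∣ n → n ≡ 0
  lem (divides k eq) = trans eq (ℕₚ.*-zeroʳ k)
coprime-below 1≤n 1≤c c<B large {suc zero}    _ = refl
coprime-below {n} {c} 1≤n 1≤c c<B large {g@(suc (suc _))} (g∣n , g∣c) with prime-divisor g (s≤s (s≤s z≤n))
... | p , p-prime , p∣g = ⊥-elim (ℕₚ.<⇒≱ c<B (ℕₚ.≤-trans (large p p-prime (∣-trans p∣g g∣n)) (∣⇒≤ {{ℕ.>-nonZero 1≤c}} (∣-trans p∣g g∣c))))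

-- The linear form with coefficients 1, 2, 4, ...

binary : ∀ {d} → Vec ℤ d → ℤ
binary []      = 0ℤ
binary (a ∷ h) = a +ᶻ (+ 2) *ᶻ binary h

binaryℕ : ∀ {d} → Vec ℕ d → ℕ
binaryℕ []      = 0
binaryℕ (x ∷ p) = x + 2 * binaryℕ p

binary-⊙ : ∀ {d} k (h : Vec ℤ d) → binary (k ⊙ h) ≡ k *ᶻ binary h
binary-⊙ k []      = sym (ℤₚ.*-zeroʳ k)
binary-⊙ k (a ∷ h) = trans (cong (λ x → k *ᶻ a +ᶻ (+ 2) *ᶻ x) (binary-⊙ k h)) (lem k a (binary h))
  where
  lem : ∀ k a x → k *ᶻ a +ᶻ (+ 2) *ᶻ (k *ᶻ x) ≡ k *ᶻ (a +ᶻ (+ 2) *ᶻ x)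
  lem = ℤ-Ring.solve-∀

binary-zeros : ∀ d → binary (Vec.replicate d 0ℤ) ≡ 0ℤ
binary-zeros zero    = refl
binary-zeros (suc d) = cong (λ x → 0ℤ +ᶻ (+ 2) *ᶻ x) (binary-zeros d)

binary-bound : ∀ {d} (v : Vec Dir d) → abs (binary ⟦ v ⟧) < 2 ^ d
binary-bound []      = s≤s z≤n
binary-bound {suc d} (a ∷ v) = begin-strict
  abs (dirℤ a +ᶻ (+ 2) *ᶻ binary ⟦ v ⟧)         ≤⟨ ℤₚ.∣i+j∣≤∣i∣+∣j∣ (dirℤ a) ((+ 2) *ᶻ binary ⟦ v ⟧) ⟩
  abs (dirℤ a) + abs ((+ 2) *ᶻ binary ⟦ v ⟧)      ≡⟨ cong (λ z → abs (dirℤ a) + z) (ℤₚ.∣i*j∣≡∣i∣*∣j∣ (+ 2) (binary ⟦ v ⟧)) ⟩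
  abs (dirℤ a) + 2 * abs (binary ⟦ v ⟧)           <⟨ s≤s (ℕₚ.+-monoˡ-≤ (2 * abs (binary ⟦ v ⟧)) (dir≤1 a)) ⟩
  2 + 2 * abs (binary ⟦ v ⟧)                    ≡⟨ ℕₚ.*-suc 2 (abs (binary ⟦ v ⟧)) ⟨
  2 * suc (abs (binary ⟦ v ⟧))                    ≤⟨ ℕₚ.*-monoʳ-≤ 2 (binary-bound v) ⟩
  2 ^ suc d                                   ∎
  where
  open ℕₚ.≤-Reasoning
  dir≤1 : ∀ a → abs (dirℤ a) ≤ 1
  dir≤1 neg = ℕₚ.≤-refl
  dir≤1 zer = z≤n
  dir≤1 pos = ℕₚ.≤-refl

odd≢0 : ∀ a c → abs a ≡ 1 → a +ᶻ (+ 2) *ᶻ c ≢ 0ℤ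
odd≢0 a c ∣a∣≡1 eq = even≢1 (abs c) (trans (sym (ℤₚ.∣i*j∣≡∣i∣*∣j∣ (+ 2) c)) (trans (cong abs 2c≡-a) (trans (ℤₚ.∣-i∣≡∣i∣ a) ∣a∣≡1)))
  where
  lem : ∀ a c → (+ 2) *ᶻ c ≡ (a +ᶻ (+ 2) *ᶻ c) +ᶻ (-ᶻ a)
  lem = ℤ-Ring.solve-∀
  2c≡-a : (+ 2) *ᶻ c ≡ -ᶻ a
  2c≡-a = trans (lem a c) (trans (cong (_+ᶻ (-ᶻ a)) eq) (ℤₚ.+-identityˡ (-ᶻ a)))
  even≢1 : ∀ n → 2 * n ≢ 1
  even≢1 zero    ()
  even≢1 (suc n) eq′ = ℕₚ.0≢1+n (sym (ℕₚ.suc-injective (trans (sym (ℕₚ.*-suc 2 n)) eq′)))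

-- Leading zero coordinates only contribute a power of 2; after dividing it out, the first
-- coordinate ±1 makes the value odd.
binary-nonzero : ∀ {d} (v : Vec Dir d) → isNonzero v ≡ true → binary ⟦ v ⟧ ≢ 0ℤ
binary-nonzero (neg ∷ v) nz = odd≢0 -1ℤ (binary ⟦ v ⟧) refl
binary-nonzero (pos ∷ v) nz = odd≢0 1ℤ (binary ⟦ v ⟧) refl
binary-nonzero (zer ∷ v) nz eq with ℤₚ.i*j≡0⇒i≡0∨j≡0 (+ 2) (trans (sym (ℤₚ.+-identityˡ ((+ 2) *ᶻ binary ⟦ v ⟧))) eq)
... | inj₂ c≡0 = binary-nonzero v nz c≡0

module Slant (m : ℕ) (d : ℕ) (large : ∀ p → Prime p → p ∣ suc (suc m) → 2 ^ d ≤ p) (A B : ℕ) (A≢B : A ≢ B) where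

  n : ℕ
  n = suc (suc m)

  w′ : List ℕ
  w′ = replicate (suc m) B

  open Lines (length w′) (nth (A ∷ w′))

  ℓ≡n : ℓ ≡ n
  ℓ≡n = cong suc (Listₚ.length-replicate (suc m))

  nth-tail : ∀ {i} → suc i < ℓ → nth (A ∷ w′) (suc i) ≡ B
  nth-tail (s≤s i<) = go (suc m) i<
    where
    go : ∀ k {i} → i < length (replicate k B) → nth (replicate k B) i ≡ B
    go (suc k) {zero}  _        = refl
    go (suc k) {suc i} (s≤s i<) = go k i<

  head-unique : ∀ {j} → 1 ≤ j → j < ℓ → nth (A ∷ w′) 0 ≢ nth (A ∷ w′) j
  head-unique {suc j} _ j<ℓ eq = A≢B (trans eq (nth-tail j<ℓ))

  b≡0 : b ≡ 0
  b≡0 = go b refl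
    where
    go : ∀ x → b ≡ x → b ≡ 0
    go zero    eq = eq
    go (suc x) eq = ⊥-elim (head-unique (ℕₚ.m<n⇒0<n∸m b<ℓ) ℓ∸b<ℓ (b-border (s≤s z≤n) ℓ∸b<ℓ (sym (ℕₚ.m∸n+n≡m (ℕₚ.<⇒≤ b<ℓ)))))
      where
      ℓ∸b<ℓ : ℓ ∸ b < ℓ
      ℓ∸b<ℓ = subst (λ y → ℓ ∸ y < ℓ) (sym eq) (s≤s (ℕₚ.m∸n≤m (length w′) x))

  r≤1 : r ≤ 1
  r≤1 = go r refl
    where
    go : ∀ x → r ≡ x → r ≤ 1
    go zero          eq = ℕₚ.≤-trans (ℕₚ.≤-reflexive eq) z≤n
    go (suc zero)    eq = ℕₚ.≤-reflexive eq
    go (suc (suc x)) eq = ⊥-elim (head-unique (s≤s z≤n) 1+x<ℓ (r-pal (s≤s z≤n) 1+x<ℓ (sym eq)))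
      where
      1+x<ℓ : suc x < ℓ
      1+x<ℓ = ℕₚ.<-trans (ℕₚ.≤-reflexive (sym eq)) r<ℓ

  -- A occurs only at the head, so a border is empty and a palindromic prefix has at most one
  -- letter. With q ≤ ℓ′ this gives M ≤ ℓ, hence D = 2ℓ - M ≥ ℓ.
  n≤D : n ≤ D
  n≤D = ℕₚ.≤-trans (ℕₚ.≤-reflexive (sym ℓ≡n)) (ℕₚ.+-cancelʳ-≤ ℓ ℓ D (ℕₚ.≤-trans (ℕₚ.≤-reflexive (sym D+M)) (ℕₚ.+-monoʳ-≤ D M≤ℓ)))
    where
    M≤ℓ : M ≤ ℓ
    M≤ℓ = M-lub (ℕₚ.≤-trans (ℕₚ.≤-reflexive (cong (λ x → x + x) b≡0)) z≤n)
      (ℕₚ.≤-trans (ℕₚ.+-mono-≤ (ℕₚ.≤-pred q<ℓ) r≤1) (ℕₚ.≤-reflexive (ℕₚ.+-comm (length w′) 1)))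

  multiplicity≡1 : multiplicity ≡ 1
  multiplicity≡1 = cong (λ c → if c then 2 else 1) (dec-false (reads? bwd (nth (A ∷ w′)) 0)
    (λ R → head-unique (ℕₚ.≤-trans (s≤s z≤n) (ℕₚ.≤-reflexive (sym (Listₚ.length-replicate (suc m))))) ℕₚ.≤-refl (R (s≤s z≤n))))

  Divisible : ℤ → Set
  Divisible x = ∃[ k ] x ≡ k *ᶻ + n

  divisible⇒∣ : ∀ {x} → Divisible x → n ∣ abs x
  divisible⇒∣ (k , eq) = divides (abs k) (trans (cong abs eq) (ℤₚ.∣i*j∣≡∣i∣*∣j∣ k (+ n)))

  ∣⇒divisible : ∀ {x} → n ∣ x → Divisible (+ x)
  ∣⇒divisible (divides k eq) = + k , trans (cong +_ eq) (ℤₚ.pos-* k n)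

  slantLabel : Vec ℕ d → ℕ
  slantLabel p = if does (n ∣? binaryℕ p) then A else B

  Γ : Grid d
  Γ = record { shape = Vec.replicate d n ; shapePos = positive d ; label = slantLabel }
    where
    positive : ∀ e → All (1 ≤_) (Vec.replicate e n)
    positive zero    = []
    positive (suc e) = s≤s z≤n ∷ positive e

  open GridLines A w′ Γ using (line; found; ∑-appearances; P; T; ns; G)

  -- Reducing a coordinate modulo n changes the form by a multiple of n, so its residue is well
  -- defined on the torus.
  binary-translate : ∀ {e} h (p : Vec ℕ e) → ∃[ k ] + binaryℕ (translate (Vec.replicate e n) h p) ≡ (+ binaryℕ p +ᶻ binary h) +ᶻ k *ᶻ + n
  binary-translate []      []      = 0ℤ , refl
  binary-translate {suc e} (a ∷ h) (x ∷ p) with modᶻ-decompose (+ x +ᶻ a) n (s≤s z≤n) | binary-translate h p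
  ... | k , eq | k′ , eq′ = k +ᶻ (+ 2) *ᶻ k′ , (begin
      + (y + 2 * binaryℕ p₁)                                                       ≡⟨ cast y (binaryℕ p₁) ⟩
      + y +ᶻ (+ 2) *ᶻ + binaryℕ p₁                                                ≡⟨ cong₂ (λ s t → s +ᶻ (+ 2) *ᶻ t) eq eq′ ⟩
      (+ x +ᶻ a +ᶻ k *ᶻ + n) +ᶻ (+ 2) *ᶻ ((+ binaryℕ p +ᶻ binary h) +ᶻ k′ *ᶻ + n)  ≡⟨ lem (+ x) a k k′ (+ binaryℕ p) (binary h) (+ n) ⟩
      ((+ x +ᶻ (+ 2) *ᶻ + binaryℕ p) +ᶻ (a +ᶻ (+ 2) *ᶻ binary h)) +ᶻ (k +ᶻ (+ 2) *ᶻ k′) *ᶻ + n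
        ≡⟨ cong (λ s → (s +ᶻ (a +ᶻ (+ 2) *ᶻ binary h)) +ᶻ (k +ᶻ (+ 2) *ᶻ k′) *ᶻ + n) (sym (cast x (binaryℕ p))) ⟩
      (+ (x + 2 * binaryℕ p) +ᶻ (a +ᶻ (+ 2) *ᶻ binary h)) +ᶻ (k +ᶻ (+ 2) *ᶻ k′) *ᶻ + n ∎)
    where
    open ≡-Reasoning
    y = (+ x +ᶻ a) modᶻ n
    p₁ = translate (Vec.replicate e n) h p
    cast : ∀ x z → + (x + 2 * z) ≡ + x +ᶻ (+ 2) *ᶻ + z
    cast x z = trans (ℤₚ.pos-+ x (2 * z)) (cong (+ x +ᶻ_) (ℤₚ.pos-* 2 z))
    lem : ∀ x a k k′ b h n → (x +ᶻ a +ᶻ k *ᶻ n) +ᶻ (+ 2) *ᶻ ((b +ᶻ h) +ᶻ k′ *ᶻ n) ≡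
          ((x +ᶻ (+ 2) *ᶻ b) +ᶻ (a +ᶻ (+ 2) *ᶻ h)) +ᶻ (k +ᶻ (+ 2) *ᶻ k′) *ᶻ n
    lem = ℤ-Ring.solve-∀

  ring-⁺ : ∀ j k n → j *ᶻ n +ᶻ k *ᶻ n ≡ (j +ᶻ k) *ᶻ n
  ring-⁺ = ℤ-Ring.solve-∀

  translate-divisible : ∀ h p → Divisible (+ binaryℕ p +ᶻ binary h) → n ∣ binaryℕ (T h p)
  translate-divisible h p (j , eqⱼ) with binary-translate h p
  ... | k , eq = divisible⇒∣ (j +ᶻ k , trans eq (trans (cong (_+ᶻ k *ᶻ + n) eqⱼ) (ring-⁺ j k (+ n))))

  translate-divisible⁻ : ∀ h p → n ∣ binaryℕ p → n ∣ binaryℕ (T h p) → n ∣ abs (binary h)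
  translate-divisible⁻ h p n∣p n∣Tp with ∣⇒divisible n∣p | ∣⇒divisible n∣Tp | binary-translate h p
  ... | j , eqⱼ | i , eqᵢ | k , eq = divisible⇒∣ (i -ᶻ j -ᶻ k ,
    trans (lem₁ (binary h) (+ binaryℕ p) (k *ᶻ + n)) (trans (cong₂ (λ s t → s -ᶻ t -ᶻ k *ᶻ + n) (trans (sym eq) eqᵢ) eqⱼ) (lem₂ i j k (+ n))))
    where
    lem₁ : ∀ h b y → h ≡ ((b +ᶻ h) +ᶻ y) -ᶻ b -ᶻ y
    lem₁ = ℤ-Ring.solve-∀
    lem₂ : ∀ i j k n → i *ᶻ n -ᶻ j *ᶻ n -ᶻ k *ᶻ n ≡ (i -ᶻ j -ᶻ k) *ᶻ n
    lem₂ = ℤ-Ring.solve-∀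

  slant-reads : ∀ v → isNonzero v ≡ true → ∀ p → n ∣ binaryℕ p → Reads fwd (line v p) 0
  slant-reads v nz p n∣p {zero} _ = cong (λ c → if c then A else B) (dec-true (n ∣? binaryℕ (T (+ 0 ⊙ ⟦ v ⟧) p))
    (translate-divisible (+ 0 ⊙ ⟦ v ⟧) p (subst Divisible (sym (trans (cong (+ binaryℕ p +ᶻ_) (binary-⊙ 0ℤ ⟦ v ⟧)) (lem (+ binaryℕ p) (binary ⟦ v ⟧)))) (∣⇒divisible n∣p))))
    where
    lem : ∀ x c → x +ᶻ 0ℤ *ᶻ c ≡ x
    lem = ℤ-Ring.solve-∀
  slant-reads v nz p n∣p {suc i} i<ℓ = trans (cong (λ c → if c then A else B) (dec-false (n ∣? binaryℕ (T (+ suc i ⊙ ⟦ v ⟧) p)) indivisible)) (sym (nth-tail i<ℓ))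
    where
    c = abs (binary ⟦ v ⟧)
    c≢0 : c ≢ 0
    c≢0 eq = binary-nonzero v nz (ℤₚ.∣i∣≡0⇒i≡0 eq)
    indivisible : ¬ n ∣ binaryℕ (T (+ suc i ⊙ ⟦ v ⟧) p)
    -- Divisibility at both ends would give n ∣ (i + 1) c. As c is coprime to n, n would divide i +
    -- 1, which is smaller than n.
    indivisible n∣Tp = ℕₚ.<⇒≱ (subst (suc i <_) ℓ≡n i<ℓ) (∣⇒≤ (coprime-divisor
      (coprime-below {n} {c} (s≤s z≤n) (ℕₚ.n≢0⇒n>0 c≢0) (binary-bound v) large)
      (subst (n ∣_) (trans (cong abs (binary-⊙ (+ suc i) ⟦ v ⟧)) (trans (ℤₚ.∣i*j∣≡∣i∣*∣j∣ (+ suc i) (binary ⟦ v ⟧)) (ℕₚ.*-comm (suc i) c)))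
        (translate-divisible⁻ (+ suc i ⊙ ⟦ v ⟧) p n∣p n∣Tp))))

  sources : ℤ
  sources = ∑ P (λ p → + indicator (n ∣? binaryℕ p))

  sources≤found : ∀ v → isNonzero v ≡ true → sources ≤ᶻ found v
  sources≤found v nz = ∑-mono P (λ p → pointwise p (n ∣? binaryℕ p) (reads? fwd (line v p) 0))
    where
    pointwise : ∀ p (p? : Dec (n ∣ binaryℕ p)) (r? : Dec (Reads fwd (line v p) 0)) → + indicator p? ≤ᶻ + indicator r?
    pointwise p (no _)     _       = ℤ.+≤+ z≤n
    pointwise p (yes _)    (yes _) = ℤₚ.≤-refl
    pointwise p (yes n∣p) (no ¬r) = ⊥-elim (¬r (slant-reads v nz p n∣p))

  appearances-sources : (+ 2) *ᶻ + K d *ᶻ sources ≤ᶻ + appearances (A ∷ w′) Γ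
  appearances-sources = begin
    (+ 2) *ᶻ + K d *ᶻ sources                               ≡⟨ cong (_*ᶻ sources) (∑-nonzero-K d) ⟨
    ∑ (allDirVecs d) nonzero *ᶻ sources                     ≡⟨ ∑-*ʳ (allDirVecs d) sources nonzero ⟨
    ∑ (allDirVecs d) (λ v → nonzero v *ᶻ sources)           ≤⟨ ∑-mono (allDirVecs d) pointwise ⟩
    ∑ (allDirVecs d) (λ v → nonzero v *ᶻ found v)           ≡⟨ ∑-appearances ⟨
    + appearances (A ∷ w′) Γ                                ∎
    where
    open ℤₚ.≤-Reasoning
    pointwise : ∀ v → nonzero v *ᶻ sources ≤ᶻ nonzero v *ᶻ found v
    pointwise v with isNonzero v in eq
    ... | true  = *-monoˡ 1 (sources≤found v eq)
    ... | false = ℤₚ.≤-refl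

  -- Along e the form grows by 1, so one of the n translates of any p lies in the residue class 0.
  -- Averaging over p shows that this class has density at least 1 / n.
  size≤sources : (e : Vec ℤ d) → binary e ≡ 1ℤ → G ≤ᶻ + n *ᶻ sources
  size≤sources e e≡1 = begin
    G                                                              ≡⟨ ℤₚ.*-identityʳ G ⟨
    G *ᶻ 1ℤ                                                        ≡⟨ ∑-positions-const ns 1ℤ ⟨
    ∑ P (λ _ → 1ℤ)                                                 ≤⟨ ∑-mono P pointwise ⟩
    ∑ P (λ p → ∑ R (λ t → + indicator (n ∣? binaryℕ (T (+ t ⊙ e) p)))) ≡⟨ ∑-swap P R (λ p t → + indicator (n ∣? binaryℕ (T (+ t ⊙ e) p))) ⟩
    ∑ R (λ t → ∑ P (λ p → + indicator (n ∣? binaryℕ (T (+ t ⊙ e) p)))) ≡⟨ ∑-cong R (λ t → ∑-translate ns (+ t ⊙ e) (λ p → + indicator (n ∣? binaryℕ p))) ⟩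
    ∑ R (λ _ → sources)                                            ≡⟨ ∑-const R sources ⟩
    + length R *ᶻ sources                                          ≡⟨ cong (λ k → + k *ᶻ sources) (Listₚ.length-downFrom n) ⟩
    + n *ᶻ sources                                                 ∎
    where
    open ℤₚ.≤-Reasoning
    R = downFrom n
    pointwise : ∀ p → 1ℤ ≤ᶻ ∑ R (λ t → + indicator (n ∣? binaryℕ (T (+ t ⊙ e) p)))
    pointwise p with modᶻ-decompose (-ᶻ (+ binaryℕ p)) n (s≤s z≤n)
    ... | k , eq = ℤₚ.≤-trans (ℤₚ.≤-reflexive (sym (cong (λ c → + (if c then 1 else 0)) (dec-true (n ∣? binaryℕ (T (+ t ⊙ e) p)) hit))))
                              (∑-term (λ t → + indicator (n ∣? binaryℕ (T (+ t ⊙ e) p))) (λ _ → 0≤+) (∈-downFrom⁺ (n%ℕd<d (-ᶻ (+ binaryℕ p)) n)))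
      where
      -- The number of unit steps that brings the form at p to 0 modulo n.
      t = (-ᶻ (+ binaryℕ p)) modᶻ n
      lem : ∀ x y → x +ᶻ (-ᶻ x +ᶻ y) ≡ y
      lem = ℤ-Ring.solve-∀
      hit : n ∣ binaryℕ (T (+ t ⊙ e) p)
      hit = translate-divisible (+ t ⊙ e) p (k , trans
        (cong (+ binaryℕ p +ᶻ_) (trans (binary-⊙ (+ t) e) (trans (cong (+ t *ᶻ_) e≡1) (trans (ℤₚ.*-identityʳ (+ t)) eq))))
        (lem (+ binaryℕ p) (k *ᶻ + n)))

  slant-appearances : (e : Vec ℤ d) → binary e ≡ 1ℤ → 2 * K d * size ns ≤ n * appearances (A ∷ w′) Γ
  slant-appearances e e≡1 = ℤₚ.drop‿+≤+ (begin
    + (2 * K d * size ns)                       ≡⟨ trans (ℤₚ.pos-* (2 * K d) (size ns)) (cong (_*ᶻ G) (ℤₚ.pos-* 2 (K d))) ⟩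
    (+ 2) *ᶻ + K d *ᶻ G                         ≤⟨ subst₂ _≤ᶻ_ (cong (_*ᶻ G) (ℤₚ.pos-* 2 (K d))) (cong (_*ᶻ (+ n *ᶻ sources)) (ℤₚ.pos-* 2 (K d))) (*-monoˡ (2 * K d) (size≤sources e e≡1)) ⟩
    (+ 2) *ᶻ + K d *ᶻ (+ n *ᶻ sources)          ≡⟨ lem (+ K d) (+ n) sources ⟩
    + n *ᶻ ((+ 2) *ᶻ + K d *ᶻ sources)          ≤⟨ *-monoˡ n appearances-sources ⟩
    + n *ᶻ + appearances (A ∷ w′) Γ             ≡⟨ ℤₚ.pos-* n (appearances (A ∷ w′) Γ) ⟨
    + (n * appearances (A ∷ w′) Γ)              ∎)
    where
    open ℤₚ.≤-Reasoning
    lem : ∀ k n s → (+ 2) *ᶻ k *ᶻ (n *ᶻ s) ≡ n *ᶻ ((+ 2) *ᶻ k *ᶻ s)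
    lem = ℤ-Ring.solve-∀

  slant-lower : 2 * K d * size ns ≤ n * appearances (A ∷ w′) Γ → ∀ (Δ : Grid 1) (ε : ℚᵘ) → ε ℚ.> 0ℚᵘ →
                ∃[ Γ′ ] (mkℚᵘ (+ K d) 0 ℚ.* conc (A ∷ w′) Δ ℚ.≤ conc {d} (A ∷ w′) Γ′ ℚ.+ ε)
  slant-lower many Δ ε ε>0 = Γ , ℚₚ.≤-trans (≤-scaled⁺ (K d) a (x ∸ 1) c (y ∸ 1) le) (ℚₚ.p≤p+q (conc (A ∷ w′) Γ) ε {{ℚₚ.pos⇒nonNeg ε {{ℚ.positive ε>0}}}})
    where
    a = appearances (A ∷ w′) Δ
    c = appearances (A ∷ w′) Γ
    x = size (shape Δ)
    y = size ns
    upper : n * a ≤ 2 * x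
    -- `K 1` and `multiplicity` are both 1, so with n ≤ D the general upper bound says that C₁(w) is
    -- at most 2 / n.
    upper = ℕₚ.≤-trans (ℕₚ.*-monoˡ-≤ a n≤D) (ℕₚ.≤-trans (GridLines.appearances-upper A w′ Δ)
      (ℕₚ.≤-reflexive (cong₂ (λ μ z → 2 * μ * z) multiplicity≡1 (ℕₚ.*-identityˡ x))))
    arr₁ : ∀ n k a y → n * (k * a * y) ≡ k * y * (n * a)
    arr₁ = ℕ-Ring.solve-∀
    arr₂ : ∀ k y x → k * y * (2 * x) ≡ 2 * k * y * x
    arr₂ = ℕ-Ring.solve-∀
    open ℕₚ.≤-Reasoning
    le : K d * a * suc (y ∸ 1) ≤ c * suc (x ∸ 1)
    le = subst₂ (λ s t → K d * a * s ≤ c * t) (sym (suc-size Γ)) (sym (suc-size Δ)) (ℕₚ.*-cancelˡ-≤ n (begin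
      n * (K d * a * y)      ≡⟨ arr₁ n (K d) a y ⟩
      K d * y * (n * a)      ≤⟨ ℕₚ.*-monoʳ-≤ (K d * y) upper ⟩
      K d * y * (2 * x)      ≡⟨ arr₂ (K d) y x ⟩
      2 * K d * y * x        ≤⟨ ℕₚ.*-monoˡ-≤ x many ⟩
      n * c * x              ≡⟨ ℕₚ.*-assoc n c x ⟩
      n * (c * x)            ∎))

slantable : (d ℓ : ℕ) → 1 < ℓ → ((p : ℕ) → Prime p → p ∣ ℓ → 2 ^ d ≤ p) →
            (A B : ℕ) → A ≢ B → Slantable d (A ∷ replicate (ℓ ∸ 1) B)
slantable d (suc zero)    (s≤s ())
slantable d (suc (suc m)) 1<ℓ large A B A≢B = conc-≤-scaled A (replicate (suc m) B) , Slant.slant-lower m d large A B A≢B (many d large)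
  where
  many : ∀ d (large : ∀ p → Prime p → p ∣ suc (suc m) → 2 ^ d ≤ p) →
         2 * K d * size (Vec.replicate d (suc (suc m))) ≤ suc (suc m) * appearances (A ∷ replicate (suc m) B) (Slant.Γ m d large A B A≢B)
  -- Dimension 0 has no vector on which the form is 1, but `K 0` is 0.
  many zero    large = z≤n
  many (suc d) large = Slant.slant-appearances m (suc d) large A B A≢B (1ℤ ∷ Vec.replicate d 0ℤ) (cong (λ x → 1ℤ +ᶻ (+ 2) *ᶻ x) (binary-zeros d))

theorem1p5 : ((w : List ℕ) → IsWord w → (d : ℕ) →
    47 ≤ d → length w ^ 8 ≤ 2 ^ (d ∸ 47) → ¬ Slantable d w)
    × ((d ℓ : ℕ) → 1 < ℓ → ((p : ℕ) → Prime p → p ∣ ℓ → 2 ^ d ≤ p) →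
    (A B : ℕ) → A ≢ B → Slantable d (A ∷ replicate (ℓ ∸ 1) B))
theorem1p5 = not-slantable , slantable
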